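{- Let $m\geqslant 2$, $k\geqslant 2$ and $n\geqslant 2m^k$. Write $\lambda=n\bmod m^k$ and $\lambda=\nu m^{k-1}+\mu$ with $0\leqslant\nu<m$ and $0\leqslant\mu<m^{k-1}$. Then the number of $\equiv_k$-equivalence classes of the set $\{(p_U,s_U)\mid U \text{ a factor of length } n \text{ of } \mathbf{t}_m\}$ equals \[(m^{k-1}-1)(m^3-m^2+m)+\begin{cases} b^{(1)}_{\mathbf{t}_m}(m+\nu), & \text{if }\mu=0;\\ m, &\text{otherwise.}\end{cases}\]
   Context: $\mathcal{A}_m=\{0,\ldots,m-1\}=\mathbb{Z}/m\mathbb{Z}$; $\sigma_m$ is the morphism $\sigma_m(i)=i\,(i+1)\cdots(i+m-1)$ (letters mod $m$), and $\mathbf{t}_m=\lim_{j\to\infty}\sigma_m^j(0)$. For $j\geqslant1$ and a factor $U$ of $\mathbf{t}_m$, a factorization $U=x\sigma_m^j(u)y$ is a $\sigma_m^j$-factorization if there is a factor $aub$ of $\mathbf{t}_m$ with $a,b\in\mathcal{A}_m\cup\{\varepsilon\}$, $x$ a proper suffix of $\sigma_m^j(a)$ and $y$ a proper prefix of $\sigma_m^j(b)$ ($\varepsilon$ counts as proper prefix/suffix of itself). Every factor $U$ of length $\geqslant 2m^k$ has a unique $\sigma_m^k$-factorization $U=p_U\sigma_m^k(u)s_U$, defining $(p_U,s_U)$. $\sim_1$ is abelian equivalence. $(p_1,s_1)\equiv_k(p_2,s_2)$ if there exist words $x,y,p,q,r,t$ with $|x|,|y|<m^{k-1}$, $(p_1,s_1)=(x\sigma_m^{k-1}(p),\sigma_m^{k-1}(q)y)$,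 $(p_2,s_2)=(x\sigma_m^{k-1}(r),\sigma_m^{k-1}(t)y)$, and one of $pq\sim_1 rt$, $pq\sim_1 rt\,\sigma_m(0)$, $pq\,\sigma_m(0)\sim_1 rt$ holds. $b^{(1)}_{\mathbf{t}_m}(n)$ is the abelian complexity: the number of $\sim_1$-classes of length-$n$ factors of $\mathbf{t}_m$. -}

module Defs where

open import Data.Nat using (ℕ; zero; suc; _+_; _*_; _∸_; _^_; _<_; _%_)
open import Data.Nat.Properties using (_≟_)
open import Data.List using (List; []; _∷_; _++_; map; concatMap; upTo; length)
open import Data.List.Relation.Unary.All using (All)
open import Data.List.Relation.Unary.Any using (Any)
open import Data.List.Relation.Unary.AllPairs using (AllPairs)
open import Data.Maybe using (Maybe; just; nothing)
open import Data.Product using (Σ; ∃; _×_; _,_)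
open import Data.Sum using (_⊎_)
open import Relation.Nullary using (¬_; yes; no)
open import Relation.Binary.PropositionalEquality using (_≡_)

Word : Set
Word = List ℕ

-- reduction modulo m (letters of A_m = Z/mZ are represented by 0 .. m-1)
modN : ℕ → ℕ → ℕ
modN zero    x = x
modN (suc m) x = x % suc m

σ : ℕ → ℕ → Word
σ m i = map (λ j → modN m (i + j)) (upTo m)

σpow : ℕ → ℕ → Word → Word
σpow m zero    w = w
σpow m (suc j) w = concatMap (σ m) (σpow m j w)

at : Word → ℕ → ℕ
at []      _       = 0
at (a ∷ w) zero    = a
at (a ∷ w) (suc i) = at w i

-- t_m = lim σ_m^j(0); σ_m^j(0) is a prefix of σ_m^{j+1}(0) of length m^j,
-- and m^(i+1) > i for m ≥ 2, so the i-th letter of t_m is read off σ_m^(i+1)(0).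
t : ℕ → ℕ → ℕ
t m i = at (σpow m (suc i) (0 ∷ [])) i

slice : ℕ → ℕ → ℕ → Word
slice m i n = map (λ j → t m (i + j)) (upTo n)

IsFactor : ℕ → Word → Set
IsFactor m U = ∃ λ i → U ≡ slice m i (length U)

-- proper prefix / suffix (ε counts as a proper prefix/suffix of itself)
ProperSuffix : Word → Word → Set
ProperSuffix x w = ∃ λ z → (w ≡ z ++ x) × (length x < length w ⊎ w ≡ [])

ProperPrefix : Word → Word → Set
ProperPrefix y w = ∃ λ z → (w ≡ y ++ z) × (length y < length w ⊎ w ≡ [])

opt : Maybe ℕ → Word
opt nothing  = []
opt (just a) = a ∷ []

IsFactorization : ℕ → ℕ → Word → Word → Word → Word → Set
IsFactorization m j U x u y =
  (U ≡ x ++ σpow m j u ++ y) ×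
  (∃ λ (a : Maybe ℕ) → ∃ λ (b : Maybe ℕ) →
     All (_< m) (opt a) × All (_< m) (opt b) ×
     IsFactor m (opt a ++ u ++ opt b) ×
     ProperSuffix x (σpow m j (opt a)) ×
     ProperPrefix y (σpow m j (opt b)))

PSPairs : ℕ → ℕ → ℕ → Word × Word → Set
PSPairs m k n (p , s) =
  ∃ λ U → IsFactor m U × (length U ≡ n) × ∃ λ u → IsFactorization m k U p u s

occ : ℕ → Word → ℕ
occ a [] = 0
occ a (b ∷ w) with a ≟ b
... | yes _ = suc (occ a w)
... | no  _ = occ a w

_∼₁_ : Word → Word → Set
u ∼₁ v = ∀ a → occ a u ≡ occ a v

Equivk : ℕ → ℕ → Word × Word → Word × Word → Set
Equivk m k (p₁ , s₁) (p₂ , s₂) =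
  Σ Word λ x → Σ Word λ y → Σ Word λ p → Σ Word λ q → Σ Word λ r → Σ Word λ tt →
    length x < m ^ (k ∸ 1) × length y < m ^ (k ∸ 1) ×
    (p₁ ≡ x ++ σpow m (k ∸ 1) p) × (s₁ ≡ σpow m (k ∸ 1) q ++ y) ×
    (p₂ ≡ x ++ σpow m (k ∸ 1) r) × (s₂ ≡ σpow m (k ∸ 1) tt ++ y) ×
    ((p ++ q) ∼₁ (r ++ tt) ⊎ (p ++ q) ∼₁ (r ++ tt ++ σ m 0) ⊎ (p ++ q ++ σ m 0) ∼₁ (r ++ tt))

NumClasses : {A : Set} → (A → A → Set) → (A → Set) → ℕ → Set
NumClasses {A} R S N = Σ (List A) λ reps →
  (length reps ≡ N) × All S reps × AllPairs (λ a b → ¬ R a b) reps ×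
  (∀ x → S x → Any (R x) reps)

FactorsOfLength : ℕ → ℕ → Word → Set
FactorsOfLength m n U = IsFactor m U × (length U ≡ n)

AbelianComplexity : ℕ → ℕ → ℕ → Set
AbelianComplexity m n N = NumClasses _∼₁_ (FactorsOfLength m n) N

{-# OPTIONS --safe #-}

-- Every pair of letters (a, b) occurs in t_m at every positive distance, so the pairs (p, s) are all the
-- pairs (proper suffix of σᵏ(a), proper prefix of σᵏ(b)) with |p| + |s| ≡ n modulo mᵏ.  Put M = mᵏ⁻¹ and write
-- p = x σᵏ⁻¹(α ⋯ (a−1)) with |x| = e < M, and s = σᵏ⁻¹(b ⋯ (γ−1)) y with |y| = f < M.  Then x determines α if
-- e ≠ 0 and y determines γ if f ≠ 0.  Two words over ℤ/m are abelian equivalent up to copies of σ(0) iff their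
-- vectors of letter multiplicities have the same discrete derivative, and the derivative of the concatenation of
-- the cyclic intervals α ⋯ (a−1) and b ⋯ (γ−1) is [α] + [b] − [a] − [γ].  So the classes are counted by
--   * e, f ≠ 0: α, γ are fixed and δ = b − a is determined, which leaves [a + δ] − [a], giving m classes for
--     each δ ≠ 0 and one class for δ = 0, hence m (m² − m + 1) classes for each of these e;
--   * exactly one of e, f zero (only if μ ≠ 0, once each): up to translation the free part is
--     ±([i] + [j] − [i + j]), giving 1 + m (m − 1) / 2 classes for each of the m values of the fixed letter;
--   * e = f = 0 (only if μ = 0): the derivatives are exactly those of the factors of length m + ν.
module Submission where

open import Defs
open import Data.Nat
open import Data.Nat.DivMod using (_%_; _/_; m%n<n; m≡m%n+[m/n]*n; m/n*n≤m; [m+kn]%n≡m%n; m<n⇒m%n≡m; %-distribˡ-+)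
open import Data.Nat.Induction using (<-rec)
open import Data.Nat.ListAction using (sum)
open import Data.Nat.Properties
open import Data.Nat.Tactic.RingSolver using (solve-∀)
open import Data.List using (List; []; _∷_; _++_; map; length; upTo; applyUpTo; take; drop; concat; replicate; concatMap; cartesianProduct)
open import Data.List.Properties using (length-++; length-map; length-upTo; length-applyUpTo; length-take; length-drop; map-++; map-upTo; map-id-local; upTo-∷ʳ; ++-identityʳ; ++-assoc; ++-conicalˡ; ++-conicalʳ; ∷-injective; concatMap-++; take++drop≡id)
open import Data.List.Membership.Propositional using (_∈_)
open import Data.List.Membership.Propositional.Properties using (∈-∃++; ∈-cartesianProduct⁺; ∈-cartesianProduct⁻; ∈-upTo⁺; ∈-upTo⁻)
open import Data.List.Relation.Unary.All as All using (All; []; _∷_)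
import Data.List.Relation.Unary.All.Properties as All
open import Data.List.Relation.Unary.Any as Any using (Any; here; there)
import Data.List.Relation.Unary.Any.Properties as Any
open import Data.List.Relation.Unary.AllPairs using (AllPairs; []; _∷_)
import Data.List.Relation.Unary.AllPairs.Properties as AllPairs
open import Data.List.Relation.Binary.Pointwise using (Pointwise; []; _∷_; Pointwise-length)
open import Data.List.Relation.Binary.Permutation.Propositional using (_↭_; ↭-sym; ↭-refl; ↭-trans; refl; prep; swap; trans)
import Data.List.Relation.Binary.Permutation.Propositional.Properties as ↭
open import Data.Maybe using (Maybe; just; nothing)
open import Data.Product using (Σ; ∃; _×_; _,_; proj₁; proj₂)
open import Data.Sum using (_⊎_; inj₁; inj₂; [_,_]′)
open import Function using (_∘_)
open import Relation.Binary using (Tri; tri<; tri≈; tri>)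
open import Relation.Binary.PropositionalEquality hiding (trans; [_])
import Relation.Binary.PropositionalEquality as ≡
open import Relation.Nullary using (¬_; yes; no; Dec; contradiction)

-- Counting equivalence classes

-- The summand after (M - 1)(m³ - m² + m) has two different origins. Put A = m (m² - m + 1), the
-- count for a generic e. If μ ≠ 0, there are M - 2 generic values of e, and the other two
-- contribute 2 m (1 + m (m - 1) / 2) = A + m: together they replace one generic value and leave m
-- over. If μ = 0, only e = 0 is exceptional, and the lengths of its two intervals add up to ν or m
-- + ν. A block σ(u) inserted between them does not affect the derivative, so m + ν is a length at
-- which every such derivative is realised by a factor.
--
-- The relation to be counted tolerates one copy of σ(0), while equality of derivatives tolerates
-- any number. The two agree because each word compared consists of two intervals of fewer than m
-- letters.
--
-- A pair (p, s) does not determine the letters that describe it: an empty p fits every a.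
-- Parameters, pairs and factors are therefore linked by correspondences that respect the
-- equivalences, not by bijections.

module _ {A : Set} {R : A → A → Set} where

  numClasses-cong : {S S′ : A → Set} {N : ℕ} → (∀ {x} → S x → S′ x) → (∀ {x} → S′ x → S x) →
    NumClasses R S N → NumClasses R S′ N
  numClasses-cong to from (reps , len , ⊆S , sep , cover) =
    reps , len , All.map to ⊆S , sep , λ x → cover x ∘ from

  numClasses-range : {S : A → Set} (f : ℕ → A) (n : ℕ) →
    (∀ {i} → i < n → S (f i)) →
    (∀ {i j} → i < n → j < n → R (f i) (f j) → i ≡ j) →
    (∀ {x} → S x → ∃ λ i → i < n × R x (f i)) →
    NumClasses R S n
  numClasses-range f n f∈S inj cover =
    applyUpTo f n , length-applyUpTo f n , All.applyUpTo⁺₁ f n f∈S ,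
    AllPairs.applyUpTo⁺₁ f n (λ i<j j<n r → <⇒≢ i<j (inj (<-trans i<j j<n) j<n r)) ,
    λ x x∈S → let (i , i<n , r) = cover x∈S in Any.applyUpTo⁺ f r i<n

  numClasses-⊎ : {S S′ : A → Set} {N N′ : ℕ} → (∀ {x y} → S x → S′ y → ¬ R x y) →
    NumClasses R S N → NumClasses R S′ N′ → NumClasses R (λ x → S x ⊎ S′ x) (N + N′)
  numClasses-⊎ apart (xs , len , xs⊆S , sep , cover) (ys , len′ , ys⊆S′ , sep′ , cover′) =
    xs ++ ys , ≡.trans (length-++ xs) (cong₂ _+_ len len′) ,
    All.++⁺ (All.map inj₁ xs⊆S) (All.map inj₂ ys⊆S′) ,
    AllPairs.++⁺ sep sep′ (All.map (λ x∈S → All.map (apart x∈S) ys⊆S′) xs⊆S) ,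
    λ x → [ Any.++⁺ˡ ∘ cover x , Any.++⁺ʳ xs ∘ cover′ x ]′

  numClasses-⋃ : (S : ℕ → A → Set) (N : ℕ → ℕ) (n : ℕ) →
    (∀ {i j x y} → i < n → j < n → S i x → S j y → R x y → i ≡ j) →
    (∀ {i} → i < n → NumClasses R (S i) (N i)) →
    NumClasses R (λ x → ∃ λ i → i < n × S i x) (sum (applyUpTo N n))
  numClasses-⋃ S N zero    apart count = [] , refl , [] , [] , λ { x (i , () , _) }
  numClasses-⋃ S N (suc n) apart count =
    numClasses-cong
      (λ { (inj₁ s) → 0 , z<s , s ; (inj₂ (i , i<n , s)) → suc i , s<s i<n , s })
      (λ { (zero , _ , s) → inj₁ s ; (suc i , s<s i<n , s) → inj₂ (i , i<n , s) })
      (numClasses-⊎ (λ { s (i , i<n , s′) r → 0≢1+n (apart z<s (s<s i<n) s s′ r) })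
        (count z<s)
        (numClasses-⋃ (S ∘ suc) (N ∘ suc) n
          (λ i<n j<n s s′ r → suc-injective (apart (s<s i<n) (s<s j<n) s s′ r))
          (count ∘ s<s)))

  -- Greedy choice: an element joins the representatives only if it is related to none of them. This
  -- serves the case in which the number of classes is not computed but only identified with another
  -- count.
  numClasses-finite : (∀ {x} → R x x) → (∀ x y → Dec (R x y)) → (xs : List A) →
    ∃ λ N → NumClasses R (_∈ xs) N
  numClasses-finite R-refl R? [] = 0 , [] , refl , [] , [] , λ _ ()
  numClasses-finite R-refl R? (x ∷ xs) with numClasses-finite R-refl R? xs
  ... | N , reps , len , reps⊆xs , sep , cover with Any.any? (R? x) reps
  ...   | yes p = N , reps , len , All.map there reps⊆xs , sep ,
                  λ { y (here refl) → p ; y (there y∈xs) → cover y y∈xs }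
  ...   | no ¬p = suc N , x ∷ reps , cong suc len , here refl ∷ All.map there reps⊆xs ,
                  All.¬Any⇒All¬ reps ¬p ∷ sep ,
                  λ { y (here refl) → here R-refl ; y (there y∈xs) → there (cover y y∈xs) }

module _ {A B : Set} {R : A → A → Set} {R′ : B → B → Set} {S : A → Set} {S′ : B → Set} where

  -- `G` may be many-to-many. Since `to` and `from` hold for all `G`-partners, the partners chosen
  -- by `total` and `onto` do not influence the count.
  numClasses-transfer : (G : A → B → Set) →
    (∀ {x} → S x → ∃ λ y → S′ y × G x y) →
    (∀ {y} → S′ y → ∃ λ x → S x × G x y) →
    (∀ {x x′ y y′} → S x → S x′ → S′ y → S′ y′ → G x y → G x′ y′ → R x x′ → R′ y y′) →
    (∀ {x x′ y y′} → S x → S x′ → S′ y → S′ y′ → G x y → G x′ y′ → R′ y y′ → R x x′) →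
    ∀ {N} → NumClasses R S N → NumClasses R′ S′ N
  numClasses-transfer G total onto to from (xs , len , xs⊆S , sep , cover) =
    let (ys , c) = image xs⊆S in
    ys , ≡.trans (sym (Pointwise-length c)) len , image⊆S′ c , image-sep c sep ,
    λ y y∈S′ → let (x , x∈S , g) = onto y∈S′ in image-cover c x∈S y∈S′ g (cover x x∈S)
    where
    C : A → B → Set
    C x y = S x × S′ y × G x y

    image : ∀ {xs} → All S xs → ∃ λ ys → Pointwise C xs ys
    image []          = [] , []
    image (x∈S ∷ xs⊆S) =
      let (y , y∈S′ , g) = total x∈S ; (ys , c) = image xs⊆S in y ∷ ys , (x∈S , y∈S′ , g) ∷ c

    image⊆S′ : ∀ {xs ys} → Pointwise C xs ys → All S′ ys
    image⊆S′ []                  = []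
    image⊆S′ ((_ , y∈S′ , _) ∷ c) = y∈S′ ∷ image⊆S′ c

    image-apart : ∀ {x y xs ys} → C x y → Pointwise C xs ys →
      All (λ x′ → ¬ R x x′) xs → All (λ y′ → ¬ R′ y y′) ys
    image-apart _ [] [] = []
    image-apart c₀@(s , s′ , g) ((s₁ , s₁′ , g₁) ∷ c) (¬r ∷ ¬rs) =
      (λ r′ → ¬r (from s s₁ s′ s₁′ g g₁ r′)) ∷ image-apart c₀ c ¬rs

    image-sep : ∀ {xs ys} → Pointwise C xs ys →
      AllPairs (λ x x′ → ¬ R x x′) xs → AllPairs (λ y y′ → ¬ R′ y y′) ys
    image-sep []       []           = []
    image-sep (c₀ ∷ c) (¬rs ∷ sep) = image-apart c₀ c ¬rs ∷ image-sep c sep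

    image-cover : ∀ {x y xs ys} → Pointwise C xs ys → S x → S′ y → G x y →
      Any (R x) xs → Any (R′ y) ys
    image-cover ((s₁ , s₁′ , g₁) ∷ c) s s′ g (here r)  = here (to s s₁ s′ s₁′ g g₁ r)
    image-cover (_ ∷ c)               s s′ g (there p) = there (image-cover c s s′ g p)

-- Abelian equivalence

occ-∷ : ∀ z x w → occ z (x ∷ w) ≡ occ z (x ∷ []) + occ z w
occ-∷ z x w with z ≟ x
... | yes _ = refl
... | no  _ = refl

occ-++ : ∀ z u v → occ z (u ++ v) ≡ occ z u + occ z v
occ-++ z []      v = refl
occ-++ z (x ∷ u) v = begin
  occ z (x ∷ u ++ v)                    ≡⟨ occ-∷ z x (u ++ v) ⟩
  occ z (x ∷ []) + occ z (u ++ v)       ≡⟨ cong (occ z (x ∷ []) +_) (occ-++ z u v) ⟩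
  occ z (x ∷ []) + (occ z u + occ z v)  ≡⟨ +-assoc (occ z (x ∷ [])) _ _ ⟨
  occ z (x ∷ []) + occ z u + occ z v    ≡⟨ cong (_+ occ z v) (occ-∷ z x u) ⟨
  occ z (x ∷ u) + occ z v               ∎
  where open ≡-Reasoning

occ-head : ∀ x w → occ x (x ∷ w) ≡ suc (occ x w)
occ-head x w with x ≟ x
... | yes _  = refl
... | no x≢x = contradiction refl x≢x

occ-∉ : ∀ {z x} → z ≢ x → occ z (x ∷ []) ≡ 0
occ-∉ {z} {x} z≢x with z ≟ x
... | yes z≡x = contradiction z≡x z≢x
... | no _    = refl

↭⇒∼ : ∀ {u v} → u ↭ v → u ∼₁ v
↭⇒∼ refl z = refl
↭⇒∼ (prep {xs} {ys} x p) z =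
  ≡.trans (occ-∷ z x xs) (≡.trans (cong (occ z (x ∷ []) +_) (↭⇒∼ p z)) (sym (occ-∷ z x ys)))
↭⇒∼ (swap {xs} {ys} x y p) z = begin
  occ z (x ∷ y ∷ xs)                            ≡⟨ occ-++ z (x ∷ y ∷ []) xs ⟩
  occ z (x ∷ y ∷ []) + occ z xs                 ≡⟨ cong₂ _+_ (occ-∷ z x (y ∷ [])) (↭⇒∼ p z) ⟩
  occ z (x ∷ []) + occ z (y ∷ []) + occ z ys    ≡⟨ cong (_+ occ z ys) (+-comm (occ z (x ∷ [])) _) ⟩
  occ z (y ∷ []) + occ z (x ∷ []) + occ z ys    ≡⟨ cong (_+ occ z ys) (occ-∷ z y (x ∷ [])) ⟨
  occ z (y ∷ x ∷ []) + occ z ys                 ≡⟨ occ-++ z (y ∷ x ∷ []) ys ⟨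
  occ z (y ∷ x ∷ ys)                            ∎
  where open ≡-Reasoning
↭⇒∼ (trans p q) z = ≡.trans (↭⇒∼ p z) (↭⇒∼ q z)

occ>0⇒∈ : ∀ z w → 0 < occ z w → z ∈ w
occ>0⇒∈ z (x ∷ w) 0<o with z ≟ x
... | yes z≡x = here z≡x
... | no _    = there (occ>0⇒∈ z w 0<o)

-- Permutations are the working form of abelian equivalence: they can be mapped, cancelled and
-- decided, whereas `∼₁` quantifies over all natural numbers.
∼⇒↭ : ∀ u v → u ∼₁ v → u ↭ v
∼⇒↭ [] []      u∼v = ↭-refl
∼⇒↭ [] (x ∷ v) u∼v = contradiction (≡.trans (u∼v x) (occ-head x v)) 0≢1+n
∼⇒↭ (x ∷ u) v  u∼v
  with ∈-∃++ (occ>0⇒∈ x v (subst (0 <_) (≡.trans (sym (occ-head x u)) (u∼v x)) z<s))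
... | v₁ , v₂ , refl = ↭-trans (prep x (∼⇒↭ u (v₁ ++ v₂) u∼v₁₂)) (↭-sym (↭.shift x v₁ v₂))
  where
  u∼v₁₂ : u ∼₁ (v₁ ++ v₂)
  u∼v₁₂ z = +-cancelˡ-≡ (occ z (x ∷ [])) _ _ (begin
    occ z (x ∷ []) + occ z u            ≡⟨ occ-∷ z x u ⟨
    occ z (x ∷ u)                       ≡⟨ u∼v z ⟩
    occ z (v₁ ++ x ∷ v₂)                ≡⟨ ↭⇒∼ (↭.shift x v₁ v₂) z ⟩
    occ z (x ∷ v₁ ++ v₂)                ≡⟨ occ-∷ z x (v₁ ++ v₂) ⟩
    occ z (x ∷ []) + occ z (v₁ ++ v₂)   ∎)
    where open ≡-Reasoning

↭-dec : ∀ (u v : Word) → Dec (u ↭ v)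
↭-dec [] []      = yes ↭-refl
↭-dec [] (x ∷ v) = no λ p → 0≢1+n (↭.↭-length p)
↭-dec (x ∷ u) v with Any.any? (x ≟_) v
... | no x∉v = no λ p → x∉v (↭.∈-resp-↭ p (here refl))
... | yes x∈v with ∈-∃++ x∈v
...   | v₁ , v₂ , refl with ↭-dec u (v₁ ++ v₂)
...     | yes p = yes (↭-trans (prep x p) (↭-sym (↭.shift x v₁ v₂)))
...     | no ¬p = no λ p → ¬p (↭.drop-∷ (↭-trans p (↭.shift x v₁ v₂)))

↭-cancelʳ : ∀ (u : Word) {v w} → v ++ u ↭ w ++ u → v ↭ w
↭-cancelʳ u {v} {w} p = cancelˡ u (↭-trans (↭.++-comm u v) (↭-trans p (↭.++-comm w u)))
  where
  cancelˡ : ∀ u {v w : Word} → u ++ v ↭ u ++ w → v ↭ w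
  cancelˡ []      p = p
  cancelˡ (x ∷ u) p = cancelˡ u (↭.drop-∷ p)

∈-singleton : ∀ {x y : ℕ} → x ∈ y ∷ [] → x ≡ y
∈-singleton (here x≡y) = x≡y

↭-pair : ∀ {x y x′ y′ : ℕ} → x ∷ y ∷ [] ↭ x′ ∷ y′ ∷ [] → (x ≡ x′ × y ≡ y′) ⊎ (x ≡ y′ × y ≡ x′)
↭-pair {x} {y} {x′} {y′} p with ↭.∈-resp-↭ p (here refl)
... | here refl = inj₁ (refl , ∈-singleton (↭.∈-resp-↭ (↭.drop-∷ p) (here refl)))
... | there (here refl) =
  inj₂ (refl , ∈-singleton (↭.∈-resp-↭ (↭.drop-∷ (↭-trans p (swap x′ x ↭-refl))) (here refl)))

-- Tabulated words and their letter counts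

applyUpTo-cong : ∀ {A : Set} {f g : ℕ → A} n → (∀ {i} → i < n → f i ≡ g i) → applyUpTo f n ≡ applyUpTo g n
applyUpTo-cong zero    f≗g = refl
applyUpTo-cong (suc n) f≗g = cong₂ _∷_ (f≗g z<s) (applyUpTo-cong n (f≗g ∘ s<s))

map-upTo-cong : ∀ {A : Set} {f g : ℕ → A} n → (∀ {i} → i < n → f i ≡ g i) → map f (upTo n) ≡ map g (upTo n)
map-upTo-cong {f = f} {g} n f≗g =
  ≡.trans (map-upTo f n) (≡.trans (applyUpTo-cong n f≗g) (sym (map-upTo g n)))

map-upTo-+ : ∀ {A : Set} (f : ℕ → A) a b →
  map f (upTo (a + b)) ≡ map f (upTo a) ++ map (f ∘ (a +_)) (upTo b)
map-upTo-+ f a b = begin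
  map f (upTo (a + b))                            ≡⟨ map-upTo f (a + b) ⟩
  applyUpTo f (a + b)                             ≡⟨ apply f a ⟩
  applyUpTo f a ++ applyUpTo (f ∘ (a +_)) b       ≡⟨ cong₂ _++_ (map-upTo f a) (map-upTo _ b) ⟨
  map f (upTo a) ++ map (f ∘ (a +_)) (upTo b)     ∎
  where
  open ≡-Reasoning
  apply : ∀ f a → applyUpTo f (a + b) ≡ applyUpTo f a ++ applyUpTo (f ∘ (a +_)) b
  apply f zero    = refl
  apply f (suc a) = cong (f 0 ∷_) (apply (f ∘ suc) a)

length-map-upTo : ∀ {A : Set} (f : ℕ → A) n → length (map f (upTo n)) ≡ n
length-map-upTo f n = ≡.trans (length-map f (upTo n)) (length-upTo n)

occ-≥ : ∀ {z n w} → All (_< n) w → n ≤ z → occ z w ≡ 0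
occ-≥ []                           n≤z = refl
occ-≥ {z} {w = x ∷ w} (x<n ∷ w<n) n≤z = ≡.trans (occ-∷ z x w)
  (cong₂ _+_ (occ-∉ {z} {x} (λ { refl → <⇒≱ x<n n≤z })) (occ-≥ w<n n≤z))

occ-upTo : ∀ {z} n → z < n → occ z (upTo n) ≡ 1
occ-upTo {z} (suc n) z<1+n = ≡.trans (cong (occ z) (sym (upTo-∷ʳ n)))
  (≡.trans (occ-++ z (upTo n) (n ∷ [])) (last (<-cmp z n)))
  where
  last : Tri (z < n) (z ≡ n) (n < z) → occ z (upTo n) + occ z (n ∷ []) ≡ 1
  last (tri< z<n z≢n _)  = cong₂ _+_ (occ-upTo n z<n) (occ-∉ z≢n)
  last (tri≈ _ refl _)   = cong₂ _+_ (occ-≥ (All.all-upTo n) ≤-refl) (occ-head n [])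
  last (tri> _ _ n<z)    = contradiction n<z (≤⇒≯ (s≤s⁻¹ z<1+n))

modN≡% : ∀ m .{{_ : NonZero m}} x → modN m x ≡ x % m
modN≡% (suc m) x = refl

-- Arithmetic modulo m, cyclic intervals, discrete derivatives

module Residues (m : ℕ) (2≤m : 2 ≤ m) where

  instance
    m≢0 : NonZero m
    m≢0 = >-nonZero (≤-trans (s≤s z≤n) 2≤m)

  0<m : 0 < m
  0<m = ≤-trans (s≤s z≤n) 2≤m

  ⟦_⟧ : ℕ → ℕ
  ⟦_⟧ = modN m

  infix 4 _≈_
  _≈_ : ℕ → ℕ → Set
  x ≈ y = ⟦ x ⟧ ≡ ⟦ y ⟧

  private
    via% : ∀ {x y} → x % m ≡ y % m → x ≈ y
    via% {x} {y} p = ≡.trans (modN≡% m x) (≡.trans p (sym (modN≡% m y)))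

    to% : ∀ {x y} → x ≈ y → x % m ≡ y % m
    to% {x} {y} p = ≡.trans (sym (modN≡% m x)) (≡.trans p (modN≡% m y))

  ⟦⟧<m : ∀ x → ⟦ x ⟧ < m
  ⟦⟧<m x = subst (_< m) (sym (modN≡% m x)) (m%n<n x m)

  ⟦⟧-small : ∀ {x} → x < m → ⟦ x ⟧ ≡ x
  ⟦⟧-small {x} x<m = ≡.trans (modN≡% m x) (m<n⇒m%n≡m x<m)

  ⟦⟧-idem : ∀ x → ⟦ x ⟧ ≈ x
  ⟦⟧-idem x = ⟦⟧-small (⟦⟧<m x)

  ≈⇒≡ : ∀ {x y} → x < m → y < m → x ≈ y → x ≡ y
  ≈⇒≡ x<m y<m x≈y = ≡.trans (sym (⟦⟧-small x<m)) (≡.trans x≈y (⟦⟧-small y<m))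

  +k*m : ∀ x k → x + k * m ≈ x
  +k*m x k = via% ([m+kn]%n≡m%n x k m)

  +m : ∀ x → x + m ≈ x
  +m x = ≡.trans (cong (λ l → ⟦ x + l ⟧) (sym (*-identityˡ m))) (+k*m x 1)

  +-cong : ∀ {x x′ y y′} → x ≈ x′ → y ≈ y′ → x + y ≈ x′ + y′
  +-cong {x} {x′} {y} {y′} p q = via% (begin
    (x + y) % m              ≡⟨ %-distribˡ-+ x y m ⟩
    (x % m + y % m) % m      ≡⟨ cong (_% m) (cong₂ _+_ (to% p) (to% q)) ⟩
    (x′ % m + y′ % m) % m    ≡⟨ %-distribˡ-+ x′ y′ m ⟨
    (x′ + y′) % m            ∎)
    where open ≡-Reasoning

  ⟦⟧+ : ∀ x y → ⟦ x ⟧ + y ≈ x + y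
  ⟦⟧+ x y = +-cong (⟦⟧-idem x) refl

  -- Adding `z * pred m` completes `z` to the multiple `z * m`, which does the work of subtracting
  -- `z`.
  +-cancelʳ-≈ : ∀ {x y} z → x + z ≈ y + z → x ≈ y
  +-cancelʳ-≈ {x} {y} z p = begin
    ⟦ x ⟧                        ≡⟨ shift x ⟨
    ⟦ (x + z) + z * pred m ⟧     ≡⟨ +-cong p refl ⟩
    ⟦ (y + z) + z * pred m ⟧     ≡⟨ shift y ⟩
    ⟦ y ⟧                        ∎
    where
    open ≡-Reasoning
    shift : ∀ x → (x + z) + z * pred m ≈ x
    shift x = ≡.trans (cong ⟦_⟧ (begin
      (x + z) + z * pred m     ≡⟨ lemma x z (pred m) ⟩
      x + z * suc (pred m)     ≡⟨ cong (λ k → x + z * k) (suc-pred m) ⟩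
      x + z * m                ∎)) (+k*m x z)
      where
      lemma : ∀ x z k → (x + z) + z * k ≡ x + z * suc k
      lemma = solve-∀

  ≈-cancel : ∀ {x y x′ y′} z → x′ ≈ y′ → x′ ≡ x + z → y′ ≡ y + z → x ≈ y
  ≈-cancel z p refl refl = +-cancelʳ-≈ z p

  -- A representative of -x that is correct for `x ≤ m` and not reduced: `⁻ 0` is `m`.
  ⁻_ : ℕ → ℕ
  ⁻ x = m ∸ x

  ⁻-inverse : ∀ {x} y → x ≤ m → (y + ⁻ x) + x ≈ y
  ⁻-inverse {x} y x≤m =
    ≡.trans (cong ⟦_⟧ (≡.trans (+-assoc y (m ∸ x) x) (cong (y +_) (m∸n+n≡m x≤m)))) (+m y)

  -- The cyclic interval of `l` letters from `s`. By definition `σ m s` is `arc s m`, so facts about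
  -- intervals apply directly to images of letters.
  arc : ℕ → ℕ → Word
  arc s l = map (λ j → ⟦ s + j ⟧) (upTo l)

  arc<m : ∀ s l → All (_< m) (arc s l)
  arc<m s l = All.map⁺ (All.universal (λ j → ⟦⟧<m (s + j)) (upTo l))

  length-arc : ∀ s l → length (arc s l) ≡ l
  length-arc s l = length-map-upTo _ l

  arc-cong : ∀ {s s′} l → s ≈ s′ → arc s l ≡ arc s′ l
  arc-cong l s≈s′ = map-upTo-cong l (λ _ → +-cong s≈s′ refl)

  arc-+ : ∀ s l l′ → arc s (l + l′) ≡ arc s l ++ arc (s + l) l′
  arc-+ s l l′ = ≡.trans (map-upTo-+ _ l l′)
    (cong (arc s l ++_) (map-upTo-cong l′ (λ {i} _ → cong ⟦_⟧ (sym (+-assoc s l i)))))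

  -- w, seen as a vector of multiplicities indexed by ℤ/m, has discrete derivative u − v.
  record Boundary (w u v : Word) : Set where
    field
      balance : ∀ {z} → z < m → occ ⟦ suc z ⟧ w + occ ⟦ suc z ⟧ v ≡ occ z w + occ ⟦ suc z ⟧ u
  open Boundary

  boundary-++ : ∀ {w u v w′ u′ v′} → Boundary w u v → Boundary w′ u′ v′ →
    Boundary (w ++ w′) (u ++ u′) (v ++ v′)
  boundary-++ {w} {u} {v} {w′} {u′} {v′} d d′ .balance {z} z<m = begin
    occ y (w ++ w′) + occ y (v ++ v′)            ≡⟨ cong₂ _+_ (occ-++ y w w′) (occ-++ y v v′) ⟩
    (occ y w + occ y w′) + (occ y v + occ y v′)  ≡⟨ interchange (occ y w) _ _ _ ⟩
    (occ y w + occ y v) + (occ y w′ + occ y v′)  ≡⟨ cong₂ _+_ (balance d z<m) (balance d′ z<m) ⟩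
    (occ z w + occ y u) + (occ z w′ + occ y u′)  ≡⟨ interchange (occ z w) _ _ _ ⟩
    (occ z w + occ z w′) + (occ y u + occ y u′)  ≡⟨ cong₂ _+_ (occ-++ z w w′) (occ-++ y u u′) ⟨
    occ z (w ++ w′) + occ y (u ++ u′)            ∎
    where
    open ≡-Reasoning
    y = ⟦ suc z ⟧
    interchange : ∀ a b c d → (a + b) + (c + d) ≡ (a + c) + (b + d)
    interchange = solve-∀

  boundary-cancel : ∀ {w u} v → Boundary w (u ++ v) v → Boundary w u []
  boundary-cancel {w} {u} v d .balance {z} z<m = +-cancelʳ-≡ (occ y v) _ _ (begin
    (occ y w + 0) + occ y v          ≡⟨ cong (_+ occ y v) (+-identityʳ (occ y w)) ⟩
    occ y w + occ y v                ≡⟨ balance d z<m ⟩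
    occ z w + occ y (u ++ v)         ≡⟨ cong (occ z w +_) (occ-++ y u v) ⟩
    occ z w + (occ y u + occ y v)    ≡⟨ +-assoc (occ z w) _ _ ⟨
    occ z w + occ y u + occ y v      ∎)
    where
    open ≡-Reasoning
    y = ⟦ suc z ⟧

  private
    occ-suc : ∀ x {z} → z < m → occ ⟦ suc z ⟧ (⟦ suc x ⟧ ∷ []) ≡ occ z (⟦ x ⟧ ∷ [])
    occ-suc x {z} z<m with z ≟ ⟦ x ⟧
    ... | yes refl = ≡.trans (cong (λ y → occ y (⟦ suc x ⟧ ∷ [])) (+-cong {1} refl (⟦⟧-idem x)))
                             (occ-head ⟦ suc x ⟧ [])
    ... | no z≢x   = occ-∉ λ p → z≢x (≡.trans (sym (⟦⟧-small z<m))
                       (≈-cancel 1 p (+-comm 1 z) (+-comm 1 x)))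

  -- The multiplicities jump up where the interval starts and down just after it ends. Appending a
  -- letter moves only the second jump, by one place.
  boundary-arc : ∀ s l → Boundary (arc s l) (⟦ s ⟧ ∷ []) (⟦ s + l ⟧ ∷ [])
  boundary-arc s zero    .balance {z} _ = cong (λ x → occ ⟦ suc z ⟧ (⟦ x ⟧ ∷ [])) (+-identityʳ s)
  boundary-arc s (suc l) .balance {z} z<m = begin
    occ y (arc s (suc l)) + occ y (⟦ s + suc l ⟧ ∷ [])      ≡⟨ cong₂ _+_ (snoc y) (cong (λ x → occ y (⟦ x ⟧ ∷ [])) (+-suc s l)) ⟩
    occ y (arc s l) + occ y e + occ y (⟦ suc (s + l) ⟧ ∷ []) ≡⟨ cong₂ _+_ (balance (boundary-arc s l) z<m) (occ-suc (s + l) z<m) ⟩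
    occ z (arc s l) + occ y (⟦ s ⟧ ∷ []) + occ z e          ≡⟨ swap-last (occ z (arc s l)) _ _ ⟩
    occ z (arc s l) + occ z e + occ y (⟦ s ⟧ ∷ [])          ≡⟨ cong (_+ occ y (⟦ s ⟧ ∷ [])) (snoc z) ⟨
    occ z (arc s (suc l)) + occ y (⟦ s ⟧ ∷ [])              ∎
    where
    open ≡-Reasoning
    y = ⟦ suc z ⟧
    e = ⟦ s + l ⟧ ∷ []
    snoc : ∀ x → occ x (arc s (suc l)) ≡ occ x (arc s l) + occ x e
    snoc x = ≡.trans
      (cong (occ x) (≡.trans (cong (map _) (sym (upTo-∷ʳ l))) (map-++ _ (upTo l) (l ∷ []))))
      (occ-++ x (arc s l) e)
    swap-last : ∀ a b c → a + b + c ≡ a + c + b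
    swap-last = solve-∀

  -- A full turn ends just before the letter at which it started, so its two jumps cancel.
  boundary-full : ∀ s → Boundary (σ m s) [] []
  boundary-full s = boundary-cancel (⟦ s ⟧ ∷ [])
    (subst (λ x → Boundary (σ m s) (⟦ s ⟧ ∷ []) (x ∷ [])) (+m s) (boundary-arc s m))

  -- Multiplicities determine the derivative, so u - v = u′ - v′, written without subtraction. The
  -- equation at a letter `y` below `m` is `balance` at its cyclic predecessor; the bounds on
  -- letters settle all other `y`.
  boundary-unique : ∀ {w u v w′ u′ v′} → Boundary w u v → Boundary w′ u′ v′ → w ↭ w′ →
    All (_< m) (u ++ v′) → All (_< m) (u′ ++ v) → u ++ v′ ↭ u′ ++ v
  boundary-unique {w} {u} {v} {w′} {u′} {v′} d d′ w↭w′ <m <m′ = ∼⇒↭ _ _ count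
    where
    count : (u ++ v′) ∼₁ (u′ ++ v)
    count y with y <? m
    ... | no y≮m  = ≡.trans (occ-≥ <m (≮⇒≥ y≮m)) (sym (occ-≥ <m′ (≮⇒≥ y≮m)))
    ... | yes y<m = ≡.trans (occ-++ y u v′) (≡.trans key (sym (occ-++ y u′ v)))
      where
      z = ⟦ y + pred m ⟧
      1+z≡y : ⟦ suc z ⟧ ≡ y
      1+z≡y = begin
        ⟦ suc ⟦ y + pred m ⟧ ⟧   ≡⟨ +-cong {1} refl (⟦⟧-idem (y + pred m)) ⟩
        ⟦ suc (y + pred m) ⟧     ≡⟨ cong ⟦_⟧ (≡.trans (sym (+-suc y (pred m))) (cong (y +_) (suc-pred m))) ⟩
        ⟦ y + m ⟧                ≡⟨ +m y ⟩
        ⟦ y ⟧                    ≡⟨ ⟦⟧-small y<m ⟩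
        y                        ∎
        where open ≡-Reasoning
      at-y : ∀ {w u v} → Boundary w u v → occ y w + occ y v ≡ occ z w + occ y u
      at-y {w} {u} {v} d = subst (λ x → occ x w + occ x v ≡ occ z w + occ x u) 1+z≡y (balance d (⟦⟧<m (y + pred m)))
      arith : ∀ a b u v u′ v′ → a + v ≡ b + u → a + v′ ≡ b + u′ → u + v′ ≡ u′ + v
      arith a b u v u′ v′ p p′ = +-cancelˡ-≡ (a + b) _ _ (begin
        (a + b) + (u + v′)     ≡⟨ shuffle a b u v′ ⟩
        (b + u) + (a + v′)     ≡⟨ cong₂ _+_ (sym p) p′ ⟩
        (a + v) + (b + u′)     ≡⟨ shuffle′ a b u′ v ⟩
        (a + b) + (u′ + v)     ∎)
        where
        open ≡-Reasoning
        shuffle : ∀ a b c d → (a + b) + (c + d) ≡ (b + c) + (a + d)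
        shuffle = solve-∀
        shuffle′ : ∀ a b c d → (a + d) + (b + c) ≡ (a + b) + (c + d)
        shuffle′ = solve-∀
      key : occ y u + occ y v′ ≡ occ y u′ + occ y v
      key = arith (occ y w) (occ z w) _ _ _ _ (at-y d)
        (subst₂ (λ a b → a + occ y v′ ≡ b + occ y u′) (sym (↭⇒∼ w↭w′ y)) (sym (↭⇒∼ w↭w′ z)) (at-y d′))

  -- Words with equal derivatives

  fulls : ℕ → Word
  fulls g = concat (replicate g (σ m 0))

  length-fulls : ∀ g → length (fulls g) ≡ g * m
  length-fulls zero    = refl
  length-fulls (suc g) = ≡.trans (length-++ (σ m 0)) (cong₂ _+_ (length-arc 0 m) (length-fulls g))

  private
    σ0≡upTo : σ m 0 ≡ upTo m
    σ0≡upTo = ≡.trans (map-upTo _ m) (applyUpTo-cong m ⟦⟧-small)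

    occ-fulls : ∀ {z} → z < m → ∀ g → occ z (fulls g) ≡ g
    occ-fulls     z<m zero    = refl
    occ-fulls {z} z<m (suc g) = ≡.trans (occ-++ z (σ m 0) (fulls g))
      (cong₂ _+_ (≡.trans (cong (occ z) σ0≡upTo) (occ-upTo m z<m)) (occ-fulls z<m g))

    fulls<m : ∀ g → All (_< m) (fulls g)
    fulls<m zero    = []
    fulls<m (suc g) = All.++⁺ (arc<m 0 m) (fulls<m g)

  -- A vector with vanishing derivative is constant.
  ↭-up-to-fulls : ∀ {w u v w′ u′ v′} → Boundary w u v → Boundary w′ u′ v′ →
    All (_< m) w → All (_< m) w′ → u ++ v′ ↭ u′ ++ v →
    ∃ λ g → (w ↭ w′ ++ fulls g) ⊎ (w′ ↭ w ++ fulls g)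
  ↭-up-to-fulls {w} {u} {v} {w′} {u′} {v′} d d′ w<m w′<m p = case (≤-total (occ 0 w′) (occ 0 w))
    where
    step : ∀ {z} → suc z < m → occ (suc z) w + occ z w′ ≡ occ z w + occ (suc z) w′
    step {z} 1+z<m = arith (occ y w) (occ y w′) (occ z w) (occ z w′) (occ y u) (occ y v) (occ y u′) (occ y v′)
      (at-y d) (at-y d′) (≡.trans (sym (occ-++ y u v′)) (≡.trans (↭⇒∼ p y) (occ-++ y u′ v)))
      where
      y = suc z
      at-y : ∀ {w u v} → Boundary w u v → occ y w + occ y v ≡ occ z w + occ y u
      at-y {w} {u} {v} d = subst (λ x → occ x w + occ x v ≡ occ z w + occ x u) (⟦⟧-small 1+z<m) (balance d (<-trans (n<1+n z) 1+z<m))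
      arith : ∀ a a′ b b′ u v u′ v′ → a + v ≡ b + u → a′ + v′ ≡ b′ + u′ → u + v′ ≡ u′ + v → a + b′ ≡ b + a′
      arith a a′ b b′ u v u′ v′ p p′ q = +-cancelʳ-≡ (u′ + v) _ _ (begin
        a + b′ + (u′ + v)      ≡⟨ shuffle a b′ u′ v ⟩
        (a + v) + (b′ + u′)    ≡⟨ cong₂ _+_ p (sym p′) ⟩
        (b + u) + (a′ + v′)    ≡⟨ shuffle′ b u a′ v′ ⟩
        b + a′ + (u + v′)      ≡⟨ cong (b + a′ +_) q ⟩
        b + a′ + (u′ + v)      ∎)
        where
        open ≡-Reasoning
        shuffle : ∀ a b c d → a + b + (c + d) ≡ (a + d) + (b + c)
        shuffle = solve-∀
        shuffle′ : ∀ a b c d → (a + b) + (c + d) ≡ a + c + (b + d)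
        shuffle′ = solve-∀

    -- The difference of the two multiplicity vectors keeps its value at letter 0 as `z` climbs to m
    -- - 1. That value, up to sign, is the number of full turns separating the words.
    const : ∀ z → z < m → occ z w + occ 0 w′ ≡ occ 0 w + occ z w′
    const zero    _     = refl
    const (suc z) 1+z<m = arith (occ (suc z) w) (occ (suc z) w′) (occ z w) (occ z w′) _ _
      (step 1+z<m) (const z (<-trans (n<1+n z) 1+z<m))
      where
      arith : ∀ a a′ b b′ c c′ → a + b′ ≡ b + a′ → b + c′ ≡ c + b′ → a + c′ ≡ c + a′
      arith a a′ b b′ c c′ p q = +-cancelʳ-≡ (b + b′) _ _ (begin
        a + c′ + (b + b′)      ≡⟨ shuffle a c′ b b′ ⟩
        (a + b′) + (b + c′)    ≡⟨ cong₂ _+_ p q ⟩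
        (b + a′) + (c + b′)    ≡⟨ shuffle′ b a′ c b′ ⟩
        c + a′ + (b + b′)      ∎)
        where
        open ≡-Reasoning
        shuffle : ∀ a b c d → a + b + (c + d) ≡ (a + d) + (c + b)
        shuffle = solve-∀
        shuffle′ : ∀ a b c d → (a + b) + (c + d) ≡ c + b + (a + d)
        shuffle′ = solve-∀

    excess : ∀ w w′ → All (_< m) w → All (_< m) w′ →
      (∀ z → z < m → occ z w + occ 0 w′ ≡ occ 0 w + occ z w′) → occ 0 w′ ≤ occ 0 w →
      w ↭ w′ ++ fulls (occ 0 w ∸ occ 0 w′)
    excess w w′ w<m w′<m const le = ∼⇒↭ _ _ count
      where
      g = occ 0 w ∸ occ 0 w′
      count : w ∼₁ (w′ ++ fulls g)
      count z with z <? m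
      ... | no z≮m  = ≡.trans (occ-≥ w<m (≮⇒≥ z≮m)) (sym (occ-≥ (All.++⁺ w′<m (fulls<m g)) (≮⇒≥ z≮m)))
      ... | yes z<m = +-cancelʳ-≡ (occ 0 w′) _ _ (begin
        occ z w + occ 0 w′                 ≡⟨ const z z<m ⟩
        occ 0 w + occ z w′                 ≡⟨ +-comm (occ 0 w) _ ⟩
        occ z w′ + occ 0 w                 ≡⟨ cong (occ z w′ +_) (m∸n+n≡m le) ⟨
        occ z w′ + (g + occ 0 w′)          ≡⟨ +-assoc (occ z w′) g _ ⟨
        occ z w′ + g + occ 0 w′            ≡⟨ cong (λ x → occ z w′ + x + occ 0 w′) (occ-fulls z<m g) ⟨
        occ z w′ + occ z (fulls g) + occ 0 w′ ≡⟨ cong (_+ occ 0 w′) (occ-++ z w′ (fulls g)) ⟨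
        occ z (w′ ++ fulls g) + occ 0 w′   ∎)
        where open ≡-Reasoning

    case : occ 0 w′ ≤ occ 0 w ⊎ occ 0 w ≤ occ 0 w′ → ∃ λ g → (w ↭ w′ ++ fulls g) ⊎ (w′ ↭ w ++ fulls g)
    case (inj₁ le) = occ 0 w ∸ occ 0 w′ , inj₁ (excess w w′ w<m w′<m const le)
    case (inj₂ le) = occ 0 w′ ∸ occ 0 w , inj₂ (excess w′ w w′<m w<m const′ le)
      where
      const′ : ∀ z → z < m → occ z w′ + occ 0 w ≡ occ 0 w′ + occ z w
      const′ z z<m = ≡.trans (+-comm (occ z w′) _) (≡.trans (sym (const z z<m)) (+-comm (occ z w) _))

  private
    too-long : ∀ {w w′} g → w ↭ w′ ++ fulls (suc g) → length w ≢ length w′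
    too-long {w} {w′} g q len = <⇒≢ (m<m+n (length w′) (≤-trans 0<m (m≤m+n m (g * m))))
      (≡.trans (sym len) (≡.trans (↭.↭-length q) (≡.trans (length-++ w′) (cong (length w′ +_) (length-fulls (suc g))))))

  -- Each copy of σ(0) adds m > 0 letters, so words of equal length differ by none.
  ↭-from-boundary : ∀ {w u v w′ u′ v′} → Boundary w u v → Boundary w′ u′ v′ →
    All (_< m) w → All (_< m) w′ → u ++ v′ ↭ u′ ++ v → length w ≡ length w′ → w ↭ w′
  ↭-from-boundary {w} {u} {v} {w′} {u′} {v′} d d′ w<m w′<m p len
    with ↭-up-to-fulls d d′ w<m w′<m p
  ... | zero  , inj₁ q = subst (w ↭_) (++-identityʳ w′) q
  ... | zero  , inj₂ q = ↭-sym (subst (w′ ↭_) (++-identityʳ w) q)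
  ... | suc g , inj₁ q = contradiction len (too-long {w} {w′} g q)
  ... | suc g , inj₂ q = contradiction (sym len) (too-long {w′} {w} g q)

-- Cutting concatenations and reading letters

++-injective : ∀ {A : Set} (u u′ : List A) {v v′} → length u ≡ length u′ →
  u ++ v ≡ u′ ++ v′ → u ≡ u′ × v ≡ v′
++-injective []      []        _   eq = refl , eq
++-injective (x ∷ u) (x′ ∷ u′) len eq =
  let (x≡x′ , eq′) = ∷-injective eq ; (u≡u′ , v≡v′) = ++-injective u u′ (suc-injective len) eq′ in
  cong₂ _∷_ x≡x′ u≡u′ , v≡v′

++-injectiveʳ : ∀ {A : Set} (u u′ : List A) {v v′} → length v ≡ length v′ →
  u ++ v ≡ u′ ++ v′ → u ≡ u′ × v ≡ v′
++-injectiveʳ u u′ {v} {v′} len eq = ++-injective u u′ (+-cancelʳ-≡ (length v) _ _ (begin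
  length u + length v     ≡⟨ length-++ u ⟨
  length (u ++ v)         ≡⟨ cong length eq ⟩
  length (u′ ++ v′)       ≡⟨ length-++ u′ ⟩
  length u′ + length v′   ≡⟨ cong (length u′ +_) len ⟨
  length u′ + length v    ∎)) eq
  where open ≡-Reasoning

at-++ˡ : ∀ u v {i} → i < length u → at (u ++ v) i ≡ at u i
at-++ˡ (x ∷ u) v {zero}  _       = refl
at-++ˡ (x ∷ u) v {suc i} (s≤s l) = at-++ˡ u v l

at-++ʳ : ∀ u v i → at (u ++ v) (length u + i) ≡ at v i
at-++ʳ []      v i = refl
at-++ʳ (x ∷ u) v i = at-++ʳ u v i

at-applyUpTo : ∀ f n {i} → i < n → at (applyUpTo f n) i ≡ f i
at-applyUpTo f (suc n) {zero}  _       = refl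
at-applyUpTo f (suc n) {suc i} (s≤s l) = at-applyUpTo (f ∘ suc) n l

at-map-upTo : ∀ f n {i} → i < n → at (map f (upTo n)) i ≡ f i
at-map-upTo f n i<n = ≡.trans (cong (λ w → at w _) (map-upTo f n)) (at-applyUpTo f n i<n)

-- The premise `P 0` covers positions past the end, where `at` returns 0.
All-at : ∀ {P : ℕ → Set} → P 0 → ∀ {w} → All P w → ∀ i → P (at w i)
All-at p0 []       i       = p0
All-at p0 (p ∷ ps) zero    = p
All-at p0 (p ∷ ps) (suc i) = All-at p0 ps i

-- Powers of the morphism, the fixed point and its factors

module Morphism (m : ℕ) (2≤m : 2 ≤ m) where
  open Residues m 2≤m

  length-concatMap-σ : ∀ w → length (concatMap (σ m) w) ≡ length w * m
  length-concatMap-σ []      = refl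
  length-concatMap-σ (x ∷ w) =
    ≡.trans (length-++ (σ m x)) (cong₂ _+_ (length-arc x m) (length-concatMap-σ w))

  length-σpow : ∀ k w → length (σpow m k w) ≡ length w * m ^ k
  length-σpow zero    w = sym (*-identityʳ (length w))
  length-σpow (suc k) w = begin
    length (concatMap (σ m) (σpow m k w))   ≡⟨ length-concatMap-σ (σpow m k w) ⟩
    length (σpow m k w) * m                 ≡⟨ cong (_* m) (length-σpow k w) ⟩
    length w * m ^ k * m                    ≡⟨ *-assoc (length w) (m ^ k) m ⟩
    length w * (m ^ k * m)                  ≡⟨ cong (length w *_) (*-comm (m ^ k) m) ⟩
    length w * (m * m ^ k)                  ∎
    where open ≡-Reasoning

  length-σpow-letter : ∀ k x → length (σpow m k (x ∷ [])) ≡ m ^ k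
  length-σpow-letter k x = ≡.trans (length-σpow k (x ∷ [])) (*-identityˡ (m ^ k))

  σpow-[] : ∀ k → σpow m k [] ≡ []
  σpow-[] zero    = refl
  σpow-[] (suc k) = cong (concatMap (σ m)) (σpow-[] k)

  σpow-++ : ∀ k u v → σpow m k (u ++ v) ≡ σpow m k u ++ σpow m k v
  σpow-++ zero    u v = refl
  σpow-++ (suc k) u v =
    ≡.trans (cong (concatMap (σ m)) (σpow-++ k u v)) (concatMap-++ (σ m) (σpow m k u) (σpow m k v))

  -- `σpow` unfolds by applying σ on the outside. Moving one application inside exhibits the image
  -- of a letter as a sequence of m blocks of length `m ^ k`.
  σpow-suc : ∀ k x → σpow m (suc k) (x ∷ []) ≡ σpow m k (σ m x)
  σpow-suc k x = ≡.trans (inner k (x ∷ [])) (cong (σpow m k) (++-identityʳ (σ m x)))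
    where
    inner : ∀ k w → σpow m (suc k) w ≡ σpow m k (concatMap (σ m) w)
    inner zero    w = refl
    inner (suc k) w = cong (concatMap (σ m)) (inner k w)

  concatMap-σ<m : ∀ w → All (_< m) (concatMap (σ m) w)
  concatMap-σ<m []      = []
  concatMap-σ<m (x ∷ w) = All.++⁺ (arc<m x m) (concatMap-σ<m w)

  map-⟦⟧ : ∀ {w} → All (_< m) w → map ⟦_⟧ w ≡ w
  map-⟦⟧ w<m = map-id-local (All.map ⟦⟧-small w<m)

  -- The first letter of σ(x) is x modulo m. Equality of residues is all that can be expected, as
  -- words may contain numbers beyond the alphabet.
  concatMap-σ-injective : ∀ w v → concatMap (σ m) w ≡ concatMap (σ m) v → map ⟦_⟧ w ≡ map ⟦_⟧ v
  concatMap-σ-injective []      []      eq = refl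
  concatMap-σ-injective []      (x ∷ v) eq = contradiction
    (≡.trans (cong length eq) (length-concatMap-σ (x ∷ v))) (<⇒≢ (≤-trans 0<m (m≤m+n m _)))
  concatMap-σ-injective (x ∷ w) []      eq = contradiction
    (≡.trans (cong length (sym eq)) (length-concatMap-σ (x ∷ w))) (<⇒≢ (≤-trans 0<m (m≤m+n m _)))
  concatMap-σ-injective (x ∷ w) (y ∷ v) eq =
    let (σx≡σy , eq′) = ++-injective (σ m x) (σ m y) (≡.trans (length-arc x m) (sym (length-arc y m))) eq
    in cong₂ _∷_ (head σx≡σy) (concatMap-σ-injective w v eq′)
    where
    at-0 : ∀ x → at (σ m x) 0 ≡ ⟦ x ⟧
    at-0 x = ≡.trans (at-map-upTo _ m 0<m) (cong ⟦_⟧ (+-identityʳ x))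
    head : σ m x ≡ σ m y → x ≈ y
    head p = ≡.trans (sym (at-0 x)) (≡.trans (cong (λ w → at w 0) p) (at-0 y))

  σpow-injective : ∀ k w v → σpow m (suc k) w ≡ σpow m (suc k) v → map ⟦_⟧ w ≡ map ⟦_⟧ v
  σpow-injective zero    w v eq = concatMap-σ-injective w v eq
  σpow-injective (suc k) w v eq = σpow-injective k w v
    (≡.trans (sym (map-⟦⟧ (concatMap-σ<m (σpow m k w))))
      (≡.trans (concatMap-σ-injective (σpow m (suc k) w) (σpow m (suc k) v) eq)
        (map-⟦⟧ (concatMap-σ<m (σpow m k v)))))

  at-concatMap-σ : ∀ w q {r} → q < length w → r < m → at (concatMap (σ m) w) (q * m + r) ≡ ⟦ at w q + r ⟧
  at-concatMap-σ (x ∷ w) zero {r} _ r<m = ≡.trans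
    (at-++ˡ (σ m x) _ (subst (r <_) (sym (length-arc x m)) r<m)) (at-map-upTo _ m r<m)
  at-concatMap-σ (x ∷ w) (suc q) {r} (s≤s q<) r<m = begin
    at (σ m x ++ concatMap (σ m) w) (m + q * m + r)                      ≡⟨ cong (at (σ m x ++ concatMap (σ m) w)) (+-assoc m (q * m) r) ⟩
    at (σ m x ++ concatMap (σ m) w) (m + (q * m + r))                    ≡⟨ cong (λ l → at (σ m x ++ concatMap (σ m) w) (l + (q * m + r))) (length-arc x m) ⟨
    at (σ m x ++ concatMap (σ m) w) (length (σ m x) + (q * m + r))       ≡⟨ at-++ʳ (σ m x) _ _ ⟩
    at (concatMap (σ m) w) (q * m + r)                                   ≡⟨ at-concatMap-σ w q q< r<m ⟩
    ⟦ at w q + r ⟧                                                       ∎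
    where open ≡-Reasoning

  divide : ∀ i → ∃ λ q → ∃ λ r → i ≡ q * m + r × r < m
  divide i = i / m , i % m , ≡.trans (m≡m%n+[m/n]*n i m) (+-comm (i % m) _) , m%n<n i m

  quotient< : ∀ {q r} k → q * m + r < m ^ suc k → q < m ^ k
  quotient< {q} {r} k lt = *-cancelʳ-< m q (m ^ k)
    (≤-<-trans (m≤m+n (q * m) r) (subst (q * m + r <_) (*-comm m (m ^ k)) lt))

  at-σpow-suc : ∀ k x q {r} → q < m ^ k → r < m →
    at (σpow m (suc k) (x ∷ [])) (q * m + r) ≡ ⟦ at (σpow m k (x ∷ [])) q + r ⟧
  at-σpow-suc k x q q< = at-concatMap-σ (σpow m k (x ∷ [])) q (subst (q <_) (sym (length-σpow-letter k x)) q<)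

  -- By induction over the base-m digits of `i`: the letter in that position is x plus the digit sum
  -- of `i`, modulo m, and the shift by the digit sum is injective.
  at-σpow-injective : ∀ k {x y i} → x < m → y < m → i < m ^ k →
    at (σpow m k (x ∷ [])) i ≡ at (σpow m k (y ∷ [])) i → x ≡ y
  at-σpow-injective zero {i = zero} x<m y<m _ eq = eq
  at-σpow-injective zero {i = suc i} x<m y<m (s≤s ()) eq
  at-σpow-injective (suc k) {x} {y} {i} x<m y<m i< eq with divide i
  ... | q , r , refl , r<m = at-σpow-injective k x<m y<m q<
    (≈⇒≡ (letter<m k x x<m) (letter<m k y y<m)
      (+-cancelʳ-≈ r (≡.trans (sym (at-σpow-suc k x q q< r<m)) (≡.trans eq (at-σpow-suc k y q q< r<m)))))
    where
    q< = quotient< {q} {r} k i<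
    letter<m : ∀ k x → x < m → at (σpow m k (x ∷ [])) q < m
    letter<m zero    x x<m = All-at {_< m} 0<m (x<m ∷ []) q
    letter<m (suc k) x x<m = All-at {_< m} 0<m (concatMap-σ<m (σpow m k (x ∷ []))) q

  -- The definition of `t` reads each position from a different power of σ. Independence of the
  -- exponent makes these readings comparable.
  σpow-prefix : ∀ k k′ {i} → i < m ^ k → i < m ^ k′ →
    at (σpow m k (0 ∷ [])) i ≡ at (σpow m k′ (0 ∷ [])) i
  σpow-prefix zero    zero     _  _  = refl
  σpow-prefix zero    (suc k′) {suc i} (s≤s ())
  σpow-prefix zero    (suc k′) {zero} _ _ = sym (≡.trans (at-σpow-suc k′ 0 0 (m^n>0 m k′) 0<m)
    (≡.trans (cong ⟦_⟧ (≡.trans (+-identityʳ _) (sym (σpow-prefix zero k′ z<s (m^n>0 m k′))))) (⟦⟧-small 0<m)))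
  σpow-prefix (suc k) zero     {suc i} _ (s≤s ())
  σpow-prefix (suc k) zero     {zero} _ _ = ≡.trans (at-σpow-suc k 0 0 (m^n>0 m k) 0<m)
    (≡.trans (cong ⟦_⟧ (≡.trans (+-identityʳ _) (σpow-prefix k zero (m^n>0 m k) z<s))) (⟦⟧-small 0<m))
  σpow-prefix (suc k) (suc k′) {i} i< i<′ with divide i
  ... | q , r , refl , r<m = begin
    at (σpow m (suc k) (0 ∷ [])) (q * m + r)     ≡⟨ at-σpow-suc k 0 q q< r<m ⟩
    ⟦ at (σpow m k (0 ∷ [])) q + r ⟧             ≡⟨ cong (λ x → ⟦ x + r ⟧) (σpow-prefix k k′ q< q<′) ⟩
    ⟦ at (σpow m k′ (0 ∷ [])) q + r ⟧            ≡⟨ at-σpow-suc k′ 0 q q<′ r<m ⟨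
    at (σpow m (suc k′) (0 ∷ [])) (q * m + r)    ∎
    where
    open ≡-Reasoning
    q<  = quotient< {q} {r} k i<
    q<′ = quotient< {q} {r} k′ i<′

  n<m^n : ∀ n → n < m ^ n
  n<m^n zero    = z<s
  n<m^n (suc n) = begin
    2 + n              ≤⟨ s≤s (n<m^n n) ⟩
    1 + m ^ n          ≤⟨ +-monoˡ-≤ (m ^ n) (m^n>0 m n) ⟩
    m ^ n + m ^ n      ≡⟨ cong (m ^ n +_) (+-identityʳ (m ^ n)) ⟨
    2 * m ^ n          ≤⟨ *-monoˡ-≤ (m ^ n) 2≤m ⟩
    m * m ^ n          ∎
    where open ≤-Reasoning

  -- The fixed point equation of t under σ, letter by letter.
  t-* : ∀ q {r} → r < m → t m (q * m + r) ≡ ⟦ t m q + r ⟧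
  t-* q {r} r<m = begin
    t m i                                     ≡⟨ at-σpow-suc i 0 q q< r<m ⟩
    ⟦ at (σpow m i (0 ∷ [])) q + r ⟧          ≡⟨ cong (λ x → ⟦ x + r ⟧) (σpow-prefix i (suc q) q< (<-trans (n<1+n q) (n<m^n (suc q)))) ⟩
    ⟦ t m q + r ⟧                             ∎
    where
    open ≡-Reasoning
    i = q * m + r
    q< : q < m ^ i
    q< = ≤-<-trans (≤-trans (m≤m*n q m) (m≤m+n (q * m) r)) (n<m^n i)

  t<m : ∀ i → t m i < m
  t<m i = All-at {_< m} 0<m (concatMap-σ<m (σpow m i (0 ∷ []))) i

  slice-+ : ∀ i l l′ → slice m i (l + l′) ≡ slice m i l ++ slice m (i + l) l′
  slice-+ i l l′ = ≡.trans (map-upTo-+ _ l l′)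
    (cong (slice m i l ++_) (map-upTo-cong l′ (λ {j} _ → cong (t m) (sym (+-assoc i l j)))))

  length-slice : ∀ i l → length (slice m i l) ≡ l
  length-slice i l = length-map-upTo _ l

  slice-∷ : ∀ i l → slice m i (suc l) ≡ t m i ∷ slice m (suc i) l
  slice-∷ i l = ≡.trans (slice-+ i 1 l)
    (cong₂ (λ a j → t m a ∷ slice m j l) (+-identityʳ i) (+-comm i 1))

  slice-arc : ∀ q {r l} → r + l ≤ m → slice m (q * m + r) l ≡ arc (t m q + r) l
  slice-arc q {r} {l} r+l≤m = map-upTo-cong l (λ {i} i<l → begin
    t m (q * m + r + i)       ≡⟨ cong (t m) (+-assoc (q * m) r i) ⟩
    t m (q * m + (r + i))     ≡⟨ t-* q (<-≤-trans (+-monoʳ-< r i<l) r+l≤m) ⟩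
    ⟦ t m q + (r + i) ⟧       ≡⟨ cong ⟦_⟧ (+-assoc (t m q) r i) ⟨
    ⟦ t m q + r + i ⟧         ∎)
    where open ≡-Reasoning

  slice-block : ∀ j l → slice m (j * m) (l * m) ≡ concatMap (σ m) (slice m j l)
  slice-block j zero    = refl
  slice-block j (suc l) = begin
    slice m (j * m) (m + l * m)                           ≡⟨ slice-+ (j * m) m (l * m) ⟩
    slice m (j * m) m ++ slice m (j * m + m) (l * m)      ≡⟨ cong₂ _++_ first (cong (λ i → slice m i (l * m)) (+-comm (j * m) m)) ⟩
    σ m (t m j) ++ slice m (suc j * m) (l * m)            ≡⟨ cong (σ m (t m j) ++_) (slice-block (suc j) l) ⟩
    concatMap (σ m) (t m j ∷ slice m (suc j) l)           ≡⟨ cong (concatMap (σ m)) (slice-∷ j l) ⟨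
    concatMap (σ m) (slice m j (suc l))                   ∎
    where
    open ≡-Reasoning
    first : slice m (j * m) m ≡ σ m (t m j)
    first = begin
      slice m (j * m) m        ≡⟨ cong (λ i → slice m i m) (+-identityʳ (j * m)) ⟨
      slice m (j * m + 0) m    ≡⟨ slice-arc j ≤-refl ⟩
      arc (t m j + 0) m        ≡⟨ cong (λ s → arc s m) (+-identityʳ (t m j)) ⟩
      σ m (t m j)              ∎

  slice-σpow : ∀ k j l → slice m (j * m ^ k) (l * m ^ k) ≡ σpow m k (slice m j l)
  slice-σpow zero    j l = cong₂ (slice m) (*-identityʳ j) (*-identityʳ l)
  slice-σpow (suc k) j l = begin
    slice m (j * (m * m ^ k)) (l * (m * m ^ k))          ≡⟨ cong₂ (slice m) (assoc j) (assoc l) ⟩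
    slice m (j * m ^ k * m) (l * m ^ k * m)              ≡⟨ slice-block (j * m ^ k) (l * m ^ k) ⟩
    concatMap (σ m) (slice m (j * m ^ k) (l * m ^ k))    ≡⟨ cong (concatMap (σ m)) (slice-σpow k j l) ⟩
    concatMap (σ m) (σpow m k (slice m j l))             ∎
    where
    open ≡-Reasoning
    assoc : ∀ j → j * (m * m ^ k) ≡ j * m ^ k * m
    assoc j = ≡.trans (cong (j *_) (*-comm m (m ^ k))) (sym (*-assoc j (m ^ k) m))

  isFactor-slice : ∀ {w} i l → w ≡ slice m i l → IsFactor m w
  isFactor-slice i l refl = i , cong (slice m i) (sym (length-slice i l))

  infix-isFactor : ∀ x w y {i l} → x ++ w ++ y ≡ slice m i l → IsFactor m w
  infix-isFactor x w y {i} {l} eq = isFactor-slice (i + length x) (length w)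
    (proj₁ (++-injective w (slice m (i + length x) (length w)) (sym (length-slice (i + length x) (length w)))
      (proj₂ (++-injective x (slice m i (length x)) (sym (length-slice i (length x))) (≡.trans eq split)))))
    where
    split : slice m i l ≡ slice m i (length x) ++ slice m (i + length x) (length w) ++ slice m (i + length x + length w) (length y)
    split = begin
      slice m i l                                                ≡⟨ cong (slice m i) len ⟩
      slice m i (length x + (length w + length y))               ≡⟨ slice-+ i (length x) _ ⟩
      slice m i (length x) ++ slice m (i + length x) (length w + length y)
        ≡⟨ cong (slice m i (length x) ++_) (slice-+ (i + length x) (length w) (length y)) ⟩
      _ ∎
      where
      open ≡-Reasoning
      len : l ≡ length x + (length w + length y)
      len = ≡.trans (sym (length-slice i l)) (≡.trans (cong length (sym eq))
        (≡.trans (length-++ x) (cong (length x +_) (length-++ w))))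

  -- Pairs of letters at a prescribed distance

  private
    -- Inside a block neighbouring letters differ by 1. Between blocks q and q + 1 the letters are
    -- t(q) - 1 and t(q + 1), so the difference there is one more than that of t(q) and t(q + 1);
    -- induction reaches every difference. The base uses block a, whose first letter is t(a) = a
    -- because t begins with 0 1 ⋯ (m - 1).
    step-occurs : ∀ d a → a < m → ∃ λ j → t m j ≡ a × t m (suc j) ≡ ⟦ a + 1 + d ⟧
    step-occurs zero a a<m = a * m , tj , (begin
      t m (suc (a * m))      ≡⟨ cong (t m) (+-comm 1 (a * m)) ⟩
      t m (a * m + 1)        ≡⟨ t-* a 2≤m ⟩
      ⟦ t m a + 1 ⟧          ≡⟨ cong (λ x → ⟦ x + 1 ⟧) t-a ⟩
      ⟦ a + 1 ⟧              ≡⟨ cong ⟦_⟧ (+-identityʳ (a + 1)) ⟨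
      ⟦ a + 1 + 0 ⟧          ∎)
      where
      open ≡-Reasoning
      t-a : t m a ≡ a
      t-a = ≡.trans (t-* 0 a<m) (≡.trans (cong (λ x → ⟦ x + a ⟧) (σpow-prefix 1 0 (m^n>0 m 1) z<s)) (⟦⟧-small a<m))
      tj : t m (a * m) ≡ a
      tj = ≡.trans (cong (t m) (sym (+-identityʳ (a * m)))) (≡.trans (t-* a 0<m)
        (≡.trans (cong ⟦_⟧ (≡.trans (+-identityʳ _) t-a)) (⟦⟧-small a<m)))
    step-occurs (suc d) a a<m with step-occurs d ⟦ a + 1 ⟧ (⟦⟧<m (a + 1))
    ... | q , tq , tq′ = q * m + pred m , tj , tj′
      where
      open ≡-Reasoning
      suc-pred+ : ∀ a → a + pred m + 1 ≡ a + m
      suc-pred+ a = ≡.trans (+-assoc a (pred m) 1) (cong (a +_) (≡.trans (+-comm (pred m) 1) (suc-pred m)))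
      tj : t m (q * m + pred m) ≡ a
      tj = begin
        t m (q * m + pred m)        ≡⟨ t-* q (≤-reflexive (suc-pred m)) ⟩
        ⟦ t m q + pred m ⟧          ≡⟨ cong (λ x → ⟦ x + pred m ⟧) tq ⟩
        ⟦ ⟦ a + 1 ⟧ + pred m ⟧      ≡⟨ ⟦⟧+ (a + 1) (pred m) ⟩
        ⟦ a + 1 + pred m ⟧          ≡⟨ cong ⟦_⟧ (≡.trans (+-assoc a 1 (pred m)) (cong (a +_) (suc-pred m))) ⟩
        ⟦ a + m ⟧                   ≡⟨ +m a ⟩
        ⟦ a ⟧                       ≡⟨ ⟦⟧-small a<m ⟩
        a                           ∎
      tj′ : t m (suc (q * m + pred m)) ≡ ⟦ a + 1 + suc d ⟧
      tj′ = begin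
        t m (suc (q * m + pred m))  ≡⟨ cong (t m) (≡.trans (+-comm 1 _) (≡.trans (suc-pred+ (q * m)) (≡.trans (+-comm (q * m) m) (sym (+-identityʳ _))))) ⟩
        t m (suc q * m + 0)         ≡⟨ t-* (suc q) 0<m ⟩
        ⟦ t m (suc q) + 0 ⟧         ≡⟨ cong ⟦_⟧ (+-identityʳ (t m (suc q))) ⟩
        ⟦ t m (suc q) ⟧             ≡⟨ cong ⟦_⟧ tq′ ⟩
        ⟦ ⟦ ⟦ a + 1 ⟧ + 1 + d ⟧ ⟧   ≡⟨ ⟦⟧-idem _ ⟩
        ⟦ ⟦ a + 1 ⟧ + 1 + d ⟧       ≡⟨ cong ⟦_⟧ (+-assoc ⟦ a + 1 ⟧ 1 d) ⟩
        ⟦ ⟦ a + 1 ⟧ + suc d ⟧       ≡⟨ ⟦⟧+ (a + 1) (suc d) ⟩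
        ⟦ a + 1 + suc d ⟧           ∎

  -- For distance d > 1, the positions q·m + r and (q + D)·m with d + r = D·m reduce d to D < d.
  pair-occurs : ∀ d {a b} → a < m → b < m → ∃ λ j → t m j ≡ a × t m (j + suc d) ≡ b
  pair-occurs = <-rec _ go
    where
    go : ∀ d → (∀ {d′} → d′ < d → ∀ {a b} → a < m → b < m → ∃ λ j → t m j ≡ a × t m (j + suc d′) ≡ b) →
      ∀ {a b} → a < m → b < m → ∃ λ j → t m j ≡ a × t m (j + suc d) ≡ b
    go zero rec {a} {b} a<m b<m =
      -- The increment is chosen so that a + 1 plus it equals b + m.
      let (j , tj , tj′) = step-occurs (b + pred (m ∸ a)) a a<m in
      j , tj , ≡.trans (cong (t m) (+-comm j 1)) (≡.trans tj′ (≡.trans (cong ⟦_⟧ (wrap b)) (≡.trans (+m b) (⟦⟧-small b<m))))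
      where
      wrap : ∀ b → a + 1 + (b + pred (m ∸ a)) ≡ b + m
      wrap b = begin
        a + 1 + (b + pred (m ∸ a))      ≡⟨ lemma a b (pred (m ∸ a)) ⟩
        b + (suc (pred (m ∸ a)) + a)    ≡⟨ cong (λ x → b + (x + a)) (suc-pred (m ∸ a) {{>-nonZero (m<n⇒0<n∸m a<m)}}) ⟩
        b + (m ∸ a + a)                 ≡⟨ cong (b +_) (m∸n+n≡m (<⇒≤ a<m)) ⟩
        b + m                           ∎
        where
        open ≡-Reasoning
        lemma : ∀ a b c → a + 1 + (b + c) ≡ b + (suc c + a)
        lemma = solve-∀
    go d@(suc d₋₁) rec {a} {b} a<m b<m with divide d
    -- Both `d` and `D` are distances minus one. With r = m - 1 - s, the letter a + s + 1 at q
    -- becomes a at offset r of its block, and d + 1 places further is the first letter of block q +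
    -- D + 1, which is b.
    ... | D , s , d≡ , s<m = let (q , tq , tq′) = rec D<d (⟦⟧<m (a + s + 1)) b<m in
      q * m + r , tj q tq , ≡.trans (cong (t m) (position q)) (≡.trans (t-* (q + suc D) 0<m)
        (≡.trans (cong ⟦_⟧ (≡.trans (+-identityʳ _) tq′)) (⟦⟧-small b<m)))
      where
      r = m ∸ suc s
      D<d : D < d
      D<d = *-cancelʳ-< m D d (begin-strict
        D * m            ≤⟨ m≤m+n (D * m) s ⟩
        D * m + s        ≡⟨ d≡ ⟨
        d                <⟨ m<m+n d z<s ⟩
        d + d            ≡⟨ cong (d +_) (+-identityʳ d) ⟨
        2 * d            ≤⟨ *-monoˡ-≤ d 2≤m ⟩
        m * d            ≡⟨ *-comm m d ⟩
        d * m            ∎)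
        where open ≤-Reasoning
      r+1+s : r + suc s ≡ m
      r+1+s = m∸n+n≡m s<m
      tj : ∀ q → t m q ≡ ⟦ a + s + 1 ⟧ → t m (q * m + r) ≡ a
      tj q tq = begin
        t m (q * m + r)          ≡⟨ t-* q (≤-trans (m<m+n r z<s) (≤-reflexive r+1+s)) ⟩
        ⟦ t m q + r ⟧            ≡⟨ cong (λ x → ⟦ x + r ⟧) tq ⟩
        ⟦ ⟦ a + s + 1 ⟧ + r ⟧    ≡⟨ ⟦⟧+ (a + s + 1) r ⟩
        ⟦ a + s + 1 + r ⟧        ≡⟨ cong ⟦_⟧ (≡.trans (lemma a s r) (cong (a +_) r+1+s)) ⟩
        ⟦ a + m ⟧                ≡⟨ +m a ⟩
        ⟦ a ⟧                    ≡⟨ ⟦⟧-small a<m ⟩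
        a                        ∎
        where
        open ≡-Reasoning
        lemma : ∀ a s r → a + s + 1 + r ≡ a + (r + suc s)
        lemma = solve-∀
      position : ∀ q → q * m + r + suc d ≡ (q + suc D) * m + 0
      position q = begin
        q * m + r + suc d                     ≡⟨ cong (λ x → q * m + r + suc x) d≡ ⟩
        q * m + r + suc (D * m + s)           ≡⟨ lemma (q * m) r (D * m) s ⟩
        q * m + ((r + suc s) + D * m)         ≡⟨ cong (λ x → q * m + (x + D * m)) r+1+s ⟩
        q * m + (m + D * m)                   ≡⟨ *-distribʳ-+ m q (suc D) ⟨
        (q + suc D) * m                       ≡⟨ +-identityʳ _ ⟨
        (q + suc D) * m + 0                   ∎
        where
        open ≡-Reasoning
        lemma : ∀ a r b s → a + r + suc (b + s) ≡ a + ((r + suc s) + b)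
        lemma = solve-∀

at-take : ∀ w f → at (take (suc f) w) 0 ≡ at w 0
at-take []      f = refl
at-take (x ∷ w) f = refl

at-drop : ∀ w i → at (drop i w) 0 ≡ at w i
at-drop []      zero    = refl
at-drop []      (suc i) = refl
at-drop (x ∷ w) zero    = refl
at-drop (x ∷ w) (suc i) = at-drop w i

length≡0 : ∀ {w : Word} → length w ≡ 0 → w ≡ []
length≡0 {[]} _ = refl

remainder-unique : ∀ M .{{_ : NonZero M}} {r r′} q q′ → r < M → r′ < M → r + q * M ≡ r′ + q′ * M → r ≡ r′
remainder-unique M {r} {r′} q q′ r<M r′<M eq = begin
  r                    ≡⟨ m<n⇒m%n≡m r<M ⟨
  r % M                ≡⟨ [m+kn]%n≡m%n r q M ⟨
  (r + q * M) % M      ≡⟨ cong (_% M) eq ⟩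
  (r′ + q′ * M) % M    ≡⟨ [m+kn]%n≡m%n r′ q′ M ⟩
  r′ % M               ≡⟨ m<n⇒m%n≡m r′<M ⟩
  r′                   ∎
  where open ≡-Reasoning

-- Intervals from one letter to another

module Segments (m : ℕ) (2≤m : 2 ≤ m) where
  open Residues m 2≤m

  -- The number of steps from α up to a around ℤ/m, taken among 0 ⋯ m - 1. Equal letters give 0 and
  -- not m, in accordance with suffixes and prefixes being proper.
  dist : ℕ → ℕ → ℕ
  dist α a = ⟦ a + ⁻ α ⟧

  dist<m : ∀ α a → dist α a < m
  dist<m α a = ⟦⟧<m (a + ⁻ α)

  dist+ : ∀ {α} a → α < m → dist α a + α ≈ a
  dist+ {α} a α<m = ≡.trans (⟦⟧+ (a + ⁻ α) α) (⁻-inverse a (<⇒≤ α<m))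

  dist-unique : ∀ {α a c} → α < m → c < m → c + α ≈ a → dist α a ≡ c
  dist-unique {α} {a} α<m c<m p = ≈⇒≡ (dist<m α a) c<m (+-cancelʳ-≈ α (≡.trans (dist+ a α<m) (sym p)))

  segment : ℕ → ℕ → Word
  segment α a = arc α (dist α a)

  length-segment : ∀ α a → length (segment α a) ≡ dist α a
  length-segment α a = length-arc α (dist α a)

  boundary-segment : ∀ {α a} → α < m → a < m → Boundary (segment α a) (α ∷ []) (a ∷ [])
  boundary-segment {α} {a} α<m a<m =
    subst₂ (λ x y → Boundary (segment α a) (x ∷ []) (y ∷ [])) (⟦⟧-small α<m)
      (≡.trans (cong ⟦_⟧ (+-comm α (dist α a))) (≡.trans (dist+ a α<m) (⟦⟧-small a<m)))
      (boundary-arc α (dist α a))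

  -- σ(a) is the full turn ending in a - 1. As `dist α a < m`, some letter precedes the segment, and
  -- it is α - 1, written as α + (m - 1).
  σ-split-suffix : ∀ {α a} → α < m → ∃ λ w → σ m a ≡ w ++ ⟦ α + pred m ⟧ ∷ segment α a
  σ-split-suffix {α} {a} α<m = arc a r , (begin
    σ m a                                           ≡⟨ cong (arc a) r+1+c ⟨
    arc a (r + suc c)                               ≡⟨ arc-+ a r (suc c) ⟩
    arc a r ++ arc (a + r) (suc c)                  ≡⟨ cong (arc a r ++_) (arc-+ (a + r) 1 c) ⟩
    arc a r ++ ⟦ a + r + 0 ⟧ ∷ arc (a + r + 1) c    ≡⟨ cong₂ (λ x w → arc a r ++ x ∷ w) last (arc-cong c start) ⟩
    arc a r ++ ⟦ α + pred m ⟧ ∷ segment α a         ∎)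
    where
    open ≡-Reasoning
    c = dist α a
    r = m ∸ suc c
    r+1+c : r + suc c ≡ m
    r+1+c = m∸n+n≡m (dist<m α a)
    start : a + r + 1 ≈ α
    start = begin
      ⟦ a + r + 1 ⟧            ≡⟨ cong ⟦_⟧ (+-assoc a r 1) ⟩
      ⟦ a + (r + 1) ⟧          ≡⟨ +-cong (dist+ a α<m) refl ⟨
      ⟦ c + α + (r + 1) ⟧      ≡⟨ cong ⟦_⟧ (lemma c α r) ⟩
      ⟦ α + (r + suc c) ⟧      ≡⟨ cong (λ x → ⟦ α + x ⟧) r+1+c ⟩
      ⟦ α + m ⟧                ≡⟨ +m α ⟩
      ⟦ α ⟧                    ∎
      where
      lemma : ∀ c α r → c + α + (r + 1) ≡ α + (r + suc c)
      lemma = solve-∀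
    last : a + r + 0 ≈ α + pred m
    last = +-cancelʳ-≈ 1 (begin
      ⟦ a + r + 0 + 1 ⟧        ≡⟨ cong (λ x → ⟦ x + 1 ⟧) (+-identityʳ (a + r)) ⟩
      ⟦ a + r + 1 ⟧            ≡⟨ start ⟩
      ⟦ α ⟧                    ≡⟨ +m α ⟨
      ⟦ α + m ⟧                ≡⟨ cong (λ x → ⟦ α + x ⟧) (≡.trans (+-comm (pred m) 1) (suc-pred m)) ⟨
      ⟦ α + (pred m + 1) ⟧     ≡⟨ cong ⟦_⟧ (+-assoc α (pred m) 1) ⟨
      ⟦ α + pred m + 1 ⟧       ∎)

  σ-split-prefix : ∀ {b γ} → b < m → γ < m → ∃ λ w → σ m b ≡ segment b γ ++ γ ∷ w
  σ-split-prefix {b} {γ} b<m γ<m = arc (b + d + 1) r , (begin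
    σ m b                                              ≡⟨ cong (arc b) (≡.trans (+-comm d (suc r)) (≡.trans (sym (+-suc r d)) (m∸n+n≡m (dist<m b γ)))) ⟨
    arc b (d + suc r)                                  ≡⟨ arc-+ b d (suc r) ⟩
    arc b d ++ arc (b + d) (suc r)                     ≡⟨ cong (arc b d ++_) (arc-+ (b + d) 1 r) ⟩
    arc b d ++ ⟦ b + d + 0 ⟧ ∷ arc (b + d + 1) r       ≡⟨ cong (λ x → arc b d ++ x ∷ arc (b + d + 1) r) next ⟩
    arc b d ++ γ ∷ arc (b + d + 1) r                   ∎)
    where
    open ≡-Reasoning
    d = dist b γ
    r = m ∸ suc d
    next : ⟦ b + d + 0 ⟧ ≡ γ
    next = ≡.trans (cong ⟦_⟧ (≡.trans (+-identityʳ (b + d)) (+-comm b d))) (≡.trans (dist+ γ b<m) (⟦⟧-small γ<m))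

-- A pair (p, s) is described by e = |p| mod M and f = |s| mod M, where M = mᵏ⁻¹, together with letters:
-- with σ(a) ending in (α−1) α ⋯ (a−1), the word p consists of the last e letters of σᵏ⁻¹(α−1) and σᵏ⁻¹(α ⋯ (a−1));
-- with σ(b) beginning by b ⋯ (γ−1) γ, the word s consists of σᵏ⁻¹(b ⋯ (γ−1)) and the first f letters of σᵏ⁻¹(γ).
record Param : Set where
  constructor param
  field
    e f α a b γ : ℕ

-- Equality of the formal sums [α] + [b] - [a] - [γ], with the negative terms moved across.
SameBoundary : Param → Param → Set
SameBoundary x x′ = P.α ∷ P.b ∷ P′.a ∷ P′.γ ∷ [] ↭ P′.α ∷ P′.b ∷ P.a ∷ P.γ ∷ []
  where
  module P = Param x
  module P′ = Param x′

-- Pairs described by parameters, and their equivalence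

module Pairs (m : ℕ) (2≤m : 2 ≤ m) (κ : ℕ) where
  open Residues m 2≤m
  open Morphism m 2≤m
  open Segments m 2≤m

  -- `K` is k - 1, which is positive because k is at least 2.
  K M : ℕ
  K = suc κ
  M = m ^ K

  instance
    M≢0 : NonZero M
    M≢0 = m^n≢0 m K

  -- The relation of the theorem expressed on parameters. A truncated block reveals its letter only
  -- if it is nonempty, whence the conditions on `e` and `f`; the three abelian alternatives merge
  -- into `boundary≡`.
  record _≋_ (x x′ : Param) : Set where
    constructor ≋-intro
    private
      module P = Param x
      module P′ = Param x′
    field
      e≡ : P.e ≡ P′.e
      f≡ : P.f ≡ P′.f
      α≡ : P.e ≢ 0 → P.α ≡ P′.α
      γ≡ : P.f ≢ 0 → P.γ ≡ P′.γ
      boundary≡ : SameBoundary x x′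

  record InRange (x : Param) : Set where
    constructor inRange
    open Param x
    field
      e<M : e < M
      f<M : f < M
      α<m : α < m
      a<m : a < m
      b<m : b < m
      γ<m : γ < m

  leftRest : ℕ → ℕ → Word
  leftRest e α = drop (M ∸ e) (σpow m K (⟦ α + pred m ⟧ ∷ []))

  rightRest : ℕ → ℕ → Word
  rightRest f γ = take f (σpow m K (γ ∷ []))

  leftWord : ℕ → ℕ → ℕ → Word
  leftWord e α a = leftRest e α ++ σpow m K (segment α a)

  rightWord : ℕ → ℕ → ℕ → Word
  rightWord f b γ = σpow m K (segment b γ) ++ rightRest f γ

  toPair : Param → Word × Word
  toPair x = let open Param x in leftWord e α a , rightWord f b γ

  length-leftRest : ∀ {e} α → e < M → length (leftRest e α) ≡ e
  length-leftRest {e} α e<M = begin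
    length (leftRest e α)                                   ≡⟨ length-drop (M ∸ e) (σpow m K (⟦ α + pred m ⟧ ∷ [])) ⟩
    length (σpow m K (⟦ α + pred m ⟧ ∷ [])) ∸ (M ∸ e)       ≡⟨ cong (_∸ (M ∸ e)) (length-σpow-letter K _) ⟩
    M ∸ (M ∸ e)                                             ≡⟨ m∸[m∸n]≡n (<⇒≤ e<M) ⟩
    e                                                       ∎
    where open ≡-Reasoning

  length-rightRest : ∀ {f} γ → f < M → length (rightRest f γ) ≡ f
  length-rightRest {f} γ f<M = ≡.trans (length-take f _)
    (≡.trans (cong (f ⊓_) (length-σpow-letter K γ)) (m≤n⇒m⊓n≡m (<⇒≤ f<M)))

  length-leftWord : ∀ {e} α a → e < M → length (leftWord e α a) ≡ e + dist α a * M
  length-leftWord {e} α a e<M = ≡.trans (length-++ (leftRest e α)) (cong₂ _+_ (length-leftRest α e<M)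
    (≡.trans (length-σpow K (segment α a)) (cong (_* M) (length-segment α a))))

  length-rightWord : ∀ {f} b γ → f < M → length (rightWord f b γ) ≡ f + dist b γ * M
  length-rightWord {f} b γ f<M = ≡.trans (length-++ (σpow m K (segment b γ)))
    (≡.trans (+-comm _ (length (rightRest f γ))) (cong₂ _+_ (length-rightRest γ f<M)
      (≡.trans (length-σpow K (segment b γ)) (cong (_* M) (length-segment b γ)))))

  leftWord-suffix : ∀ {e α a} → α < m → ∃ λ z → σpow m (suc K) (a ∷ []) ≡ z ++ leftWord e α a
  leftWord-suffix {e} {α} {a} α<m with σ-split-suffix {α} {a} α<m
  ... | w , eq = σpow m K w ++ take (M ∸ e) B , (begin
    σpow m (suc K) (a ∷ [])                                     ≡⟨ σpow-suc K a ⟩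
    σpow m K (σ m a)                                            ≡⟨ cong (σpow m K) eq ⟩
    σpow m K (w ++ β ∷ segment α a)                             ≡⟨ σpow-++ K w (β ∷ segment α a) ⟩
    σpow m K w ++ σpow m K (β ∷ segment α a)                    ≡⟨ cong (σpow m K w ++_) (σpow-++ K (β ∷ []) (segment α a)) ⟩
    σpow m K w ++ B ++ C                                        ≡⟨ cong (λ v → σpow m K w ++ v ++ C) (take++drop≡id (M ∸ e) B) ⟨
    σpow m K w ++ (take (M ∸ e) B ++ drop (M ∸ e) B) ++ C       ≡⟨ cong (σpow m K w ++_) (++-assoc (take (M ∸ e) B) _ C) ⟩
    σpow m K w ++ take (M ∸ e) B ++ leftWord e α a              ≡⟨ ++-assoc (σpow m K w) _ _ ⟨
    (σpow m K w ++ take (M ∸ e) B) ++ leftWord e α a            ∎)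
    where
    open ≡-Reasoning
    β = ⟦ α + pred m ⟧
    B = σpow m K (β ∷ [])
    C = σpow m K (segment α a)

  rightWord-prefix : ∀ {f b γ} → b < m → γ < m → ∃ λ z → σpow m (suc K) (b ∷ []) ≡ rightWord f b γ ++ z
  rightWord-prefix {f} {b} {γ} b<m γ<m with σ-split-prefix b<m γ<m
  ... | w , eq = drop f B ++ σpow m K w , (begin
    σpow m (suc K) (b ∷ [])                                     ≡⟨ σpow-suc K b ⟩
    σpow m K (σ m b)                                            ≡⟨ cong (σpow m K) eq ⟩
    σpow m K (segment b γ ++ γ ∷ w)                             ≡⟨ σpow-++ K (segment b γ) (γ ∷ w) ⟩
    C ++ σpow m K (γ ∷ w)                                       ≡⟨ cong (C ++_) (σpow-++ K (γ ∷ []) w) ⟩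
    C ++ B ++ σpow m K w                                        ≡⟨ cong (λ v → C ++ v ++ σpow m K w) (take++drop≡id f B) ⟨
    C ++ (take f B ++ drop f B) ++ σpow m K w                   ≡⟨ cong (C ++_) (++-assoc (take f B) _ _) ⟩
    C ++ take f B ++ drop f B ++ σpow m K w                     ≡⟨ ++-assoc C _ _ ⟨
    rightWord f b γ ++ drop f B ++ σpow m K w                   ∎)
    where
    open ≡-Reasoning
    B = σpow m K (γ ∷ [])
    C = σpow m K (segment b γ)

  private
    block< : ∀ {e c} → e < M → c < m → e + c * M < m * M
    block< {e} {c} e<M c<m = <-≤-trans (+-monoˡ-< (c * M) e<M) (*-monoˡ-≤ M c<m)

    split-length : ∀ L → L < m * M → ∃ λ e → ∃ λ c → e < M × c < m × L ≡ e + c * M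
    split-length L L< = L % M , L / M , m%n<n L M , *-cancelʳ-< M (L / M) m (≤-<-trans (m/n*n≤m L M) L<) ,
      m≡m%n+[m/n]*n L M

    <-block : ∀ {x w : Word} a → w ≡ σpow m (suc K) (a ∷ []) → length x < length w ⊎ w ≡ [] → length x < m * M
    <-block a refl (inj₁ lt) = subst (_ <_) (length-σpow-letter (suc K) a) lt
    <-block a refl (inj₂ eq) = contradiction (≡.trans (sym (cong length eq)) (length-σpow-letter (suc K) a)) (<⇒≢ (m^n>0 m (suc K)))

    segment-00 : segment 0 0 ≡ []
    segment-00 = cong (arc 0) (dist-unique {0} {0} {0} 0<m 0<m refl)

  properSuffix-leftWord : ∀ {e α a} → e < M → α < m → ProperSuffix (leftWord e α a) (σpow m (suc K) (a ∷ []))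
  properSuffix-leftWord {e} {α} {a} e<M α<m = let (z , eq) = leftWord-suffix {e} {α} {a} α<m in
    z , eq , inj₁ (subst₂ _<_ (sym (length-leftWord α a e<M)) (sym (length-σpow-letter (suc K) a)) (block< e<M (dist<m α a)))

  properPrefix-rightWord : ∀ {f b γ} → f < M → b < m → γ < m → ProperPrefix (rightWord f b γ) (σpow m (suc K) (b ∷ []))
  properPrefix-rightWord {f} {b} {γ} f<M b<m γ<m = let (z , eq) = rightWord-prefix b<m γ<m in
    z , eq , inj₁ (subst₂ _<_ (sym (length-rightWord b γ f<M)) (sym (length-σpow-letter (suc K) b)) (block< f<M (dist<m b γ)))

  -- An absent letter forces the empty word, which the letter 0 describes as well. For a letter a,
  -- division of the length of `p` by M yields `e` and the number of whole blocks, and suffixes of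
  -- one word with equal length coincide.
  properSuffix⇒leftWord : ∀ {p} (a : Maybe ℕ) → All (_< m) (opt a) → ProperSuffix p (σpow m (suc K) (opt a)) →
    ∃ λ e → ∃ λ α → ∃ λ a′ → e < M × α < m × a′ < m × p ≡ leftWord e α a′
  properSuffix⇒leftWord nothing _ (z , eq , _) = 0 , 0 , 0 , m^n>0 m K , 0<m , 0<m , (begin
    _                                           ≡⟨ ++-conicalʳ z _ (≡.trans (sym eq) (σpow-[] (suc K))) ⟩
    []                                          ≡⟨ σpow-[] K ⟨
    σpow m K []                                 ≡⟨ cong (σpow m K) segment-00 ⟨
    σpow m K (segment 0 0)                      ≡⟨ cong (_++ σpow m K (segment 0 0)) (length≡0 (length-leftRest 0 (m^n>0 m K))) ⟨
    leftWord 0 0 0                              ∎)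
    where
    open ≡-Reasoning
  properSuffix⇒leftWord {p} (just a) (a<m ∷ []) (z , eq , short)
    with split-length (length p) (<-block {p} a refl short)
  ... | e , c , e<M , c<m , len = e , α , a , e<M , ⟦⟧<m (a + ⁻ c) , a<m ,
    let (z′ , eq′) = leftWord-suffix {e} {α} {a} (⟦⟧<m (a + ⁻ c)) in
    proj₂ (++-injectiveʳ z z′ len′ (≡.trans (sym eq) eq′))
    where
    α = ⟦ a + ⁻ c ⟧
    c≡ : dist α a ≡ c
    c≡ = dist-unique (⟦⟧<m (a + ⁻ c)) c<m
      (≡.trans (cong ⟦_⟧ (+-comm c α)) (≡.trans (⟦⟧+ (a + ⁻ c) c) (⁻-inverse a (<⇒≤ c<m))))
    len′ : length p ≡ length (leftWord e α a)
    len′ = ≡.trans len (sym (≡.trans (length-leftWord α a e<M) (cong (λ c → e + c * M) c≡)))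

  properPrefix⇒rightWord : ∀ {s} (b : Maybe ℕ) → All (_< m) (opt b) → ProperPrefix s (σpow m (suc K) (opt b)) →
    ∃ λ f → ∃ λ b′ → ∃ λ γ → f < M × b′ < m × γ < m × s ≡ rightWord f b′ γ
  properPrefix⇒rightWord {s} nothing _ (z , eq , _) = 0 , 0 , 0 , m^n>0 m K , 0<m , 0<m , (begin
    s                                           ≡⟨ ++-conicalˡ s z (≡.trans (sym eq) (σpow-[] (suc K))) ⟩
    []                                          ≡⟨ σpow-[] K ⟨
    σpow m K []                                 ≡⟨ cong (σpow m K) segment-00 ⟨
    σpow m K (segment 0 0)                      ≡⟨ ++-identityʳ _ ⟨
    rightWord 0 0 0                             ∎)
    where
    open ≡-Reasoning
  properPrefix⇒rightWord {s} (just b) (b<m ∷ []) (z , eq , short)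
    with split-length (length s) (<-block {s} b refl short)
  ... | f , d , f<M , d<m , len = f , b , γ , f<M , b<m , ⟦⟧<m (b + d) ,
    let (z′ , eq′) = rightWord-prefix {f} {b} {γ} b<m (⟦⟧<m (b + d)) in
    proj₁ (++-injective s (rightWord f b γ) len′ (≡.trans (sym eq) eq′))
    where
    γ = ⟦ b + d ⟧
    d≡ : dist b γ ≡ d
    d≡ = dist-unique b<m d<m (≡.trans (cong ⟦_⟧ (+-comm d b)) (sym (⟦⟧-idem (b + d))))
    len′ : length s ≡ length (rightWord f b γ)
    len′ = ≡.trans len (sym (≡.trans (length-rightWord b γ f<M) (cong (λ c → f + c * M) d≡)))

  segment-⟦⟧ : ∀ α a → map ⟦_⟧ (segment α a) ≡ segment α a
  segment-⟦⟧ α a = map-⟦⟧ (arc<m α (dist α a))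

  -- Both remainders are shorter than M and are followed by whole blocks of length M, so the total
  -- length modulo M fixes the cut.
  leftWord-unique : ∀ {e} α a x p → e < M → length x < M → leftWord e α a ≡ x ++ σpow m K p →
    leftRest e α ≡ x × segment α a ≡ map ⟦_⟧ p
  leftWord-unique {e} α a x p e<M x<M eq =
    let (rest≡ , σ≡) = ++-injective (leftRest e α) x len eq in
    rest≡ , ≡.trans (sym (segment-⟦⟧ α a)) (σpow-injective κ (segment α a) p σ≡)
    where
    len : length (leftRest e α) ≡ length x
    len = ≡.trans (length-leftRest α e<M) (remainder-unique M (dist α a) (length p) e<M x<M
      (≡.trans (sym (length-leftWord α a e<M)) (≡.trans (cong length eq) (≡.trans (length-++ x) (cong (length x +_) (length-σpow K p))))))

  rightWord-unique : ∀ {f} b γ q y → f < M → length y < M → rightWord f b γ ≡ σpow m K q ++ y →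
    rightRest f γ ≡ y × segment b γ ≡ map ⟦_⟧ q
  rightWord-unique {f} b γ q y f<M y<M eq =
    let (σ≡ , rest≡) = ++-injectiveʳ (σpow m K (segment b γ)) (σpow m K q) len eq in
    rest≡ , ≡.trans (sym (segment-⟦⟧ b γ)) (σpow-injective κ (segment b γ) q σ≡)
    where
    len : length (rightRest f γ) ≡ length y
    len = ≡.trans (length-rightRest γ f<M) (remainder-unique M (dist b γ) (length q) f<M y<M
      (≡.trans (sym (length-rightWord b γ f<M)) (≡.trans (cong length eq)
        (≡.trans (length-++ (σpow m K q)) (≡.trans (+-comm _ (length y)) (cong (length y +_) (length-σpow K q)))))))

  -- The first letter that survives comes from position M - e, a genuine position of the block when
  -- e ≠ 0, and one letter at a known position determines the block.
  leftRest-injective : ∀ {e α α′} → e < M → e ≢ 0 → α < m → α′ < m → leftRest e α ≡ leftRest e α′ → α ≡ α′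
  leftRest-injective {e} {α} {α′} e<M e≢0 α<m α′<m eq = ≈⇒≡ α<m α′<m (+-cancelʳ-≈ (pred m)
    (at-σpow-injective K (⟦⟧<m (α + pred m)) (⟦⟧<m (α′ + pred m)) (∸-monoʳ-< (n≢0⇒n>0 e≢0) (<⇒≤ e<M))
      (≡.trans (sym (at-drop _ (M ∸ e))) (≡.trans (cong (λ w → at w 0) eq) (at-drop _ (M ∸ e))))))

  rightRest-injective : ∀ {f γ γ′} → f ≢ 0 → γ < m → γ′ < m → rightRest f γ ≡ rightRest f γ′ → γ ≡ γ′
  rightRest-injective {zero}  f≢0 _ _ _ = contradiction refl f≢0
  rightRest-injective {suc f} {γ} {γ′} _ γ<m γ′<m eq = at-σpow-injective K γ<m γ′<m (m^n>0 m K)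
    (≡.trans (sym (at-take (σpow m K (γ ∷ [])) f)) (≡.trans (cong (λ w → at w 0) eq) (at-take (σpow m K (γ′ ∷ [])) f)))

  core : Param → Word
  core x = let open Param x in segment α a ++ segment b γ

  core<m : ∀ x → All (_< m) (core x)
  core<m x = let open Param x in All.++⁺ (arc<m α (dist α a)) (arc<m b (dist b γ))

  length-core : ∀ x → let open Param x in length (core x) ≡ dist α a + dist b γ
  length-core x = let open Param x in
    ≡.trans (length-++ (segment α a)) (cong₂ _+_ (length-segment α a) (length-segment b γ))

  HasBoundary : Word → Param → Set
  HasBoundary w x = Boundary w (α ∷ b ∷ []) (a ∷ γ ∷ [])
    where open Param x

  boundary-core : ∀ {x} → InRange x → HasBoundary (core x) x
  boundary-core r = boundary-++ (boundary-segment α<m a<m) (boundary-segment b<m γ<m)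
    where open InRange r

  boundary-core-σ0 : ∀ {x} → InRange x → HasBoundary (core x ++ σ m 0) x
  boundary-core-σ0 r = boundary-++ (boundary-core r) (boundary-full 0)

  boundary≡-intro : ∀ {x x′ w w′} → InRange x → InRange x′ → HasBoundary w x → HasBoundary w′ x′ → w ↭ w′ →
    SameBoundary x x′
  boundary≡-intro r r′ d d′ w↭w′ = boundary-unique d d′ w↭w′
    (R.α<m ∷ R.b<m ∷ R′.a<m ∷ R′.γ<m ∷ []) (R′.α<m ∷ R′.b<m ∷ R.a<m ∷ R.γ<m ∷ [])
    where
    module R = InRange r
    module R′ = InRange r′

  -- The words claimed by `Equivk` are forced: the outer ones are the truncated blocks and the inner
  -- ones are the segments modulo m. An appended σ(0) has zero derivative, so all three alternatives
  -- lead to the same conclusion.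
  Equivk⇒≋ : ∀ {x x′} → InRange x → InRange x′ → Equivk m (suc K) (toPair x) (toPair x′) → x ≋ x′
  Equivk⇒≋ {x} {x′} rg rg′ (u , v , p , q , r , s , u<M , v<M , p₁≡ , s₁≡ , p₂≡ , s₂≡ , cases)
    with leftWord-unique P.α P.a u p R.e<M u<M p₁≡ | rightWord-unique P.b P.γ q v R.f<M v<M s₁≡
       | leftWord-unique P′.α P′.a u r R′.e<M u<M p₂≡ | rightWord-unique P′.b P′.γ s v R′.f<M v<M s₂≡
    where
    module P = Param x
    module P′ = Param x′
    module R = InRange rg
    module R′ = InRange rg′
  ... | u≡ , p≡ | v≡ , q≡ | u′≡ , r≡ | v′≡ , s≡ = ≋-intro e≡ f≡ α≡ γ≡ (bd cases)
    where
    module P = Param x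
    module P′ = Param x′
    module R = InRange rg
    module R′ = InRange rg′
    e≡ : P.e ≡ P′.e
    e≡ = ≡.trans (sym (length-leftRest P.α R.e<M)) (≡.trans (cong length (≡.trans u≡ (sym u′≡))) (length-leftRest P′.α R′.e<M))
    f≡ : P.f ≡ P′.f
    f≡ = ≡.trans (sym (length-rightRest P.γ R.f<M)) (≡.trans (cong length (≡.trans v≡ (sym v′≡))) (length-rightRest P′.γ R′.f<M))
    α≡ : P.e ≢ 0 → P.α ≡ P′.α
    α≡ e≢0 = leftRest-injective R.e<M e≢0 R.α<m R′.α<m (≡.trans u≡ (≡.trans (sym u′≡) (cong (λ e → leftRest e P′.α) (sym e≡))))
    γ≡ : P.f ≢ 0 → P.γ ≡ P′.γ
    γ≡ f≢0 = rightRest-injective f≢0 R.γ<m R′.γ<m (≡.trans v≡ (≡.trans (sym v′≡) (cong (λ f → rightRest f P′.γ) (sym f≡))))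
    core≡ : map ⟦_⟧ (p ++ q) ≡ core x
    core≡ = ≡.trans (map-++ ⟦_⟧ p q) (cong₂ _++_ (sym p≡) (sym q≡))
    core≡′ : map ⟦_⟧ (r ++ s) ≡ core x′
    core≡′ = ≡.trans (map-++ ⟦_⟧ r s) (cong₂ _++_ (sym r≡) (sym s≡))
    +σ0 : ∀ u v {w} → map ⟦_⟧ (u ++ v) ≡ w → map ⟦_⟧ (u ++ v ++ σ m 0) ≡ w ++ σ m 0
    +σ0 u v refl = ≡.trans (cong (map ⟦_⟧) (sym (++-assoc u v (σ m 0))))
      (≡.trans (map-++ ⟦_⟧ (u ++ v) (σ m 0)) (cong (map ⟦_⟧ (u ++ v) ++_) (map-⟦⟧ (arc<m 0 m))))
    ↭-map : ∀ {u v w w′} → map ⟦_⟧ u ≡ w → map ⟦_⟧ v ≡ w′ → u ∼₁ v → w ↭ w′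
    ↭-map {u} {v} refl refl u∼v = ↭.map⁺ ⟦_⟧ (∼⇒↭ u v u∼v)
    bd : (p ++ q) ∼₁ (r ++ s) ⊎ (p ++ q) ∼₁ (r ++ s ++ σ m 0) ⊎ (p ++ q ++ σ m 0) ∼₁ (r ++ s) → SameBoundary x x′
    bd (inj₁ c) = boundary≡-intro rg rg′ (boundary-core rg) (boundary-core rg′) (↭-map core≡ core≡′ c)
    bd (inj₂ (inj₁ c)) = boundary≡-intro rg rg′ (boundary-core rg) (boundary-core-σ0 rg′) (↭-map core≡ (+σ0 r s core≡′) c)
    bd (inj₂ (inj₂ c)) = boundary≡-intro rg rg′ (boundary-core-σ0 rg) (boundary-core rg′) (↭-map (+σ0 p q core≡) core≡′ c)

  ≋⇒Equivk : ∀ {x x′} → InRange x → InRange x′ → x ≋ x′ → Equivk m (suc K) (toPair x) (toPair x′)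
  ≋⇒Equivk {x} {x′} rg rg′ (≋-intro refl refl α≡ γ≡ bd) =
    leftRest P.e P.α , rightRest P.f P.γ , segment P.α P.a , segment P.b P.γ , segment P′.α P′.a , segment P′.b P′.γ ,
    subst (_< M) (sym (length-leftRest P.α R.e<M)) R.e<M , subst (_< M) (sym (length-rightRest P.γ R.f<M)) R.f<M ,
    refl , refl , cong (_++ σpow m K (segment P′.α P′.a)) (left-eq P.e refl) ,
    cong (σpow m K (segment P′.b P′.γ) ++_) (right-eq P.f refl) ,
    cases (↭-up-to-fulls (boundary-core rg) (boundary-core rg′) (core<m x) (core<m x′) bd)
    where
    module P = Param x
    module P′ = Param x′
    module R = InRange rg
    module R′ = InRange rg′
    left-eq : ∀ e → P.e ≡ e → leftRest P.e P′.α ≡ leftRest P.e P.α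
    left-eq zero refl = ≡.trans (length≡0 (length-leftRest P′.α R.e<M)) (sym (length≡0 (length-leftRest P.α R.e<M)))
    left-eq (suc e) refl = cong (leftRest P.e) (sym (α≡ (λ ())))
    right-eq : ∀ f → P.f ≡ f → rightRest P.f P′.γ ≡ rightRest P.f P.γ
    right-eq zero    refl = refl
    right-eq (suc f) refl = cong (rightRest P.f) (sym (γ≡ (λ ())))
    -- A core has fewer than 2m letters, so it cannot contain two copies of σ(0). This limits the
    -- excess to what `Equivk` admits.
    excess≤1 : ∀ y y′ g → ¬ (core y ↭ core y′ ++ fulls (2 + g))
    excess≤1 y y′ g p = <⇒≱ (+-mono-<-≤ (dist<m (Param.α y) (Param.a y)) (<⇒≤ (dist<m (Param.b y) (Param.γ y)))) (begin
      m + m                                       ≤⟨ m≤m+n (m + m) (g * m) ⟩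
      m + m + g * m                               ≡⟨ +-assoc m m (g * m) ⟩
      (2 + g) * m                                 ≡⟨ length-fulls (2 + g) ⟨
      length (fulls (2 + g))                      ≤⟨ m≤n+m _ (length (core y′)) ⟩
      length (core y′) + length (fulls (2 + g))   ≡⟨ length-++ (core y′) ⟨
      length (core y′ ++ fulls (2 + g))           ≡⟨ ↭.↭-length p ⟨
      length (core y)                             ≡⟨ length-core y ⟩
      _                                           ∎)
      where open ≤-Reasoning
    assoc : ∀ y → let open Param y in core y ++ fulls 1 ≡ segment α a ++ segment b γ ++ σ m 0
    assoc y = let open Param y in ≡.trans (cong (core y ++_) (++-identityʳ (σ m 0))) (++-assoc (segment α a) (segment b γ) (σ m 0))
    cases : (∃ λ g → (core x ↭ core x′ ++ fulls g) ⊎ (core x′ ↭ core x ++ fulls g)) →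
      core x ∼₁ core x′ ⊎ core x ∼₁ (segment P′.α P′.a ++ segment P′.b P′.γ ++ σ m 0) ⊎
      (segment P.α P.a ++ segment P.b P.γ ++ σ m 0) ∼₁ core x′
    cases (zero , inj₁ p) = inj₁ (↭⇒∼ (subst (core x ↭_) (++-identityʳ (core x′)) p))
    cases (zero , inj₂ p) = inj₁ (↭⇒∼ (↭-sym (subst (core x′ ↭_) (++-identityʳ (core x)) p)))
    cases (suc zero , inj₁ p) = inj₂ (inj₁ (↭⇒∼ (subst (core x ↭_) (assoc x′) p)))
    cases (suc zero , inj₂ p) = inj₂ (inj₂ (↭⇒∼ (↭-sym (subst (core x′ ↭_) (assoc x) p))))
    cases (suc (suc g) , inj₁ p) = contradiction p (excess≤1 x x′ g)
    cases (suc (suc g) , inj₂ p) = contradiction p (excess≤1 x′ x g)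

-- The parameters that occur for factors of length n

module Validity (m : ℕ) (2≤m : 2 ≤ m) (κ ν μ : ℕ) (ν<m : ν < m) where
  open Residues m 2≤m
  open Morphism m 2≤m
  open Segments m 2≤m
  open Pairs m 2≤m κ

  -- The lengths e + f + (a − α + γ − b) M of the described pairs are those congruent to ν M + μ modulo mᵏ.
  record Valid (x : Param) : Set where
    constructor valid
    open Param x
    field
      range   : InRange x
      h       : ℕ
      carry   : e + f ≡ μ + h * M
      balance : a + γ + h ≈ ν + α + b
    open InRange range public

  dist-balance : ∀ {α a b γ} h → α < m → b < m → a + γ + h ≈ ν + α + b → h + (dist α a + dist b γ) ≈ ν
  dist-balance {α} {a} {b} {γ} h α<m b<m bal = +-cancelʳ-≈ (α + b) (begin
    ⟦ h + (dist α a + dist b γ) + (α + b) ⟧          ≡⟨ cong ⟦_⟧ (lemma h (dist α a) (dist b γ) α b) ⟩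
    ⟦ (dist α a + α) + (dist b γ + b) + h ⟧          ≡⟨ +-cong (+-cong (dist+ a α<m) (dist+ γ b<m)) refl ⟩
    ⟦ a + γ + h ⟧                                    ≡⟨ bal ⟩
    ⟦ ν + α + b ⟧                                    ≡⟨ cong ⟦_⟧ (+-assoc ν α b) ⟩
    ⟦ ν + (α + b) ⟧                                  ∎)
    where
    open ≡-Reasoning
    lemma : ∀ h c d α b → h + (c + d) + (α + b) ≡ (c + α) + (d + b) + h
    lemma = solve-∀

  balance-dist : ∀ {α a b γ} h → α < m → b < m → h + (dist α a + dist b γ) ≈ ν → a + γ + h ≈ ν + α + b
  balance-dist {α} {a} {b} {γ} h α<m b<m p = begin
    ⟦ a + γ + h ⟧                                    ≡⟨ +-cong (+-cong (dist+ a α<m) (dist+ γ b<m)) refl ⟨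
    ⟦ (dist α a + α) + (dist b γ + b) + h ⟧          ≡⟨ cong ⟦_⟧ (lemma h (dist α a) (dist b γ) α b) ⟩
    ⟦ h + (dist α a + dist b γ) + (α + b) ⟧          ≡⟨ +-cong p refl ⟩
    ⟦ ν + (α + b) ⟧                                  ≡⟨ cong ⟦_⟧ (+-assoc ν α b) ⟨
    ⟦ ν + α + b ⟧                                    ∎
    where
    open ≡-Reasoning
    lemma : ∀ h c d α b → (c + α) + (d + b) + h ≡ h + (c + d) + (α + b)
    lemma = solve-∀

  ≈ν⇒ : ∀ {x} → x ≈ ν → ∃ λ Q → x ≡ ν + Q * m
  ≈ν⇒ {x} x≈ν with divide x
  ... | Q , r , refl , r<m = Q , ≡.trans (+-comm (Q * m) r) (cong (_+ Q * m)
    (≈⇒≡ r<m ν<m (≡.trans (sym (≡.trans (cong ⟦_⟧ (+-comm (Q * m) r)) (+k*m r Q))) x≈ν)))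

  -- The word lies inside the k-th image of the factor a u b, and images of factors of a fixed point
  -- are factors.
  extend-isFactor : ∀ k {a b l} u j p s → a ∷ u ++ b ∷ [] ≡ slice m j l →
    (∃ λ z → σpow m k (a ∷ []) ≡ z ++ p) → (∃ λ z → σpow m k (b ∷ []) ≡ s ++ z) → IsFactor m (p ++ σpow m k u ++ s)
  extend-isFactor k {a} {b} {l} u j p s eq (z , p≡) (z′ , s≡) = infix-isFactor z (p ++ σpow m k u ++ s) z′ {j * m ^ k} {l * m ^ k} (begin
    z ++ (p ++ σpow m k u ++ s) ++ z′                                   ≡⟨ cong (z ++_) (++-assoc p _ z′) ⟩
    z ++ p ++ (σpow m k u ++ s) ++ z′                                   ≡⟨ cong (λ w → z ++ p ++ w) (++-assoc (σpow m k u) s z′) ⟩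
    z ++ p ++ σpow m k u ++ s ++ z′                                     ≡⟨ ++-assoc z p _ ⟨
    (z ++ p) ++ σpow m k u ++ s ++ z′                                   ≡⟨ cong₂ (λ v w → v ++ σpow m k u ++ w) (sym p≡) (sym s≡) ⟩
    σpow m k (a ∷ []) ++ σpow m k u ++ σpow m k (b ∷ [])                ≡⟨ cong (σpow m k (a ∷ []) ++_) (σpow-++ k u (b ∷ [])) ⟨
    σpow m k (a ∷ []) ++ σpow m k (u ++ b ∷ [])                         ≡⟨ σpow-++ k (a ∷ []) (u ++ b ∷ []) ⟨
    σpow m k (a ∷ u ++ b ∷ [])                                          ≡⟨ cong (σpow m k) eq ⟩
    σpow m k (slice m j l)                                              ≡⟨ slice-σpow k j l ⟨
    slice m (j * m ^ k) (l * m ^ k)                                     ∎)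
    where open ≡-Reasoning

  factor-between : ∀ ℓ {a b} → a < m → b < m → ∃ λ u → ∃ λ j → length u ≡ ℓ × a ∷ u ++ b ∷ [] ≡ slice m j (suc ℓ + 1)
  factor-between ℓ {a} {b} a<m b<m with pair-occurs ℓ a<m b<m
  ... | j , refl , refl = slice m (suc j) ℓ , j , length-slice (suc j) ℓ , (begin
    t m j ∷ slice m (suc j) ℓ ++ t m (j + suc ℓ) ∷ []      ≡⟨ cong (_++ t m (j + suc ℓ) ∷ []) (slice-∷ j ℓ) ⟨
    slice m j (suc ℓ) ++ t m (j + suc ℓ) ∷ []              ≡⟨ cong (slice m j (suc ℓ) ++_) (cong (λ i → t m i ∷ []) (+-identityʳ (j + suc ℓ))) ⟨
    slice m j (suc ℓ) ++ slice m (j + suc ℓ) 1             ≡⟨ slice-+ j (suc ℓ) 1 ⟨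
    slice m j (suc ℓ + 1)                                  ∎)
    where open ≡-Reasoning

  module _ (μ<M : μ < M) {n : ℕ} (q : ℕ) (2m^k≤n : 2 * m ^ suc K ≤ n) (n≡ : n ≡ q * m ^ suc K + (ν * M + μ)) where

    private
      2≤q : 2 ≤ q
      2≤q = s≤s⁻¹ (*-cancelʳ-< (m ^ suc K) 2 (suc q) (begin-strict
        2 * (m * M)                  ≤⟨ 2m^k≤n ⟩
        n                            ≡⟨ n≡ ⟩
        q * (m * M) + (ν * M + μ)    <⟨ +-monoʳ-< (q * (m * M)) (+-monoʳ-< (ν * M) μ<M) ⟩
        q * (m * M) + (ν * M + M)    ≡⟨ cong (q * (m * M) +_) (+-comm (ν * M) M) ⟩
        q * (m * M) + suc ν * M      ≤⟨ +-monoʳ-≤ (q * (m * M)) (*-monoˡ-≤ M ν<m) ⟩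
        q * (m * M) + m * M          ≡⟨ +-comm (q * (m * M)) (m * M) ⟩
        suc q * (m * M)              ∎))
        where open ≤-Reasoning

    -- The end letters a and b can be placed around a word u of any length, so only the length of u
    -- has to be fitted. The lower bound on n gives `2 ≤ q`, which keeps that length from becoming
    -- negative.
    toPair-PSPairs : ∀ {x} → Valid x → PSPairs m (suc K) n (toPair x)
    toPair-PSPairs {x} v with ≈ν⇒ (dist-balance h α<m b<m bal)
      where open Valid v renaming (balance to bal)
    -- The carry and the whole blocks of prefix and suffix make up ν blocks of length M plus `Q`
    -- times `m ^ k`; the middle word supplies the rest.
    ... | Q , Q≡ with factor-between (q ∸ Q) (Valid.a<m v) (Valid.b<m v)
    ...   | u , j , len-u , slice≡ =
      leftWord e α a ++ σpow m (suc K) u ++ rightWord f b γ ,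
      extend-isFactor (suc K) u j (leftWord e α a) (rightWord f b γ) slice≡
        (leftWord-suffix {e} {α} {a} α<m) (rightWord-prefix {f} {b} {γ} b<m γ<m) ,
      len , u , refl , just a , just b , a<m ∷ [] , b<m ∷ [] ,
      isFactor-slice j _ slice≡ , properSuffix-leftWord e<M α<m , properPrefix-rightWord f<M b<m γ<m
      where
      open Param x
      open Valid v hiding (balance)
      c = dist α a
      d = dist b γ
      h<2 : h < 2
      h<2 = *-cancelʳ-< M h 2 (begin-strict
        h * M          ≤⟨ m≤n+m (h * M) μ ⟩
        μ + h * M      ≡⟨ carry ⟨
        e + f          <⟨ +-mono-<-≤ e<M (<⇒≤ f<M) ⟩
        M + M          ≡⟨ cong (M +_) (+-identityʳ M) ⟨
        2 * M          ∎)
        where open ≤-Reasoning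
      Q≤q : Q ≤ q
      Q≤q = ≤-trans (<⇒≤ (*-cancelʳ-< m Q 2 (begin-strict
        Q * m               ≤⟨ m≤n+m (Q * m) ν ⟩
        ν + Q * m           ≡⟨ Q≡ ⟨
        h + (c + d)         ≤⟨ +-monoˡ-≤ (c + d) (s≤s⁻¹ h<2) ⟩
        suc c + d           <⟨ +-mono-≤-< (dist<m α a) (dist<m b γ) ⟩
        m + m               ≡⟨ cong (m +_) (+-identityʳ m) ⟨
        2 * m               ∎))) 2≤q
        where open ≤-Reasoning
      len : length (leftWord e α a ++ σpow m (suc K) u ++ rightWord f b γ) ≡ n
      len = begin
        length (leftWord e α a ++ σpow m (suc K) u ++ rightWord f b γ)    ≡⟨ length-++ (leftWord e α a) ⟩
        length (leftWord e α a) + length (σpow m (suc K) u ++ rightWord f b γ)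
          ≡⟨ cong₂ _+_ (length-leftWord α a e<M) (≡.trans (length-++ (σpow m (suc K) u))
               (cong₂ _+_ (≡.trans (length-σpow (suc K) u) (cong (_* (m * M)) len-u)) (length-rightWord b γ f<M))) ⟩
        e + c * M + ((q ∸ Q) * (m * M) + (f + d * M))      ≡⟨ lemma e f c d (q ∸ Q) m M ⟩
        (e + f) + (c + d + (q ∸ Q) * m) * M                ≡⟨ cong (_+ (c + d + (q ∸ Q) * m) * M) carry ⟩
        μ + h * M + (c + d + (q ∸ Q) * m) * M              ≡⟨ lemma₂ μ h (c + d) ((q ∸ Q) * m) M ⟩
        μ + (h + (c + d) + (q ∸ Q) * m) * M                ≡⟨ cong (λ x → μ + (x + (q ∸ Q) * m) * M) Q≡ ⟩
        μ + (ν + Q * m + (q ∸ Q) * m) * M                  ≡⟨ lemma₃ μ ν Q (q ∸ Q) m M ⟩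
        (Q + (q ∸ Q)) * (m * M) + (ν * M + μ)              ≡⟨ cong (λ x → x * (m * M) + (ν * M + μ)) (m+[n∸m]≡n Q≤q) ⟩
        q * (m * M) + (ν * M + μ)                          ≡⟨ n≡ ⟨
        n                                                  ∎
        where
        open ≡-Reasoning
        lemma : ∀ e f c d l m M → e + c * M + (l * (m * M) + (f + d * M)) ≡ (e + f) + (c + d + l * m) * M
        lemma = solve-∀
        lemma₂ : ∀ μ h x y M → μ + h * M + (x + y) * M ≡ μ + (h + x + y) * M
        lemma₂ = solve-∀
        lemma₃ : ∀ μ ν Q l m M → μ + (ν + Q * m + l * m) * M ≡ (Q + l) * (m * M) + (ν * M + μ)
        lemma₃ = solve-∀

    -- The length is compared in two stages: its residue modulo M yields `carry`, and the quotient
    -- modulo m yields `balance`.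
    PSPairs-toPair : ∀ {y} → PSPairs m (suc K) n y → ∃ λ x → Valid x × toPair x ≡ y
    PSPairs-toPair {p , s} (U , _ , len , u , U≡ , a? , b? , a?<m , b?<m , _ , suf , pre)
      with properSuffix⇒leftWord {p} a? a?<m suf | properPrefix⇒rightWord {s} b? b?<m pre
    ... | e , α , a , e<M , α<m , a<m , refl | f , b , γ , f<M , b<m , γ<m , refl =
      param e f α a b γ , valid (inRange e<M f<M α<m a<m b<m γ<m) h carry (balance-dist h α<m b<m bal) , refl
      where
      open ≡-Reasoning
      c = dist α a
      d = dist b γ
      L = length u
      h = (e + f) / M
      total : (e + f) + (c + d + L * m) * M ≡ μ + (q * m + ν) * M
      total = begin
        (e + f) + (c + d + L * m) * M                 ≡⟨ lemma e f c d L m M ⟨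
        e + c * M + (L * (m * M) + (f + d * M))
          ≡⟨ cong₂ _+_ (length-leftWord α a e<M) (≡.trans (length-++ (σpow m (suc K) u)) (cong₂ _+_ (length-σpow (suc K) u) (length-rightWord b γ f<M))) ⟨
        length (leftWord e α a) + length (σpow m (suc K) u ++ rightWord f b γ)   ≡⟨ length-++ (leftWord e α a) ⟨
        length (leftWord e α a ++ σpow m (suc K) u ++ rightWord f b γ)           ≡⟨ cong length U≡ ⟨
        length U                                      ≡⟨ len ⟩
        n                                             ≡⟨ n≡ ⟩
        q * (m * M) + (ν * M + μ)                     ≡⟨ lemma₂ q ν μ m M ⟩
        μ + (q * m + ν) * M                           ∎
        where
        lemma : ∀ e f c d l m M → e + c * M + (l * (m * M) + (f + d * M)) ≡ (e + f) + (c + d + l * m) * M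
        lemma = solve-∀
        lemma₂ : ∀ q ν μ m M → q * (m * M) + (ν * M + μ) ≡ μ + (q * m + ν) * M
        lemma₂ = solve-∀
      split : e + f ≡ (e + f) % M + h * M
      split = m≡m%n+[m/n]*n (e + f) M
      regroup : ∀ r h x M → r + h * M + x * M ≡ r + (h + x) * M
      regroup = solve-∀
      total′ : (e + f) % M + (h + (c + d + L * m)) * M ≡ μ + (q * m + ν) * M
      total′ = ≡.trans (sym (regroup ((e + f) % M) h _ M)) (≡.trans (cong (_+ (c + d + L * m) * M) (sym split)) total)
      rem≡μ : (e + f) % M ≡ μ
      rem≡μ = remainder-unique M (h + (c + d + L * m)) (q * m + ν) (m%n<n (e + f) M) μ<M total′
      carry : e + f ≡ μ + h * M
      carry = ≡.trans split (cong (_+ h * M) rem≡μ)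
      bal : h + (c + d) ≈ ν
      bal = begin
        ⟦ h + (c + d) ⟧             ≡⟨ +k*m (h + (c + d)) L ⟨
        ⟦ h + (c + d) + L * m ⟧     ≡⟨ cong ⟦_⟧ (+-assoc h (c + d) (L * m)) ⟩
        ⟦ h + (c + d + L * m) ⟧     ≡⟨ cong ⟦_⟧ (*-cancelʳ-≡ _ _ M (+-cancelˡ-≡ μ _ _ (≡.trans (cong (_+ (h + (c + d + L * m)) * M) (sym rem≡μ)) total′))) ⟩
        ⟦ q * m + ν ⟧               ≡⟨ cong ⟦_⟧ (+-comm (q * m) ν) ⟩
        ⟦ ν + q * m ⟧               ≡⟨ +k*m ν q ⟩
        ⟦ ν ⟧                       ∎

    -- `toPair` is not injective: for e = 0 and α = a the left word is empty whatever a is. Such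
    -- parameters are related by `≋`, so counting them up to `≋` is harmless.
    numClasses-PSPairs : ∀ {N} → NumClasses _≋_ Valid N → NumClasses (Equivk m (suc K)) (PSPairs m (suc K) n) N
    numClasses-PSPairs = numClasses-transfer (λ x y → toPair x ≡ y)
      (λ {x} v → toPair x , toPair-PSPairs v , refl)
      PSPairs-toPair
      (λ { v v′ _ _ refl refl → ≋⇒Equivk (Valid.range v) (Valid.range v′) })
      (λ { v v′ _ _ refl refl → Equivk⇒≋ (Valid.range v) (Valid.range v′) })

-- Finite sums

sum-const : ∀ c n → sum (applyUpTo (λ _ → c) n) ≡ n * c
sum-const c zero    = refl
sum-const c (suc n) = cong (c +_) (sum-const c n)

-- The value `y` that is absent at the exceptional index is added on the left, which avoids n - 1.
sum-except : ∀ (N : ℕ → ℕ) {j n x y} → j < n → N j ≡ x → (∀ {i} → i ≢ j → N i ≡ y) →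
  sum (applyUpTo N n) + y ≡ x + n * y
sum-except N {zero} {suc n} {x} {y} _ refl rest = begin
  x + sum (applyUpTo (N ∘ suc) n) + y      ≡⟨ +-assoc x _ y ⟩
  x + (sum (applyUpTo (N ∘ suc) n) + y)    ≡⟨ cong (λ s → x + (s + y)) (≡.trans (cong sum (applyUpTo-cong n (λ _ → rest (λ ())))) (sum-const y n)) ⟩
  x + (n * y + y)                          ≡⟨ cong (x +_) (+-comm (n * y) y) ⟩
  x + suc n * y                            ∎
  where open ≡-Reasoning
sum-except N {suc j} {suc n} {x} {y} (s≤s j<n) Nj rest = begin
  N 0 + sum (applyUpTo (N ∘ suc) n) + y    ≡⟨ +-assoc (N 0) _ y ⟩
  N 0 + (sum (applyUpTo (N ∘ suc) n) + y)  ≡⟨ cong₂ _+_ (rest (λ ())) (sum-except (N ∘ suc) j<n Nj (λ i≢j → rest (i≢j ∘ suc-injective))) ⟩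
  y + (x + n * y)                          ≡⟨ lemma x y (n * y) ⟩
  x + suc n * y                            ∎
  where
  open ≡-Reasoning
  lemma : ∀ x y z → y + (x + z) ≡ x + (y + z)
  lemma = solve-∀

sum-arithmetic : ∀ c n → 2 * sum (applyUpTo (c +_) n) + n ≡ n * n + 2 * c * n
sum-arithmetic c zero    = sym (*-zeroʳ (2 * c))
sum-arithmetic c (suc n) = begin
  2 * (c + 0 + sum (applyUpTo (λ i → c + suc i) n)) + suc n    ≡⟨ cong (λ s → 2 * (c + 0 + s) + suc n) (cong sum (applyUpTo-cong n (λ {i} _ → +-suc c i))) ⟩
  2 * (c + 0 + s) + suc n                                      ≡⟨ lemma c n s ⟩
  2 * c + 1 + (2 * s + n)                                      ≡⟨ cong (2 * c + 1 +_) (sum-arithmetic (suc c) n) ⟩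
  2 * c + 1 + (n * n + 2 * suc c * n)                          ≡⟨ lemma₂ c n ⟩
  suc n * suc n + 2 * c * suc n                                ∎
  where
  open ≡-Reasoning
  s = sum (applyUpTo (suc c +_) n)
  lemma : ∀ c n s → 2 * (c + 0 + s) + suc n ≡ 2 * c + 1 + (2 * s + n)
  lemma = solve-∀
  lemma₂ : ∀ c n → 2 * c + 1 + (n * n + 2 * suc c * n) ≡ suc n * suc n + 2 * c * suc n
  lemma₂ = solve-∀

-- Counting the formal sums [i] + [j] - [i + j]

module Triples (m : ℕ) (2≤m : 2 ≤ m) where
  open Residues m 2≤m

  -- (i , j) stands for the formal sum [i] + [j] − [i + j] over ℤ/m, which is [0] when i = 0 or j = 0
  -- and is otherwise reduced, hence determines the unordered pair {i , j}.
  _≍_ : ℕ × ℕ → ℕ × ℕ → Set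
  (i , j) ≍ (i′ , j′) = i ∷ j ∷ ⟦ i′ + j′ ⟧ ∷ [] ↭ i′ ∷ j′ ∷ ⟦ i + j ⟧ ∷ []

  -- Level 0 collects all pairs that represent [0], a single class. A positive level h collects the
  -- pairs of nonzero residues with maximum h, which form h unordered pairs.
  Level : ℕ → ℕ × ℕ → Set
  Level zero    (i , j) = i < m × j < m × (i ≡ 0 ⊎ j ≡ 0)
  Level (suc h) (i , j) = i < m × j < m × 0 < i × 0 < j × i ⊔ j ≡ suc h

  private
    ≉-+ : ∀ {i} j → 0 < i → i < m → ¬ (i + j ≈ j)
    ≉-+ j 0<i i<m p = <⇒≢ 0<i (sym (≈⇒≡ i<m 0<m (+-cancelʳ-≈ j p)))

    -- For nonzero i and j the residue of i + j differs from both, so it can only be matched with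
    -- that of i′ + j′; cancelling these leaves the two unordered pairs.
    unordered : ∀ {h h′ i j i′ j′} → Level (suc h) (i , j) → Level (suc h′) (i′ , j′) →
      (i , j) ≍ (i′ , j′) → (i ≡ i′ × j ≡ j′) ⊎ (i ≡ j′ × j ≡ i′)
    unordered {i = i} {j} {i′} {j′} (i<m , j<m , 0<i , 0<j , _) _ p
      with ↭.∈-resp-↭ (↭-sym p) (there (there (here refl)))
    ... | here eq = contradiction (≡.trans (cong ⟦_⟧ (+-comm j i)) (≡.trans eq (sym (⟦⟧-small i<m)))) (≉-+ i 0<j j<m)
    ... | there (here eq) = contradiction (≡.trans eq (sym (⟦⟧-small j<m))) (≉-+ j 0<i i<m)
    ... | there (there (here eq)) =
      ↭-pair (↭-cancelʳ (⟦ i + j ⟧ ∷ []) (subst (λ x → i ∷ j ∷ x ∷ [] ↭ i′ ∷ j′ ∷ ⟦ i + j ⟧ ∷ []) (sym eq) p))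

    0∉ : ∀ {i j s} → 0 < i → 0 < j → ¬ (0 ∷ s ∷ [] ↭ i ∷ j ∷ [])
    0∉ 0<i 0<j p with ↭-pair p
    ... | inj₁ (eq , _) = <⇒≢ 0<i eq
    ... | inj₂ (eq , _) = <⇒≢ 0<j eq

    zero≭suc : ∀ {h x y} → Level 0 x → Level (suc h) y → ¬ (x ≍ y)
    zero≭suc {x = i , j} {i′ , j′} (i<m , j<m , inj₁ refl) (_ , _ , 0<i′ , 0<j′ , _) p =
      0∉ 0<i′ 0<j′ (↭.drop-∷ (↭-trans (swap j 0 ↭-refl) (↭-trans
        (subst (λ x → 0 ∷ j ∷ ⟦ i′ + j′ ⟧ ∷ [] ↭ i′ ∷ j′ ∷ x ∷ []) (⟦⟧-small j<m) p) (↭.++-comm (i′ ∷ j′ ∷ []) (j ∷ [])))))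
    zero≭suc {x = i , j} {i′ , j′} (i<m , j<m , inj₂ refl) (_ , _ , 0<i′ , 0<j′ , _) p =
      0∉ 0<i′ 0<j′ (↭.drop-∷ (↭-trans
        (subst (λ x → i ∷ 0 ∷ ⟦ i′ + j′ ⟧ ∷ [] ↭ i′ ∷ j′ ∷ x ∷ []) (≡.trans (cong ⟦_⟧ (+-identityʳ i)) (⟦⟧-small i<m)) p)
        (↭.++-comm (i′ ∷ j′ ∷ []) (i ∷ []))))

    apart : ∀ {h h′ x y} → Level h x → Level h′ y → x ≍ y → h ≡ h′
    apart {zero}  {zero}   _ _ _ = refl
    apart {zero}  {suc h′} l l′ p = contradiction p (zero≭suc l l′)
    apart {suc h} {zero}   l l′ p = contradiction (↭-sym p) (zero≭suc l′ l)
    apart {suc h} {suc h′} {i , j} {i′ , j′} l@(_ , _ , _ , _ , max) l′@(_ , _ , _ , _ , max′) p with unordered l l′ p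
    ... | inj₁ (refl , refl) = ≡.trans (sym max) max′
    ... | inj₂ (refl , refl) = ≡.trans (sym max) (≡.trans (⊔-comm i j) max′)

    level : ∀ {h} → h < m → NumClasses _≍_ (Level h) (1 ⊔ h)
    level {zero} _ = numClasses-range (λ _ → 0 , 0) 1
      (λ _ → 0<m , 0<m , inj₁ refl) (λ { {zero} {zero} _ _ _ → refl ; {suc _} (s≤s ()) ; {zero} {suc _} _ (s≤s ()) })
      (λ { {i , j} (i<m , j<m , z) → 0 , z<s , cover i<m j<m z })
      where
      cover : ∀ {i j} → i < m → j < m → i ≡ 0 ⊎ j ≡ 0 → (i , j) ≍ (0 , 0)
      cover {j = j} i<m j<m (inj₁ refl) = subst₂ (λ x y → 0 ∷ j ∷ x ∷ [] ↭ 0 ∷ 0 ∷ y ∷ []) (sym (⟦⟧-small 0<m)) (sym (⟦⟧-small j<m))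
        (prep 0 (swap j 0 ↭-refl))
      cover {i} i<m j<m (inj₂ refl) = subst₂ (λ x y → i ∷ 0 ∷ x ∷ [] ↭ 0 ∷ 0 ∷ y ∷ []) (sym (⟦⟧-small 0<m))
        (sym (≡.trans (cong ⟦_⟧ (+-identityʳ i)) (⟦⟧-small i<m))) (↭.++-comm (i ∷ []) (0 ∷ 0 ∷ []))
    level {suc h} h<m = numClasses-range (λ i → suc i , suc h) (suc h) rep∈
      (λ i< j< p → inj (unordered {h} {h} (rep∈ i<) (rep∈ j<) p))
      (λ { {i , j} l → cover i j l (⊔-sel i j) })
      where
      rep∈ : ∀ {i} → i < suc h → Level (suc h) (suc i , suc h)
      rep∈ i< = ≤-<-trans i< h<m , h<m , z<s , z<s , m≤n⇒m⊔n≡n i<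
      inj : ∀ {i j} → (suc i ≡ suc j × suc h ≡ suc h) ⊎ (suc i ≡ suc h × suc h ≡ suc j) → i ≡ j
      inj (inj₁ (eq , _))   = suc-injective eq
      inj (inj₂ (eq , eq′)) = suc-injective (≡.trans eq eq′)
      cover : ∀ i j → Level (suc h) (i , j) → i ⊔ j ≡ i ⊎ i ⊔ j ≡ j → ∃ λ i′ → i′ < suc h × (i , j) ≍ (suc i′ , suc h)
      cover (suc i) j (i<m , j<m , _ , 0<j , max) (inj₂ sel) with ≡.trans (sym sel) max
      ... | refl = i , m⊔n≡n⇒m≤n sel , ↭-refl
      cover i (suc j) (i<m , j<m , 0<i , _ , max) (inj₁ sel) with ≡.trans (sym sel) max
      ... | refl = j , m⊔n≡m⇒n≤m sel , subst (λ x → suc h ∷ suc j ∷ ⟦ x ⟧ ∷ [] ↭ suc j ∷ suc h ∷ ⟦ suc h + suc j ⟧ ∷ [])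
        (+-comm (suc h) (suc j)) (swap (suc h) (suc j) ↭-refl)

  -- The sum of the level sizes, 1 + (1 + 2 + ⋯ + (m - 1)).
  T : ℕ
  T = sum (applyUpTo (1 ⊔_) m)

  numClasses-≍ : NumClasses _≍_ (λ (i , j) → i < m × j < m) T
  numClasses-≍ = numClasses-cong
    (λ { {i , j} (zero , _ , i<m , j<m , _) → i<m , j<m ; {i , j} (suc h , _ , i<m , j<m , _) → i<m , j<m })
    (λ { {i , j} (i<m , j<m) → find i j i<m j<m })
    (numClasses-⋃ Level (1 ⊔_) m (λ _ _ → apart) level)
    where
    find : ∀ i j → i < m → j < m → ∃ λ h → h < m × Level h (i , j)
    find zero    j       i<m j<m = 0 , 0<m , i<m , j<m , inj₁ refl
    find (suc i) zero    i<m j<m = 0 , 0<m , i<m , j<m , inj₂ refl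
    find (suc i) (suc j) i<m j<m = suc (i ⊔ j) , ⊔-lub i<m j<m , i<m , j<m , z<s , z<s , refl

  T-value : 2 * T + m ≡ m * m + 2
  T-value = by-pred (pred m) (suc-pred m)
    where
    by-pred : ∀ n → suc n ≡ m → 2 * T + m ≡ m * m + 2
    by-pred n refl = begin
      2 * (1 + s) + suc n             ≡⟨ lemma s n ⟩
      3 + (2 * s + n)                 ≡⟨ cong (3 +_) (sum-arithmetic 1 n) ⟩
      3 + (n * n + 2 * 1 * n)         ≡⟨ lemma₂ n ⟩
      suc n * suc n + 2               ∎
      where
      open ≡-Reasoning
      s = sum (applyUpTo suc n)
      lemma : ∀ s n → 2 * (1 + s) + suc n ≡ 3 + (2 * s + n)
      lemma = solve-∀
      lemma₂ : ∀ n → 3 + (n * n + 2 * 1 * n) ≡ suc n * suc n + 2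
      lemma₂ = solve-∀

  translate : ℕ → ℕ → ℕ
  translate β x = ⟦ x + β ⟧

  ≍-translate : ∀ {i j i′ j′} β → (i , j) ≍ (i′ , j′) → let τ = translate β in
    τ i ∷ τ j ∷ τ (i′ + j′) ∷ [] ↭ τ i′ ∷ τ j′ ∷ τ (i + j) ∷ []
  ≍-translate {i} {j} {i′} {j′} β p = subst₂ (λ x y → τ i ∷ τ j ∷ x ∷ [] ↭ τ i′ ∷ τ j′ ∷ y ∷ [])
    (⟦⟧+ (i′ + j′) β) (⟦⟧+ (i + j) β) (↭.map⁺ τ p)
    where τ = translate β

  ≍-untranslate : ∀ {i j i′ j′} β → β < m → i < m → j < m → i′ < m → j′ < m → let τ = translate β in
    τ i ∷ τ j ∷ τ (i′ + j′) ∷ [] ↭ τ i′ ∷ τ j′ ∷ τ (i + j) ∷ [] → (i , j) ≍ (i′ , j′)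
  ≍-untranslate {i} {j} {i′} {j′} β β<m i<m j<m i′<m j′<m p = subst₂ _↭_
    (cong₂ _∷_ (undo i<m) (cong₂ (λ x y → x ∷ y ∷ []) (undo j<m) (inverse (i′ + j′))))
    (cong₂ _∷_ (undo i′<m) (cong₂ (λ x y → x ∷ y ∷ []) (undo j′<m) (inverse (i + j))))
    (↭.map⁺ (translate (⁻ β)) p)
    where
    inverse : ∀ x → translate (⁻ β) (translate β x) ≡ ⟦ x ⟧
    inverse x = begin
      ⟦ ⟦ x + β ⟧ + ⁻ β ⟧     ≡⟨ ⟦⟧+ (x + β) (⁻ β) ⟩
      ⟦ x + β + ⁻ β ⟧         ≡⟨ cong ⟦_⟧ (lemma x β (⁻ β)) ⟩
      ⟦ x + ⁻ β + β ⟧         ≡⟨ ⁻-inverse x (<⇒≤ β<m) ⟩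
      ⟦ x ⟧                   ∎
      where
      open ≡-Reasoning
      lemma : ∀ a b c → a + b + c ≡ a + c + b
      lemma = solve-∀
    undo : ∀ {x} → x < m → translate (⁻ β) (translate β x) ≡ x
    undo {x} x<m = ≡.trans (inverse x) (⟦⟧-small x<m)

-- Classes of parameters with prescribed e

module Counting (m : ℕ) (2≤m : 2 ≤ m) (κ ν μ : ℕ) (ν<m : ν < m) where
  open Residues m 2≤m
  open Pairs m 2≤m κ
  open Validity m 2≤m κ ν μ ν<m
  open Triples m 2≤m

  ≋-refl : ∀ {x} → x ≋ x
  ≋-refl = ≋-intro refl refl (λ _ → refl) (λ _ → refl) ↭-refl

  ValidAt : ℕ → Param → Set
  ValidAt e x = Valid x × Param.e x ≡ e

  module Fixed {e f h : ℕ} (e<M : e < M) (f<M : f < M) (e+f≡ : e + f ≡ μ + h * M) where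

    -- A given e leaves only one residue for f modulo M, hence one f and one carry.
    carry-unique : ∀ {f′ h′} → f′ < M → e + f′ ≡ μ + h′ * M → f′ ≡ f × h′ ≡ h
    carry-unique {f′} {h′} f′<M eq = f≡ , h≡
      where
      open ≡-Reasoning
      f≡ : f′ ≡ f
      f≡ = remainder-unique M h h′ f′<M f<M (+-cancelˡ-≡ e _ _ (begin
        e + (f′ + h * M)        ≡⟨ +-assoc e f′ _ ⟨
        e + f′ + h * M          ≡⟨ cong (_+ h * M) eq ⟩
        μ + h′ * M + h * M      ≡⟨ lemma μ (h′ * M) (h * M) ⟩
        μ + h * M + h′ * M      ≡⟨ cong (_+ h′ * M) e+f≡ ⟨
        e + f + h′ * M          ≡⟨ +-assoc e f _ ⟩
        e + (f + h′ * M)        ∎))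
        where
        lemma : ∀ a b c → a + b + c ≡ a + c + b
        lemma = solve-∀
      h≡ : h′ ≡ h
      h≡ = *-cancelʳ-≡ h′ h M (+-cancelˡ-≡ μ _ _ (≡.trans (sym eq) (≡.trans (cong (e +_) f≡) e+f≡)))

    -- The carry is in fact at most 1; the bound has this form because `⁻ h` represents -h only for
    -- `h ≤ m`.
    h≤m : h ≤ m
    h≤m = ≤-trans (s≤s⁻¹ (*-cancelʳ-< M h 2 (begin-strict
      h * M          ≤⟨ m≤n+m (h * M) μ ⟩
      μ + h * M      ≡⟨ e+f≡ ⟨
      e + f          <⟨ +-mono-<-≤ e<M (<⇒≤ f<M) ⟩
      M + M          ≡⟨ cong (M +_) (+-identityʳ M) ⟨
      2 * M          ∎))) 0<m
      where open ≤-Reasoning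

    f≡f : ∀ {x} → ValidAt e x → Param.f x ≡ f
    f≡f (v , refl) = proj₁ (carry-unique {h′ = Valid.h v} (Valid.f<M v) (Valid.carry v))

    balance-h : ∀ {x} → ValidAt e x → let open Param x in a + γ + h ≈ ν + α + b
    balance-h {x} (v , refl) = subst (λ h → a + γ + h ≈ ν + α + b) (proj₂ (carry-unique (Valid.f<M v) (Valid.carry v))) (Valid.balance v)
      where open Param x

    module Generic (e≢0 : e ≢ 0) (f≢0 : f ≢ 0) where

      -- δ is an invariant of the class: `balance` becomes γ + h = ν + α + δ, in which α and γ are
      -- both visible. Within fixed α and δ the letter a is the only freedom.
      Offset : ℕ → ℕ → Param → Set
      Offset α δ x = ValidAt e x × Param.α x ≡ α × Param.b x ≈ Param.a x + δ

      private
        γ+h : ∀ {α δ x} → Offset α δ x → Param.γ x + h ≈ ν + α + δ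
        γ+h {δ = δ} {x} (v , refl , b≈) = +-cancelʳ-≈ a (begin
          ⟦ γ + h + a ⟧           ≡⟨ cong ⟦_⟧ (lemma γ h a) ⟩
          ⟦ a + γ + h ⟧           ≡⟨ balance-h v ⟩
          ⟦ ν + α + b ⟧           ≡⟨ +-cong {ν + α} refl b≈ ⟩
          ⟦ ν + α + (a + δ) ⟧     ≡⟨ cong ⟦_⟧ (lemma₂ (ν + α) a δ) ⟩
          ⟦ ν + α + δ + a ⟧       ∎)
          where
          open Param x
          open ≡-Reasoning
          lemma : ∀ g h a → g + h + a ≡ a + g + h
          lemma = solve-∀
          lemma₂ : ∀ n a d → n + (a + d) ≡ n + d + a
          lemma₂ = solve-∀

        rep : ℕ → ℕ → ℕ → Param
        rep α δ a = param e f α a ⟦ a + δ ⟧ ⟦ ν + α + δ + ⁻ h ⟧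

        rep∈ : ∀ {α δ a} → α < m → a < m → Offset α δ (rep α δ a)
        rep∈ {α} {δ} {a} α<m a<m =
          (valid (inRange e<M f<M α<m a<m (⟦⟧<m _) (⟦⟧<m _)) h e+f≡ bal , refl) , refl , ⟦⟧-idem (a + δ)
          where
          open ≡-Reasoning
          bal : a + ⟦ ν + α + δ + ⁻ h ⟧ + h ≈ ν + α + ⟦ a + δ ⟧
          bal = begin
            ⟦ a + ⟦ ν + α + δ + ⁻ h ⟧ + h ⟧    ≡⟨ +-cong (+-cong {a} refl (⟦⟧-idem (ν + α + δ + ⁻ h))) refl ⟩
            ⟦ a + (ν + α + δ + ⁻ h) + h ⟧      ≡⟨ cong ⟦_⟧ (lemma a (ν + α) δ (⁻ h) h) ⟩
            ⟦ ν + α + (a + δ) + ⁻ h + h ⟧      ≡⟨ ⁻-inverse (ν + α + (a + δ)) h≤m ⟩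
            ⟦ ν + α + (a + δ) ⟧                ≡⟨ +-cong {ν + α} refl (⟦⟧-idem (a + δ)) ⟨
            ⟦ ν + α + ⟦ a + δ ⟧ ⟧              ∎
            where
            lemma : ∀ a n d i h → a + (n + d + i) + h ≡ n + (a + d) + i + h
            lemma = solve-∀

        ≡rep : ∀ {α δ x} → Offset α δ x → x ≡ rep α δ (Param.a x)
        ≡rep {α} {δ} {x} o@(v@(vx , refl) , refl , b≈) = params (f≡f v)
          (≡.trans (sym (⟦⟧-small b<m)) b≈)
          (≈⇒≡ γ<m (⟦⟧<m _) (≡.trans (+-cancelʳ-≈ h (≡.trans (γ+h o) (sym (⁻-inverse (ν + α + δ) h≤m)))) (sym (⟦⟧-idem (ν + α + δ + ⁻ h)))))
          where
          open Valid vx using (b<m; γ<m)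
          params : ∀ {e α a f f′ b b′ γ γ′} → f ≡ f′ → b ≡ b′ → γ ≡ γ′ → param e f α a b γ ≡ param e f′ α a b′ γ′
          params refl refl refl = refl

        classes : ℕ → ℕ
        classes zero    = 1
        classes (suc _) = m

        count : ∀ {α δ} → α < m → δ < m → NumClasses _≋_ (Offset α δ) (classes δ)
        count {α} {zero} α<m _ = numClasses-range (λ _ → rep α 0 0) 1 (λ _ → rep∈ α<m 0<m)
          (λ { {zero} {zero} _ _ _ → refl ; {suc _} (s≤s ()) ; {zero} {suc _} _ (s≤s ()) })
          (λ {x} o → 0 , z<s , subst (_≋ rep α 0 0) (sym (≡rep o))
            (≋-intro refl refl (λ _ → refl) (λ _ → refl)
              (prep α (subst₂ (λ y z → y ∷ 0 ∷ γ₀ ∷ [] ↭ z ∷ Param.a x ∷ γ₀ ∷ [])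
                (sym (≡.trans (cong ⟦_⟧ (+-identityʳ (Param.a x))) (⟦⟧-small (Valid.a<m (proj₁ (proj₁ o))))))
                (sym (⟦⟧-small 0<m)) (swap (Param.a x) 0 ↭-refl)))))
          where γ₀ = ⟦ ν + α + 0 + ⁻ h ⟧
        count {α} {suc δ} α<m δ<m = numClasses-range (rep α (suc δ)) m (rep∈ α<m)
          (λ i<m _ r → inj i<m (↭-pair (↭-cancelʳ (⟦ ν + α + suc δ + ⁻ h ⟧ ∷ []) (↭.drop-∷ (_≋_.boundary≡ r)))))
          (λ {x} o → Param.a x , Valid.a<m (proj₁ (proj₁ o)) , subst (_≋ rep α (suc δ) (Param.a x)) (sym (≡rep o)) ≋-refl)
          where
          -- A nonzero offset makes [a + δ] - [a] reduced, so it determines a: the crosswise match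
          -- would give i + δ = i.
          inj : ∀ {i j} → i < m → (⟦ i + suc δ ⟧ ≡ ⟦ j + suc δ ⟧ × j ≡ i) ⊎ (⟦ i + suc δ ⟧ ≡ i × j ≡ ⟦ j + suc δ ⟧) → i ≡ j
          inj i<m (inj₁ (_ , j≡i)) = sym j≡i
          inj {i} i<m (inj₂ (i≡ , _)) = contradiction
            (≈⇒≡ δ<m 0<m (≈-cancel i (≡.trans i≡ (sym (⟦⟧-small i<m))) (+-comm i (suc δ)) refl)) (λ ())

      numClasses-generic : NumClasses _≋_ (ValidAt e) (m * (1 + pred m * m))
      numClasses-generic = subst (NumClasses _≋_ (ValidAt e))
        (≡.trans (sum-const _ m) (cong (m *_) sum-classes))
        (numClasses-cong (λ { (_ , _ , _ , _ , v , _) → v }) (λ {x} → find x)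
          (numClasses-⋃ (λ α x → ∃ λ δ → δ < m × Offset α δ x) (λ _ → sum (applyUpTo classes m)) m
            (λ { _ _ (_ , _ , (_ , refl) , refl , _) (_ , _ , (_ , _) , refl , _) r → _≋_.α≡ r e≢0 })
            (λ {α} α<m → numClasses-⋃ (Offset α) classes m
              (λ {δ} {δ′} {x} {y} δ<m δ′<m o o′ r → ≈⇒≡ δ<m δ′<m (apart {α} {δ} {δ′} {x} {y} o o′ r)) (count α<m))))
        where
        sum-classes : sum (applyUpTo classes m) ≡ 1 + pred m * m
        sum-classes = ≡.trans (cong (sum ∘ applyUpTo classes) (sym (suc-pred m))) (cong suc (sum-const m (pred m)))
        apart : ∀ {α δ δ′ x y} → Offset α δ x → Offset α δ′ y → x ≋ y → δ ≈ δ′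
        apart {α} {δ} {δ′} {x} {y} o o′ r = ≈-cancel (ν + α)
          (≡.trans (sym (γ+h o)) (≡.trans (cong (λ γ → ⟦ γ + h ⟧) (_≋_.γ≡ r (λ f≡0 → f≢0 (≡.trans (sym (f≡f (proj₁ o))) f≡0)))) (γ+h o′)))
          (+-comm (ν + α) δ) (+-comm (ν + α) δ′)
        find : ∀ x → ValidAt e x → ∃ λ α → α < m × ∃ λ δ → δ < m × Offset α δ x
        find x v = α , α<m , ⟦ b + ⁻ a ⟧ , ⟦⟧<m _ , v , refl ,
          sym (≡.trans (cong ⟦_⟧ (+-comm a ⟦ b + ⁻ a ⟧)) (≡.trans (⟦⟧+ (b + ⁻ a) a) (⁻-inverse b (<⇒≤ a<m))))
          where
          open Param x
          open Valid (proj₁ v) using (α<m; a<m; b<m; γ<m)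

  module LeftAligned (0<M : 0 < M) (μ<M : μ < M) (μ≢0 : μ ≢ 0) where
    open Fixed {0} {μ} {0} 0<M μ<M (sym (+-identityʳ μ))

    private
      -- With no carry, `balance` is a + γ = ν + α + b. Measured from β = γ - ν this says that a is
      -- the sum of α and b, so [α] + [b] - [a] is a translate of [i] + [j] - [i + j].
      base : ℕ → ℕ
      base γ = ⟦ γ + ⁻ ν ⟧

      base+ν : ∀ γ → base γ + ν ≈ γ
      base+ν γ = ≡.trans (⟦⟧+ (γ + ⁻ ν) ν) (⁻-inverse γ (<⇒≤ ν<m))

      G : ℕ → ℕ × ℕ → Param → Set
      G γ (i , j) x = Param.α x ≡ τ i × Param.b x ≡ τ j × Param.a x ≡ τ (i + j)
        where τ = translate (base γ)

      count : ∀ {γ} → γ < m → NumClasses _≋_ (λ x → ValidAt 0 x × Param.γ x ≡ γ) T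
      count {γ} γ<m = numClasses-transfer (G γ) total onto to from numClasses-≍
        where
        β = base γ
        τ = translate β
        total : ∀ {ij} → proj₁ ij < m × proj₂ ij < m → ∃ λ x → (ValidAt 0 x × Param.γ x ≡ γ) × G γ ij x
        total {i , j} _ = param 0 μ (τ i) (τ (i + j)) (τ j) γ ,
          ((valid (inRange 0<M μ<M (⟦⟧<m _) (⟦⟧<m _) (⟦⟧<m _) γ<m) 0 (sym (+-identityʳ μ)) bal , refl) , refl) , refl , refl , refl
          where
          open ≡-Reasoning
          lemma : ∀ i j β ν → i + j + β + (β + ν) + 0 ≡ ν + (i + β) + (j + β)
          lemma = solve-∀
          bal : τ (i + j) + γ + 0 ≈ ν + τ i + τ j
          bal = begin
            ⟦ τ (i + j) + γ + 0 ⟧                ≡⟨ +-cong (+-cong (⟦⟧-idem (i + j + β)) (sym (base+ν γ))) refl ⟩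
            ⟦ i + j + β + (β + ν) + 0 ⟧          ≡⟨ cong ⟦_⟧ (lemma i j β ν) ⟩
            ⟦ ν + (i + β) + (j + β) ⟧            ≡⟨ +-cong (+-cong {ν} refl (⟦⟧-idem (i + β))) (⟦⟧-idem (j + β)) ⟨
            ⟦ ν + τ i + τ j ⟧                    ∎
        onto : ∀ {x} → ValidAt 0 x × Param.γ x ≡ γ → ∃ λ ij → (proj₁ ij < m × proj₂ ij < m) × G γ ij x
        onto {x} (v , refl) = (i , j) , (⟦⟧<m _ , ⟦⟧<m _) , ≈⇒≡ α<m (⟦⟧<m _) α≈ , ≈⇒≡ b<m (⟦⟧<m _) b≈ , ≈⇒≡ a<m (⟦⟧<m _) a≈
          where
          open Param x hiding (γ)
          open Valid (proj₁ v) using (α<m; a<m; b<m; γ<m)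
          open ≡-Reasoning
          i = ⟦ α + ⁻ β ⟧
          j = ⟦ b + ⁻ β ⟧
          back : ∀ y → ⟦ y + ⁻ β ⟧ + β ≈ y
          back y = ≡.trans (⟦⟧+ (y + ⁻ β) β) (⁻-inverse y (<⇒≤ (⟦⟧<m (γ + ⁻ ν))))
          α≈ : α ≈ τ i
          α≈ = sym (≡.trans (⟦⟧-idem (i + β)) (back α))
          b≈ : b ≈ τ j
          b≈ = sym (≡.trans (⟦⟧-idem (j + β)) (back b))
          lemma : ∀ i j β ν → ν + (i + β) + (j + β) ≡ i + j + β + (β + ν)
          lemma = solve-∀
          a≈ : a ≈ τ (i + j)
          a≈ = ≡.trans (+-cancelʳ-≈ γ (begin
            ⟦ a + γ ⟧                          ≡⟨ cong ⟦_⟧ (+-identityʳ (a + γ)) ⟨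
            ⟦ a + γ + 0 ⟧                      ≡⟨ balance-h v ⟩
            ⟦ ν + α + b ⟧                      ≡⟨ +-cong (+-cong {ν} refl (back α)) (back b) ⟨
            ⟦ ν + (i + β) + (j + β) ⟧          ≡⟨ cong ⟦_⟧ (lemma i j β ν) ⟩
            ⟦ i + j + β + (β + ν) ⟧            ≡⟨ +-cong {i + j + β} refl (base+ν γ) ⟩
            ⟦ i + j + β + γ ⟧                  ∎)) (sym (⟦⟧-idem (i + j + β)))
        to : ∀ {ij ij′ x x′} → proj₁ ij < m × proj₂ ij < m → proj₁ ij′ < m × proj₂ ij′ < m →
          ValidAt 0 x × Param.γ x ≡ γ → ValidAt 0 x′ × Param.γ x′ ≡ γ → G γ ij x → G γ ij′ x′ → ij ≍ ij′ → x ≋ x′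
        to _ _ (v@(_ , refl) , refl) (v′@(_ , refl) , refl) (refl , refl , refl) (refl , refl , refl) p =
          ≋-intro refl (≡.trans (f≡f v) (sym (f≡f v′))) (λ 0≢0 → contradiction refl 0≢0) (λ _ → refl)
            (↭.++⁺ʳ (γ ∷ []) (≍-translate β p))
        from : ∀ {ij ij′ x x′} → proj₁ ij < m × proj₂ ij < m → proj₁ ij′ < m × proj₂ ij′ < m →
          ValidAt 0 x × Param.γ x ≡ γ → ValidAt 0 x′ × Param.γ x′ ≡ γ → G γ ij x → G γ ij′ x′ → x ≋ x′ → ij ≍ ij′
        from (i<m , j<m) (i′<m , j′<m) (_ , refl) (_ , refl) (refl , refl , refl) (refl , refl , refl) r =
          ≍-untranslate β (⟦⟧<m _) i<m j<m i′<m j′<m (↭-cancelʳ (γ ∷ []) (_≋_.boundary≡ r))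

    numClasses-leftAligned : NumClasses _≋_ (ValidAt 0) (m * T)
    numClasses-leftAligned = subst (NumClasses _≋_ (ValidAt 0)) (sum-const T m)
      (numClasses-cong (λ { (_ , _ , v , _) → v }) (λ {x} v → Param.γ x , Valid.γ<m (proj₁ v) , v , refl)
        (numClasses-⋃ (λ γ x → ValidAt 0 x × Param.γ x ≡ γ) (λ _ → T) m
          (λ { _ _ (v , refl) (_ , refl) r → _≋_.γ≡ r (λ f≡0 → μ≢0 (≡.trans (sym (f≡f v)) f≡0)) }) count))

  module RightAligned (0<M : 0 < M) (μ<M : μ < M) (μ≢0 : μ ≢ 0) where
    open Fixed {μ} {0} {0} μ<M 0<M refl

    private
      -- Here α is the visible letter. Measured from α + ν, `balance` says that b is the sum of a
      -- and γ. The derivative without [α] is then the negative of a translated triple, so the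
      -- permutations below are reversed.
      G : ℕ → ℕ × ℕ → Param → Set
      G α (i , j) x = Param.a x ≡ τ i × Param.γ x ≡ τ j × Param.b x ≡ τ (i + j)
        where τ = translate ⟦ α + ν ⟧

      count : ∀ {α} → α < m → NumClasses _≋_ (λ x → ValidAt μ x × Param.α x ≡ α) T
      count {α} α<m = numClasses-transfer (G α) total onto to from numClasses-≍
        where
        β = ⟦ α + ν ⟧
        τ = translate β
        total : ∀ {ij} → proj₁ ij < m × proj₂ ij < m → ∃ λ x → (ValidAt μ x × Param.α x ≡ α) × G α ij x
        total {i , j} _ = param μ 0 α (τ i) (τ (i + j)) (τ j) ,
          ((valid (inRange μ<M 0<M α<m (⟦⟧<m _) (⟦⟧<m _) (⟦⟧<m _)) 0 refl bal , refl) , refl) , refl , refl , refl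
          where
          open ≡-Reasoning
          lemma : ∀ i j β α ν → i + β + (j + (α + ν)) + 0 ≡ ν + α + (i + j + β)
          lemma = solve-∀
          bal : τ i + τ j + 0 ≈ ν + α + τ (i + j)
          bal = begin
            ⟦ τ i + τ j + 0 ⟧                  ≡⟨ +-cong (+-cong (⟦⟧-idem (i + β)) (⟦⟧-idem (j + β))) refl ⟩
            ⟦ i + β + (j + β) + 0 ⟧            ≡⟨ +-cong (+-cong {i + β} refl (+-cong {j} refl (⟦⟧-idem (α + ν)))) refl ⟩
            ⟦ i + β + (j + (α + ν)) + 0 ⟧      ≡⟨ cong ⟦_⟧ (lemma i j β α ν) ⟩
            ⟦ ν + α + (i + j + β) ⟧            ≡⟨ +-cong {ν + α} refl (⟦⟧-idem (i + j + β)) ⟨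
            ⟦ ν + α + τ (i + j) ⟧              ∎
        onto : ∀ {x} → ValidAt μ x × Param.α x ≡ α → ∃ λ ij → (proj₁ ij < m × proj₂ ij < m) × G α ij x
        onto {x} (v , refl) = (i , j) , (⟦⟧<m _ , ⟦⟧<m _) , ≈⇒≡ a<m (⟦⟧<m _) a≈ , ≈⇒≡ γ<m (⟦⟧<m _) γ≈ , ≈⇒≡ b<m (⟦⟧<m _) b≈
          where
          open Param x hiding (α)
          open Valid (proj₁ v) using (a<m; b<m; γ<m)
          open ≡-Reasoning
          i = ⟦ a + ⁻ β ⟧
          j = ⟦ γ + ⁻ β ⟧
          back : ∀ y → ⟦ y + ⁻ β ⟧ + β ≈ y
          back y = ≡.trans (⟦⟧+ (y + ⁻ β) β) (⁻-inverse y (<⇒≤ (⟦⟧<m (α + ν))))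
          a≈ : a ≈ τ i
          a≈ = sym (≡.trans (⟦⟧-idem (i + β)) (back a))
          γ≈ : γ ≈ τ j
          γ≈ = sym (≡.trans (⟦⟧-idem (j + β)) (back γ))
          lemma : ∀ i j β α ν → i + β + (j + (α + ν)) + 0 ≡ i + j + β + (ν + α)
          lemma = solve-∀
          b≈ : b ≈ τ (i + j)
          b≈ = ≡.trans (+-cancelʳ-≈ (ν + α) (begin
            ⟦ b + (ν + α) ⟧                    ≡⟨ cong ⟦_⟧ (+-comm b (ν + α)) ⟩
            ⟦ ν + α + b ⟧                      ≡⟨ balance-h v ⟨
            ⟦ a + γ + 0 ⟧                      ≡⟨ +-cong (+-cong (back a) (back γ)) refl ⟨
            ⟦ i + β + (j + β) + 0 ⟧            ≡⟨ +-cong (+-cong {i + β} refl (+-cong {j} refl (⟦⟧-idem (α + ν)))) refl ⟩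
            ⟦ i + β + (j + (α + ν)) + 0 ⟧      ≡⟨ cong ⟦_⟧ (lemma i j β α ν) ⟩
            ⟦ i + j + β + (ν + α) ⟧            ∎)) (sym (⟦⟧-idem (i + j + β)))
        to : ∀ {ij ij′ x x′} → proj₁ ij < m × proj₂ ij < m → proj₁ ij′ < m × proj₂ ij′ < m →
          ValidAt μ x × Param.α x ≡ α → ValidAt μ x′ × Param.α x′ ≡ α → G α ij x → G α ij′ x′ → ij ≍ ij′ → x ≋ x′
        to {i , j} {i′ , j′} _ _ (v@(_ , refl) , refl) (v′@(_ , refl) , refl) (refl , refl , refl) (refl , refl , refl) p =
          ≋-intro refl (≡.trans (f≡f v) (sym (f≡f v′))) (λ _ → refl) (λ f≢0 → contradiction (f≡f v) f≢0)
            (prep α (↭-trans (↭.++-comm (τ (i + j) ∷ []) (τ i′ ∷ τ j′ ∷ []))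
              (↭-trans (↭-sym (≍-translate β p)) (↭.++-comm (τ i ∷ τ j ∷ []) (τ (i′ + j′) ∷ [])))))
        from : ∀ {ij ij′ x x′} → proj₁ ij < m × proj₂ ij < m → proj₁ ij′ < m × proj₂ ij′ < m →
          ValidAt μ x × Param.α x ≡ α → ValidAt μ x′ × Param.α x′ ≡ α → G α ij x → G α ij′ x′ → x ≋ x′ → ij ≍ ij′
        from {i , j} {i′ , j′} (i<m , j<m) (i′<m , j′<m) (_ , refl) (_ , refl) (refl , refl , refl) (refl , refl , refl) r =
          ≍-untranslate β (⟦⟧<m _) i<m j<m i′<m j′<m (↭-trans (↭.++-comm (τ i ∷ τ j ∷ []) (τ (i′ + j′) ∷ []))
            (↭-trans (↭-sym (↭.drop-∷ (_≋_.boundary≡ r))) (↭.++-comm (τ (i + j) ∷ []) (τ i′ ∷ τ j′ ∷ []))))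

    numClasses-rightAligned : NumClasses _≋_ (ValidAt μ) (m * T)
    numClasses-rightAligned = subst (NumClasses _≋_ (ValidAt μ)) (sum-const T m)
      (numClasses-cong (λ { (_ , _ , v , _) → v }) (λ {x} v → Param.α x , Valid.α<m (proj₁ v) , v , refl)
        (numClasses-⋃ (λ α x → ValidAt μ x × Param.α x ≡ α) (λ _ → T) m
          (λ { _ _ ((_ , e≡) , refl) (_ , refl) r → _≋_.α≡ r (λ e≡0 → μ≢0 (≡.trans (sym e≡) e≡0)) }) count))

-- The case e = f = 0 and abelian complexity

module Aligned (m : ℕ) (2≤m : 2 ≤ m) (κ ν : ℕ) (ν<m : ν < m) where
  open Residues m 2≤m
  open Morphism m 2≤m
  open Segments m 2≤m
  open Pairs m 2≤m κ
  open Validity m 2≤m κ ν 0 ν<m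
  open Counting m 2≤m κ ν 0 ν<m
  open Fixed {0} {0} {0} (m^n>0 m K) (m^n>0 m K) refl

  private
    fill : ℕ × ℕ × ℕ → Param
    fill (α , a , b) = param 0 0 α a b ⟦ ν + α + b + ⁻ a ⟧

    R : ℕ × ℕ × ℕ → ℕ × ℕ × ℕ → Set
    R s s′ = SameBoundary (fill s) (fill s′)

    triples : List (ℕ × ℕ × ℕ)
    triples = cartesianProduct (upTo m) (cartesianProduct (upTo m) (upTo m))

    ∈-triples⁻ : ∀ {α a b} → (α , a , b) ∈ triples → α < m × a < m × b < m
    ∈-triples⁻ p =
      let (α∈ , q)  = ∈-cartesianProduct⁻ (upTo m) (cartesianProduct (upTo m) (upTo m)) p
          (a∈ , b∈) = ∈-cartesianProduct⁻ (upTo m) (upTo m) q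
      in ∈-upTo⁻ α∈ , ∈-upTo⁻ a∈ , ∈-upTo⁻ b∈

    fill-valid : ∀ {s} → s ∈ triples → ValidAt 0 (fill s)
    fill-valid {α , a , b} p with ∈-triples⁻ p
    ... | α<m , a<m , b<m = valid (inRange (m^n>0 m K) (m^n>0 m K) α<m a<m b<m (⟦⟧<m _)) 0 refl bal , refl
      where
      open ≡-Reasoning
      lemma : ∀ a x y → a + (x + y) + 0 ≡ x + y + a
      lemma = solve-∀
      bal : a + ⟦ ν + α + b + ⁻ a ⟧ + 0 ≈ ν + α + b
      bal = begin
        ⟦ a + ⟦ ν + α + b + ⁻ a ⟧ + 0 ⟧   ≡⟨ +-cong (+-cong {a} refl (⟦⟧-idem (ν + α + b + ⁻ a))) refl ⟩
        ⟦ a + (ν + α + b + ⁻ a) + 0 ⟧     ≡⟨ cong ⟦_⟧ (lemma a (ν + α + b) (⁻ a)) ⟩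
        ⟦ ν + α + b + ⁻ a + a ⟧           ≡⟨ ⁻-inverse (ν + α + b) (<⇒≤ a<m) ⟩
        ⟦ ν + α + b ⟧                     ∎

    fill-onto : ∀ {x} → ValidAt 0 x → ∃ λ s → s ∈ triples × fill s ≡ x
    fill-onto {x} v@(vx , refl) = (α , a , b) ,
      ∈-cartesianProduct⁺ (∈-upTo⁺ α<m) (∈-cartesianProduct⁺ (∈-upTo⁺ a<m) (∈-upTo⁺ b<m)) ,
      params (sym (f≡f v)) (≈⇒≡ (⟦⟧<m _) γ<m (≡.trans (⟦⟧-idem (ν + α + b + ⁻ a)) (+-cancelʳ-≈ a (begin
        ⟦ ν + α + b + ⁻ a + a ⟧           ≡⟨ ⁻-inverse (ν + α + b) (<⇒≤ a<m) ⟩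
        ⟦ ν + α + b ⟧                     ≡⟨ balance-h v ⟨
        ⟦ a + γ + 0 ⟧                     ≡⟨ cong ⟦_⟧ (≡.trans (+-identityʳ (a + γ)) (+-comm a γ)) ⟩
        ⟦ γ + a ⟧                         ∎))))
      where
      open Param x
      open Valid vx using (α<m; a<m; b<m; γ<m)
      open ≡-Reasoning
      params : ∀ {e f f′ α a b γ γ′} → f ≡ f′ → γ ≡ γ′ → param e f α a b γ ≡ param e f′ α a b γ′
      params refl refl = refl

  -- No closed form is sought: γ is determined by the other three letters, so the parameters form a
  -- finite list, and equality of derivatives is decidable.
  numClasses-aligned : ∃ λ N → NumClasses _≋_ (ValidAt 0) N
  numClasses-aligned = let (N , count) = numClasses-finite {R = R} ↭-refl (λ _ _ → ↭-dec _ _) triples in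
    N , numClasses-transfer (λ s x → fill s ≡ x)
      (λ {s} p → fill s , fill-valid p , refl) fill-onto
      (λ { _ _ _ _ refl refl r → ≋-intro refl refl (λ 0≢0 → contradiction refl 0≢0) (λ 0≢0 → contradiction refl 0≢0) r })
      (λ { _ _ _ _ refl refl → _≋_.boundary≡ }) count

  private
    boundary-concatMap-σ : ∀ u → Boundary (concatMap (σ m) u) [] []
    boundary-concatMap-σ []      = record { balance = λ _ → refl }
    boundary-concatMap-σ (x ∷ u) = boundary-++ (boundary-full x) (boundary-concatMap-σ u)

    factor<m : ∀ {U} → IsFactor m U → All (_< m) U
    factor<m (i , eq) = subst (All (_< m)) (sym eq) (All.map⁺ (All.universal (λ j → t<m (i + j)) _))

    -- The two segments have ν or m + ν letters altogether. One block σ(u) with u a single letter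
    -- makes up the difference in the first case, and u is empty in the second; the derivative is
    -- the same either way.
    total : ∀ {x} → ValidAt 0 x → ∃ λ U → FactorsOfLength m (m + ν) U × HasBoundary U x
    total {x} v@(vx , refl) with ≈ν⇒ (dist-balance {α} {a} {b} {γ} 0 α<m b<m (balance-h v))
      where
      open Param x
      open Valid vx using (α<m; b<m)
    ... | Q , Q≡ with factor-between (1 ∸ Q) (Valid.a<m vx) (Valid.b<m vx)
    ...   | u , j , len-u , slice≡ = segment α a ++ σpow m 1 u ++ segment b γ ,
      (extend-isFactor 1 u j (segment α a) (segment b γ) slice≡ suffix prefix , len) ,
      boundary-++ (boundary-segment α<m a<m) (boundary-++ (boundary-concatMap-σ u) (boundary-segment b<m γ<m))
      where
      open Param x
      open Valid vx using (α<m; a<m; b<m; γ<m)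
      open ≡-Reasoning
      suffix : ∃ λ z → σpow m 1 (a ∷ []) ≡ z ++ segment α a
      suffix = let (w , eq) = σ-split-suffix {α} {a} α<m in w ++ ⟦ α + pred m ⟧ ∷ [] ,
        ≡.trans (++-identityʳ (σ m a)) (≡.trans eq (sym (++-assoc w (⟦ α + pred m ⟧ ∷ []) (segment α a))))
      prefix : ∃ λ z → σpow m 1 (b ∷ []) ≡ segment b γ ++ z
      prefix = let (w , eq) = σ-split-prefix b<m γ<m in γ ∷ w , ≡.trans (++-identityʳ (σ m b)) eq
      Q≤1 : Q ≤ 1
      Q≤1 = s≤s⁻¹ (*-cancelʳ-< m Q 2 (≤-<-trans (≤-trans (m≤n+m (Q * m) ν) (≤-reflexive (sym Q≡)))
        (<-≤-trans (+-mono-< (dist<m α a) (dist<m b γ)) (≤-reflexive (cong (m +_) (sym (+-identityʳ m)))))))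
      lemma : ∀ c d l m → c + (l * m + d) ≡ c + d + l * m
      lemma = solve-∀
      lemma₂ : ∀ n q l m → n + q * m + l * m ≡ (q + l) * m + n
      lemma₂ = solve-∀
      len : length (segment α a ++ σpow m 1 u ++ segment b γ) ≡ m + ν
      len = begin
        length (segment α a ++ σpow m 1 u ++ segment b γ)       ≡⟨ length-++ (segment α a) ⟩
        length (segment α a) + length (σpow m 1 u ++ segment b γ)
          ≡⟨ cong₂ _+_ (length-segment α a) (≡.trans (length-++ (σpow m 1 u))
               (cong₂ _+_ (≡.trans (length-concatMap-σ u) (cong (_* m) len-u)) (length-segment b γ))) ⟩
        dist α a + ((1 ∸ Q) * m + dist b γ)                     ≡⟨ lemma (dist α a) (dist b γ) (1 ∸ Q) m ⟩
        dist α a + dist b γ + (1 ∸ Q) * m                       ≡⟨ cong (_+ (1 ∸ Q) * m) Q≡ ⟩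
        ν + Q * m + (1 ∸ Q) * m                                 ≡⟨ lemma₂ ν Q (1 ∸ Q) m ⟩
        (Q + (1 ∸ Q)) * m + ν                                   ≡⟨ cong (λ l → l * m + ν) (m+[n∸m]≡n Q≤1) ⟩
        1 * m + ν                                               ≡⟨ cong (_+ ν) (*-identityˡ m) ⟩
        m + ν                                                   ∎

    aligned-slice : ∀ j {l} → l ≤ m → slice m (j * m) l ≡ arc (t m j) l
    aligned-slice j {l} l≤m = ≡.trans (cong (λ i → slice m i l) (sym (+-identityʳ (j * m))))
      (≡.trans (slice-arc j l≤m) (cong (λ s → arc s l) (+-identityʳ (t m j))))

    boundary-t : ∀ j l → Boundary (arc (t m j) l) (t m j ∷ []) (⟦ t m j + l ⟧ ∷ [])
    boundary-t j l = subst (λ s → Boundary (arc (t m j) l) (s ∷ []) (⟦ t m j + l ⟧ ∷ [])) (⟦⟧-small (t<m j)) (boundary-arc (t m j) l)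

    -- A factor that starts at offset r of block j uses the last m - r letters of that block, and r
    -- + ν letters remain. Either they stay within block j + 1, or they contain it entirely, as a
    -- full turn of zero derivative, and continue into block j + 2.
    onto : ∀ {U} → FactorsOfLength m (m + ν) U → ∃ λ x → ValidAt 0 x × HasBoundary U x
    onto {U} ((i , U≡) , len) with divide i
    ... | j , r , refl , r<m = onto-case (m ≤? r + ν)
      where
      open ≡-Reasoning
      α = ⟦ t m j + r ⟧
      a = t m j
      U≡′ : U ≡ arc (t m j + r) (m ∸ r) ++ slice m (suc j * m) (r + ν)
      U≡′ = begin
        U                                                                      ≡⟨ U≡ ⟩
        slice m (j * m + r) (length U)                                         ≡⟨ cong (slice m (j * m + r)) (≡.trans len split) ⟩
        slice m (j * m + r) (m ∸ r + (r + ν))                                  ≡⟨ slice-+ (j * m + r) (m ∸ r) (r + ν) ⟩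
        slice m (j * m + r) (m ∸ r) ++ slice m (j * m + r + (m ∸ r)) (r + ν)
          ≡⟨ cong₂ (λ w i → w ++ slice m i (r + ν)) (slice-arc j (≤-reflexive (m+[n∸m]≡n (<⇒≤ r<m)))) next ⟩
        arc (t m j + r) (m ∸ r) ++ slice m (suc j * m) (r + ν)                 ∎
        where
        split : m + ν ≡ m ∸ r + (r + ν)
        split = ≡.trans (cong (_+ ν) (sym (m∸n+n≡m (<⇒≤ r<m)))) (+-assoc (m ∸ r) r ν)
        next : j * m + r + (m ∸ r) ≡ suc j * m
        next = ≡.trans (+-assoc (j * m) r (m ∸ r)) (≡.trans (cong (j * m +_) (m+[n∸m]≡n (<⇒≤ r<m))) (+-comm (j * m) m))
      boundary-first : Boundary (arc (t m j + r) (m ∸ r)) (α ∷ []) (a ∷ [])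
      boundary-first = subst (λ s → Boundary (arc (t m j + r) (m ∸ r)) (α ∷ []) (s ∷ [])) (begin
        ⟦ t m j + r + (m ∸ r) ⟧       ≡⟨ cong ⟦_⟧ (≡.trans (+-assoc (t m j) r (m ∸ r)) (cong (t m j +_) (m+[n∸m]≡n (<⇒≤ r<m)))) ⟩
        ⟦ t m j + m ⟧                 ≡⟨ +m (t m j) ⟩
        ⟦ t m j ⟧                     ≡⟨ ⟦⟧-small (t<m j) ⟩
        t m j                         ∎) (boundary-arc (t m j + r) (m ∸ r))
      mk : ∀ j′ l → l ≈ r + ν → ValidAt 0 (param 0 0 α a (t m j′) ⟦ t m j′ + l ⟧)
      mk j′ l l≈ = valid (inRange (m^n>0 m K) (m^n>0 m K) (⟦⟧<m _) (t<m j) (t<m j′) (⟦⟧<m _)) 0 refl bal , refl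
        where
        lemma : ∀ a b r n → a + (b + (r + n)) + 0 ≡ n + (a + r) + b
        lemma = solve-∀
        bal : a + ⟦ t m j′ + l ⟧ + 0 ≈ ν + α + t m j′
        bal = begin
          ⟦ a + ⟦ t m j′ + l ⟧ + 0 ⟧             ≡⟨ +-cong (+-cong {a} refl (≡.trans (⟦⟧-idem (t m j′ + l)) (+-cong {t m j′} refl l≈))) refl ⟩
          ⟦ a + (t m j′ + (r + ν)) + 0 ⟧         ≡⟨ cong ⟦_⟧ (lemma a (t m j′) r ν) ⟩
          ⟦ ν + (a + r) + t m j′ ⟧               ≡⟨ +-cong (+-cong {ν} refl (⟦⟧-idem (a + r))) refl ⟨
          ⟦ ν + α + t m j′ ⟧                     ∎
      onto-case : Dec (m ≤ r + ν) → ∃ λ x → ValidAt 0 x × HasBoundary U x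
      onto-case (no r+ν<m) = _ , mk (suc j) (r + ν) refl ,
        subst (λ U → HasBoundary U (param 0 0 α a (t m (suc j)) ⟦ t m (suc j) + (r + ν) ⟧))
          (sym (≡.trans U≡′ (cong (arc (t m j + r) (m ∸ r) ++_) (aligned-slice (suc j) (<⇒≤ (≰⇒> r+ν<m))))))
          (boundary-++ boundary-first (boundary-t (suc j) (r + ν)))
      onto-case (yes m≤r+ν) = _ , mk (2 + j) l l≈ ,
        subst (λ U → HasBoundary U (param 0 0 α a (t m (2 + j)) ⟦ t m (2 + j) + l ⟧))
          (sym (≡.trans U≡′ (cong (arc (t m j + r) (m ∸ r) ++_) rest)))
          (boundary-++ boundary-first (boundary-++ (boundary-full (t m (suc j))) (boundary-t (2 + j) l)))
        where
        l = r + ν ∸ m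
        l≈ : l ≈ r + ν
        l≈ = ≡.trans (sym (+m l)) (cong ⟦_⟧ (m∸n+n≡m m≤r+ν))
        l≤m : l ≤ m
        l≤m = ≤-trans (∸-monoˡ-≤ m (+-mono-≤ (<⇒≤ r<m) (<⇒≤ ν<m))) (≤-reflexive (m+n∸n≡m m m))
        rest : slice m (suc j * m) (r + ν) ≡ σ m (t m (suc j)) ++ arc (t m (2 + j)) l
        rest = begin
          slice m (suc j * m) (r + ν)                                 ≡⟨ cong (slice m (suc j * m)) (m+[n∸m]≡n m≤r+ν) ⟨
          slice m (suc j * m) (m + l)                                 ≡⟨ slice-+ (suc j * m) m l ⟩
          slice m (suc j * m) m ++ slice m (suc j * m + m) l          ≡⟨ cong₂ (λ w i → w ++ slice m i l) (aligned-slice (suc j) ≤-refl) (+-comm (suc j * m) m) ⟩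
          σ m (t m (suc j)) ++ slice m ((2 + j) * m) l                ≡⟨ cong (σ m (t m (suc j)) ++_) (aligned-slice (2 + j) l≤m) ⟩
          σ m (t m (suc j)) ++ arc (t m (2 + j)) l                    ∎

  abelianComplexity : ∀ {N} → NumClasses _≋_ (ValidAt 0) N → AbelianComplexity m (m + ν) N
  abelianComplexity = numClasses-transfer (λ x U → HasBoundary U x) total onto
    (λ { {x} {x′} _ _ (U∈ , len) (U′∈ , len′) g g′ r → ↭⇒∼
      (↭-from-boundary g g′ (factor<m U∈) (factor<m U′∈) (_≋_.boundary≡ r) (≡.trans len (sym len′))) })
    (λ { {x} {x′} {U} {U′} v@(vx , refl) v′@(vx′ , refl) _ _ g g′ U∼U′ →
      ≋-intro refl (≡.trans (f≡f v) (sym (f≡f v′))) (λ 0≢0 → contradiction refl 0≢0) (λ f≢0 → contradiction (f≡f v) f≢0)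
        (boundary≡-intro (Valid.range vx) (Valid.range vx′) g g′ (∼⇒↭ U U′ U∼U′)) })

-- Summation over e

module Total (m : ℕ) (2≤m : 2 ≤ m) (κ ν μ : ℕ) (ν<m : ν < m) where
  open Residues m 2≤m
  open Pairs m 2≤m κ
  open Validity m 2≤m κ ν μ ν<m
  open Counting m 2≤m κ ν μ ν<m
  open Triples m 2≤m

  A : ℕ
  A = m * (1 + pred m * m)

  A-value : A ≡ m ^ 3 ∸ m ^ 2 + m
  A-value = by-pred (pred m) (suc-pred m)
    where
    by-pred : ∀ n → suc n ≡ m → A ≡ m ^ 3 ∸ m ^ 2 + m
    by-pred n refl = begin
      suc n * (1 + n * suc n)                                   ≡⟨ lemma n ⟩
      n * (suc n) ^ 2 + suc n                                   ≡⟨ cong (_+ suc n) (m+n∸m≡n (suc n ^ 2) (n * (suc n) ^ 2)) ⟨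
      (suc n ^ 2 + n * (suc n) ^ 2) ∸ suc n ^ 2 + suc n         ∎
      where
      open ≡-Reasoning
      lemma : ∀ n → suc n * (1 + n * suc n) ≡ n * (suc n * (suc n * 1)) + suc n
      lemma = solve-∀

  numClasses-total : ∀ N → (∀ {e} → e < M → NumClasses _≋_ (ValidAt e) (N e)) → NumClasses _≋_ Valid (sum (applyUpTo N M))
  numClasses-total N count = numClasses-cong (λ { (_ , _ , v , _) → v }) (λ {x} v → Param.e x , Valid.e<M v , v , refl)
    (numClasses-⋃ ValidAt N M (λ { _ _ (_ , refl) (_ , refl) → _≋_.e≡ }) count)

  sum-M : ∀ N → sum (applyUpTo N M) ≡ N 0 + sum (applyUpTo (N ∘ suc) (M ∸ 1))
  sum-M N = cong (sum ∘ applyUpTo N) (sym (suc-pred M))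

  total-μ≡0 : μ ≡ 0 → ∀ {b} → NumClasses _≋_ (ValidAt 0) b → NumClasses _≋_ Valid ((M ∸ 1) * (m ^ 3 ∸ m ^ 2 + m) + b)
  total-μ≡0 refl {b} zero-count = subst (NumClasses _≋_ Valid) value (numClasses-total N count)
    where
    N : ℕ → ℕ
    N zero    = b
    N (suc _) = A
    count : ∀ {e} → e < M → NumClasses _≋_ (ValidAt e) (N e)
    count {zero}  _   = zero-count
    count {suc e} e<M = numClasses-generic (λ ()) (m>n⇒m∸n≢0 e<M)
      where
      -- For μ = 0 and e ≠ 0 the two remainders add up to M, hence the carry 1 and a nonzero f.
      open Fixed {suc e} {M ∸ suc e} {1} e<M (∸-monoʳ-< z<s (<⇒≤ e<M)) (≡.trans (m+[n∸m]≡n (<⇒≤ e<M)) (sym (+-identityʳ M)))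
      open Generic
    value : sum (applyUpTo N M) ≡ (M ∸ 1) * (m ^ 3 ∸ m ^ 2 + m) + b
    value = begin
      sum (applyUpTo N M)                         ≡⟨ sum-M N ⟩
      b + sum (applyUpTo (λ _ → A) (M ∸ 1))       ≡⟨ cong (b +_) (sum-const A (M ∸ 1)) ⟩
      b + (M ∸ 1) * A                             ≡⟨ +-comm b _ ⟩
      (M ∸ 1) * A + b                             ≡⟨ cong (λ A → (M ∸ 1) * A + b) A-value ⟩
      (M ∸ 1) * (m ^ 3 ∸ m ^ 2 + m) + b           ∎
      where open ≡-Reasoning

  total-μ≢0 : μ < M → μ ≢ 0 → NumClasses _≋_ Valid ((M ∸ 1) * (m ^ 3 ∸ m ^ 2 + m) + m)
  total-μ≢0 μ<M μ≢0 = subst (NumClasses _≋_ Valid) (value μ refl) (numClasses-total N count)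
    where
    -- e = 0 forces f = μ, and e = μ forces f = 0. For every other e both remainders are nonzero,
    -- with carry 0 if e < μ and carry 1 if e > μ.
    N′ : ∀ {e} → Dec (e ≡ μ) → ℕ
    N′ (yes _) = m * T
    N′ (no _)  = A
    N : ℕ → ℕ
    N zero    = m * T
    N (suc e) = N′ (suc e ≟ μ)
    count : ∀ {e} → e < M → NumClasses _≋_ (ValidAt e) (N e)
    count {zero} 0<M = LeftAligned.numClasses-leftAligned 0<M μ<M μ≢0
    count {e@(suc e′)} e<M with e ≟ μ
    ... | yes e≡μ = subst (λ e → NumClasses _≋_ (ValidAt e) (m * T)) (sym e≡μ)
      (RightAligned.numClasses-rightAligned (≤-<-trans z≤n e<M) μ<M μ≢0)
    ... | no e≢μ with <-cmp e μ
    ...   | tri≈ _ e≡μ _ = contradiction e≡μ e≢μ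
    ...   | tri< e<μ _ _ = numClasses-generic (λ ()) (m>n⇒m∸n≢0 e<μ)
      where
      open Fixed {e} {μ ∸ e} {0} e<M (≤-<-trans (m∸n≤m μ e) μ<M) (≡.trans (m+[n∸m]≡n (<⇒≤ e<μ)) (sym (+-identityʳ μ)))
      open Generic
    ...   | tri> _ _ μ<e = numClasses-generic (λ ()) (m>n⇒m∸n≢0 (<-≤-trans e<M (m≤n+m M μ)))
      where
      open Fixed {e} {μ + M ∸ e} {1} e<M
        (<-≤-trans (∸-monoʳ-< μ<e (≤-trans (<⇒≤ e<M) (m≤n+m M μ))) (≤-reflexive (m+n∸m≡n μ M)))
        (≡.trans (m+[n∸m]≡n (≤-trans (<⇒≤ e<M) (m≤n+m M μ))) (cong (μ +_) (sym (+-identityʳ M))))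
      open Generic
    N-μ : ∀ {μ′} → μ ≡ suc μ′ → N (suc μ′) ≡ m * T
    N-μ {μ′} μ≡ with suc μ′ ≟ μ
    ... | yes _ = refl
    ... | no ≢μ = contradiction (sym μ≡) ≢μ
    N-≢ : ∀ {μ′ i} → μ ≡ suc μ′ → i ≢ μ′ → N (suc i) ≡ A
    N-≢ {μ′} {i} μ≡ i≢ with suc i ≟ μ
    ... | yes ≡μ = contradiction (suc-injective (≡.trans ≡μ μ≡)) i≢
    ... | no _   = refl
    -- The origin of the final summand m: both sides equal m (m² - m + 2), so the two exceptional
    -- values of e exceed one generic value by m.
    2mT : m * T + m * T ≡ A + m
    2mT = by-pred (pred m) (suc-pred m)
      where
      by-pred : ∀ n → suc n ≡ m → m * T + m * T ≡ A + m
      by-pred n eq = +-cancelʳ-≡ (m * m) _ _ (begin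
        m * T + m * T + m * m                            ≡⟨ lemma m T ⟩
        m * (2 * T + m)                                  ≡⟨ cong (m *_) T-value ⟩
        m * (m * m + 2)                                  ≡⟨ cong (λ m → m * (m * m + 2)) eq ⟨
        suc n * (suc n * suc n + 2)                      ≡⟨ lemma₂ n ⟩
        suc n * (1 + n * suc n) + suc n + suc n * suc n  ≡⟨ cong₂ (λ m n → m * (1 + n * m) + m + m * m) eq (cong pred eq) ⟩
        A + m + m * m                                    ∎)
        where
        open ≡-Reasoning
        lemma : ∀ m t → m * t + m * t + m * m ≡ m * (2 * t + m)
        lemma = solve-∀
        lemma₂ : ∀ n → suc n * (suc n * suc n + 2) ≡ suc n * (1 + n * suc n) + suc n + suc n * suc n
        lemma₂ = solve-∀
    value : ∀ μ₀ → μ₀ ≡ μ → sum (applyUpTo N M) ≡ (M ∸ 1) * (m ^ 3 ∸ m ^ 2 + m) + m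
    value zero     0≡μ = contradiction (sym 0≡μ) μ≢0
    value (suc μ′) μ≡ = +-cancelʳ-≡ A _ _ (begin
      sum (applyUpTo N M) + A                                    ≡⟨ cong (_+ A) (sum-M N) ⟩
      m * T + sum (applyUpTo (N ∘ suc) (M ∸ 1)) + A              ≡⟨ +-assoc (m * T) _ A ⟩
      m * T + (sum (applyUpTo (N ∘ suc) (M ∸ 1)) + A)            ≡⟨ cong (m * T +_) (sum-except (N ∘ suc) μ′< (N-μ (sym μ≡)) (N-≢ (sym μ≡))) ⟩
      m * T + (m * T + (M ∸ 1) * A)                              ≡⟨ +-assoc (m * T) (m * T) _ ⟨
      m * T + m * T + (M ∸ 1) * A                                ≡⟨ cong (_+ (M ∸ 1) * A) 2mT ⟩
      A + m + (M ∸ 1) * A                                        ≡⟨ lemma A m ((M ∸ 1) * A) ⟩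
      (M ∸ 1) * A + m + A                                        ≡⟨ cong (λ X → (M ∸ 1) * X + m + A) A-value ⟩
      (M ∸ 1) * (m ^ 3 ∸ m ^ 2 + m) + m + A                      ∎)
      where
      open ≡-Reasoning
      μ′< : μ′ < M ∸ 1
      μ′< = ∸-monoˡ-≤ 1 (subst (_< M) (sym μ≡) μ<M)
      lemma : ∀ a m x → a + m + x ≡ x + m + a
      lemma = solve-∀

theorem6p5 : (m k n : ℕ) → 2 ≤ m → 2 ≤ k → 2 * m ^ k ≤ n →
    (q ν μ : ℕ) → n ≡ q * m ^ k + (ν * m ^ (k ∸ 1) + μ) → ν < m → μ < m ^ (k ∸ 1) →
    (μ ≡ 0 → Σ ℕ λ b → AbelianComplexity m (m + ν) b ×
    NumClasses (Equivk m k) (PSPairs m k n) ((m ^ (k ∸ 1) ∸ 1) * (m ^ 3 ∸ m ^ 2 + m) + b)) ×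
    (μ ≢ 0 → NumClasses (Equivk m k) (PSPairs m k n) ((m ^ (k ∸ 1) ∸ 1) * (m ^ 3 ∸ m ^ 2 + m) + m))
theorem6p5 m (suc (suc κ)) n 2≤m 2≤k 2m^k≤n q ν μ n≡ ν<m μ<M =
  (λ { refl → let (b , count) = Aligned.numClasses-aligned m 2≤m κ ν ν<m in
    b , Aligned.abelianComplexity m 2≤m κ ν ν<m count , pairs (Total.total-μ≡0 m 2≤m κ ν μ ν<m refl count) }) ,
  (λ μ≢0 → pairs (Total.total-μ≢0 m 2≤m κ ν μ ν<m μ<M μ≢0))
  where
  pairs = Validity.numClasses-PSPairs m 2≤m κ ν μ ν<m μ<M q 2m^k≤n n≡
theorem6p5 m (suc zero) n 2≤m (s≤s ())
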